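{- Let $q\ge 3$ be a prime power, $n\ge 3$, and $f\in\mathrm{Per}(\mathbb{F}_q^n)\setminus\mathrm{A\Gamma L}(n,\mathbb{F}_q)$. Then \[1\text{ -coaffinity}(f)\ge 2q\genfrac{[}{]}{0pt}{0}{n-1}{1}_q=\frac{2q(q^{n-1}-1)}{q-1}.\] Moreover, letting $\tau$ be any transposition of $\mathbb{F}_q^n$, equality holds if and only if $f\in\mathrm{A\Gamma L}(n,\mathbb{F}_q)\circ\tau\circ\mathrm{A\Gamma L}(n,\mathbb{F}_q)$.
   Context: $\mathrm{Per}(\mathbb{F}_q^n)$ is the group of permutations of $\mathbb{F}_q^n$. $\mathrm{A\Gamma L}(n,\mathbb{F}_q)$ is the group of invertible semi-affine maps $x\mapsto g(x)+b$, where $b\in\mathbb{F}_q^n$ and $g$ is a bijective additive map with $g(\alpha x)=\sigma(\alpha)g(x)$ for some automorphism $\sigma$ of $\mathbb{F}_q$. A line is a coset of a $1$-dimensional subspace; $1\text{ -coaffinity}(f)$ is the number of lines $L$ with $f(L)$ not a line. A transposition interchanges two distinct points and fixes the rest. -}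

module Defs where

open import Level using (0ℓ)
open import Data.Nat using (ℕ; zero; suc; _^_) renaming (_+_ to _+ℕ_)
open import Data.Fin using (Fin)
open import Data.Vec using (Vec; zipWith; map; replicate)
open import Data.Product using (Σ; ∃; _×_; _,_)
open import Function.Bundles using (_↔_; _⇔_; Inverse)
open import Function.Definitions using (Bijective)
open import Relation.Binary.PropositionalEquality using (_≡_; _≢_)
open import Relation.Nullary using (¬_)
open import Algebra.Structures using (IsCommutativeRing)

-- A finite field with exactly q elements (propositional equality).
-- Its existence forces q to be a prime power; every F_q is such a record.
record FiniteField (q : ℕ) : Set₁ where
  infixl 6 _+_
  infixl 7 _*_
  field
    Carrier : Set
    _+_ _*_ : Carrier → Carrier → Carrier
    -_      : Carrier → Carrier
    0# 1#   : Carrier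
    isCommutativeRing : IsCommutativeRing _≡_ _+_ _*_ -_ 0# 1#
    0≢1     : 0# ≢ 1#
    inverse : ∀ x → x ≢ 0# → ∃ λ y → x * y ≡ 1#
    enum    : Carrier ↔ Fin q

-- Gaussian binomial [m choose 1]_q = 1 + q + ... + q^(m-1) = (q^m - 1)/(q - 1).
gauss1 : ℕ → ℕ → ℕ
gauss1 zero    q = 0
gauss1 (suc m) q = q ^ m +ℕ gauss1 m q

module Geometry {q : ℕ} (K : FiniteField q) (n : ℕ) where
  open FiniteField K

  Point : Set
  Point = Vec Carrier n

  _⊕_ : Point → Point → Point
  _⊕_ = zipWith _+_

  _·_ : Carrier → Point → Point
  t · v = map (t *_) v

  𝟘 : Point
  𝟘 = replicate n 0#

  IsFieldAutomorphism : (Carrier → Carrier) → Set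
  IsFieldAutomorphism σ =
    Bijective _≡_ _≡_ σ
    × (∀ x y → σ (x + y) ≡ σ x + σ y)
    × (∀ x y → σ (x * y) ≡ σ x * σ y)
    × σ 1# ≡ 1#

  IsSemiAffine : (Point → Point) → Set
  IsSemiAffine h =
    Σ (Carrier → Carrier) λ σ → IsFieldAutomorphism σ ×
    Σ (Point → Point) λ g →
      Bijective _≡_ _≡_ g
      × (∀ x y → g (x ⊕ y) ≡ g x ⊕ g y)
      × (∀ α x → g (α · x) ≡ σ α · g x)
      × Σ Point λ b → ∀ x → h x ≡ g x ⊕ b

  OnLine : Point → Point → Point → Set
  OnLine b v x = ∃ λ t → x ≡ b ⊕ (t · v)

  IsLine : (Point → Set) → Set
  IsLine S = Σ Point λ b → Σ Point λ v → v ≢ 𝟘 × (∀ x → S x ⇔ OnLine b v x)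

  Image : (Point → Point) → (Point → Set) → Point → Set
  Image f S y = ∃ λ x → S x × f x ≡ y

  BadLine : (Point → Point) → Point → Point → Set
  BadLine f b v = ¬ IsLine (Image f (OnLine b v))

  SameLine : Point → Point → Point → Point → Set
  SameLine b v b' v' = ∀ x → OnLine b v x ⇔ OnLine b' v' x

  HasCoaffinity : (Point → Point) → ℕ → Set
  HasCoaffinity f k =
    Σ (Fin k → Point) λ bs → Σ (Fin k → Point) λ vs →
      (∀ i → vs i ≢ 𝟘)
      × (∀ i → BadLine f (bs i) (vs i))
      × (∀ i j → i ≢ j → ¬ SameLine (bs i) (vs i) (bs j) (vs j))
      × (∀ b v → v ≢ 𝟘 → BadLine f b v → ∃ λ i → SameLine b v (bs i) (vs i))

  IsTransposition : (Point → Point) → Set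
  IsTransposition τ =
    Σ Point λ a → Σ Point λ c → a ≢ c × τ a ≡ c × τ c ≡ a
      × (∀ x → x ≢ a → x ≢ c → τ x ≡ x)

  InDoubleCoset : (Point → Point) → (Point → Point) → Set
  InDoubleCoset τ f =
    Σ (Point → Point) λ g → Σ (Point → Point) λ h →
      IsSemiAffine g × IsSemiAffine h × (∀ x → f x ≡ g (τ (h x)))

{-# OPTIONS --safe #-}
module Submission where

-- Call a line bad if f does not map it onto a line, and suppose that there are at most 2q[n-1] bad lines.
-- In a plane that contains a bad line L there are at least q further bad lines: otherwise some point of L
-- lies on no other bad line of the plane, and the images of the q good lines through it leave room for a
-- single line. Hence a hyperplane with a bad line contains at least 1 + q[n-2] of them, and averaging over
-- all hyperplanes yields two parallel hyperplanes without bad lines. On each of them f is, up to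
-- translation, additive (this needs n ≥ 3). A point z outside them is mapped consistently with these two
-- restrictions unless at least half of the lines joining z to the first hyperplane are bad; since bad lines
-- are few, every parallel hyperplane contains consistent points, which forces the two restrictions to have
-- the same linear part G and makes G semilinear. So f agrees with a semi-affine map h outside a small set
-- D. A line meeting D in a single point is bad, and counting such lines leaves only |D| = 0 or |D| = 2.
-- In the latter case f is h composed with a transposition and the bound is attained.

open import Defs
open import Level using (0ℓ)
open import Algebra.Bundles using (CommutativeRing)
import Algebra.Properties.AbelianGroup
import Algebra.Properties.Ring
import Algebra.Properties.Semiring.Mult.TCOptimised
import Algebra.Solver.Ring
import Algebra.Solver.Ring.AlmostCommutativeRing as ACR
open import Data.Fin using (Fin; zero; suc)
open import Data.Fin.Patterns using (0F; 1F; 2F; 3F; 4F)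
import Data.Fin.Properties as Finₚ
open import Data.Integer as ℤ using (ℤ; -[1+_])
import Data.Integer.Properties as ℤₚ
import Data.List as List
import Data.List.Membership.Propositional.Properties as Membershipₚ
import Data.List.Properties as Listₚ
open import Data.List.Membership.Propositional using (_∈_; lose; find)
open import Data.List.Relation.Unary.All as All using (All; []; _∷_)
open import Data.List.Relation.Unary.AllPairs using ([]; _∷_)
open import Data.List.Relation.Unary.Any as Any using (here; there)
open import Data.List.Relation.Unary.Unique.Propositional using (Unique)
import Data.List.Relation.Unary.Unique.Propositional.Properties as Uniqueₚ
open import Data.Maybe using (Maybe; just; nothing)
open import Data.Nat as ℕ using (ℕ; zero; suc)
import Data.Nat.Properties as ℕₚ
open import Algebra.Properties.CommutativeSemigroup ℕₚ.*-commutativeSemigroup using (x∙yz≈y∙xz)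
open import Data.Nat.Solver using (module +-*-Solver)
open import Data.Product using (Σ; ∃; _×_; _,_; proj₁; proj₂; uncurry)
open import Data.Product.Properties using (≡-dec)
import Data.Sign as Sign
open import Data.Sum using (_⊎_; inj₁; inj₂)
open import Data.Unit using (⊤)
open import Data.Vec using (Vec; []; _∷_; lookup; map; zipWith; replicate)
import Data.Vec.Functional as Functional
import Data.Vec.Properties as Vecₚ
open import Function using (_∘_; id)
open import Function.Bundles using (_↔_; _⇔_; mk⇔; Equivalence; Injection; Inverse)
import Function.Construct.Composition as Compose
open import Function.Construct.Symmetry using (↔-sym)
open import Function.Definitions using (Bijective)
open import Function.Properties.Inverse using (↔⇒↣)
open import Relation.Binary.Definitions using (DecidableEquality)
open import Relation.Binary.PropositionalEquality hiding (setoid; [_])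
open import Relation.Nullary using (¬_; Dec; yes; no; contradiction)
open import Relation.Nullary.Decidable using (map′; ¬?; decidable-stable; _×-dec_; _→-dec_)

-- The bound and the equality case come from one statement, `few⇒swap`: a map that is not
-- semi-affine and has at most the claimed number of bad lines also has at least that number and is
-- a semi-affine map with two values exchanged. A smaller number would contradict this at once.
-- Until the end no lines are counted. `W` counts pairs of a base point and a direction vector of a
-- bad line; each line has `q * (q - 1)` such pairs, so sums can be shifted, scaled and sliced by
-- functionals without choosing representatives. With `m = q^(n-1) - 1` the bound becomes
-- `2 * q * (q * m)`, the weight for two exchanged points: `q^n - q = q * m` direction vectors are
-- not multiples of the difference of these points, and for each of them the lines through one or
-- the other have `2 * q` base points. The condition q ≥ 3 supplies a scalar `α` other than 0 and 1,
-- hence a third point on every line; over two elements every permutation preserves lines. The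
-- condition n ≥ 3 enters as `q * q ≤ q^(n-1)`: hyperplanes are more than lines, and they have more
-- points than the exceptions that the counts allow.

-- Sums and counting over finite types.

module FiniteSums where
  open import Data.List using (List; []; _∷_; length; allFin; cartesianProduct) renaming (map to mapᴸ)
  open import Data.Nat using (_+_; _*_; _≤_; _<_; z≤n; s≤s)
  open import Data.Nat.ListAction using (sum)
  open import Data.Nat.ListAction.Properties using (sum-++)
  open import Data.Nat.Properties hiding (_≟_)
  open Listₚ using (map-cong; length-tabulate; map-++; map-∘)
  open Membershipₚ using (∈-allFin; ∈-cartesianProduct⁺)
  open Uniqueₚ using (allFin⁺; cartesianProduct⁺)

  𝟏 : ∀ {p} {P : Set p} → Dec P → ℕ
  𝟏 (yes _) = 1
  𝟏 (no _)  = 0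

  𝟏-yes : ∀ {p} {P : Set p} (d : Dec P) → P → 𝟏 d ≡ 1
  𝟏-yes (yes _) _ = refl
  𝟏-yes (no ¬p) p = contradiction p ¬p

  𝟏-no : ∀ {p} {P : Set p} (d : Dec P) → ¬ P → 𝟏 d ≡ 0
  𝟏-no (yes p) ¬p = contradiction p ¬p
  𝟏-no (no _)  _  = refl

  𝟏-≢0 : ∀ {p} {P : Set p} (d : Dec P) → 𝟏 d ≢ 0 → P
  𝟏-≢0 (yes p) _  = p
  𝟏-≢0 (no _)  ≢0 = contradiction refl ≢0

  𝟏-≤1 : ∀ {p} {P : Set p} (d : Dec P) → 𝟏 d ≤ 1
  𝟏-≤1 (yes _) = s≤s z≤n
  𝟏-≤1 (no _)  = z≤n

  𝟏-mono : ∀ {p r} {P : Set p} {R : Set r} (d : Dec P) (e : Dec R) → (P → R) → 𝟏 d ≤ 𝟏 e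
  𝟏-mono (no _)  _ _   = z≤n
  𝟏-mono (yes p) e P→R = ≤-reflexive (sym (𝟏-yes e (P→R p)))

  𝟏-cong : ∀ {p r} {P : Set p} {R : Set r} (d : Dec P) (e : Dec R) → (P → R) → (R → P) → 𝟏 d ≡ 𝟏 e
  𝟏-cong d e P→R R→P = ≤-antisym (𝟏-mono d e P→R) (𝟏-mono e d R→P)

  𝟏-¬ : ∀ {p} {P : Set p} (d : Dec P) → 𝟏 d + 𝟏 (¬? d) ≡ 1
  𝟏-¬ (yes _) = refl
  𝟏-¬ (no _)  = refl

  *-≢0ˡ : ∀ x {y} → x * y ≢ 0 → x ≢ 0
  *-≢0ˡ .0 ≢0 refl = ≢0 refl

  *-≢0ʳ : ∀ x {y} → x * y ≢ 0 → y ≢ 0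
  *-≢0ʳ x ≢0 refl = ≢0 (*-zeroʳ x)

  record Finite (A : Set) : Set where
    infix 4 _≟_
    field
      elements : List A
      complete : ∀ x → x ∈ elements
      unique   : Unique elements
      _≟_  : DecidableEquality A

  open Finite ⦃ ... ⦄ public using (elements; complete; unique; _≟_)

  private variable
    A B : Set

  -- Abstract, so that unification can recover the index type of a sum.
  abstract
    card : (A : Set) → ⦃ Finite A ⦄ → ℕ
    card A = length (elements {A})

    ∑ : ⦃ Finite A ⦄ → (A → ℕ) → ℕ
    ∑ f = sum (mapᴸ f elements)

  private
    sum-mono : ∀ (xs : List A) {f g} → (∀ x → f x ≤ g x) → sum (mapᴸ f xs) ≤ sum (mapᴸ g xs)
    sum-mono []  f≤g = z≤n
    sum-mono (x ∷ xs) f≤g = +-mono-≤ (f≤g x) (sum-mono xs f≤g)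

    sum-+ : ∀ (xs : List A) f g → sum (mapᴸ (λ x → f x + g x) xs) ≡ sum (mapᴸ f xs) + sum (mapᴸ g xs)
    sum-+ []  f g = refl
    sum-+ (x ∷ xs) f g rewrite sum-+ xs f g =
      solve 4 (λ a b c d → (a :+ b) :+ (c :+ d) := (a :+ c) :+ (b :+ d)) refl (f x) (g x) _ _
      where open +-*-Solver

    sum-* : ∀ (xs : List A) c f → sum (mapᴸ (λ x → c * f x) xs) ≡ c * sum (mapᴸ f xs)
    sum-* []  c f = sym (*-zeroʳ c)
    sum-* (x ∷ xs) c f rewrite sum-* xs c f = sym (*-distribˡ-+ c (f x) _)

    sum-const : ∀ (xs : List A) c → sum (mapᴸ (λ _ → c) xs) ≡ length xs * c
    sum-const []  c = refl
    sum-const (_ ∷ xs) c = cong (c +_) (sum-const xs c)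

    sum-swap : ∀ (xs : List A) (ys : List B) (f : A → B → ℕ) →
      sum (mapᴸ (λ x → sum (mapᴸ (f x) ys)) xs) ≡ sum (mapᴸ (λ y → sum (mapᴸ (λ x → f x y) xs)) ys)
    sum-swap []  ys f = sym (trans (sum-const ys 0) (*-zeroʳ (length ys)))
    sum-swap (x ∷ xs) ys f rewrite sum-swap xs ys f = sym (sum-+ ys (f x) _)

    sum-zero : ∀ (xs : List A) {f} → All (λ x → f x ≡ 0) xs → sum (mapᴸ f xs) ≡ 0
    sum-zero []  []  = refl
    sum-zero (x ∷ xs) (p ∷ ps) rewrite p = sum-zero xs ps

    sum-term : ∀ {xs : List A} f {x} → x ∈ xs → f x ≤ sum (mapᴸ f xs)
    sum-term f (here refl) = m≤m+n _ _
    sum-term f (there x∈)  = ≤-trans (sum-term f x∈) (m≤n+m _ _)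

    -- Once a term is nonzero, uniqueness of the list makes every later term vanish, so the sum is
    -- that single term.
    sum-atMostOne : ∀ (xs : List A) {f m} → Unique xs → (∀ x y → f x ≢ 0 → f y ≢ 0 → x ≡ y) →
      (∀ x → f x ≤ m) → sum (mapᴸ f xs) ≤ m
    sum-atMostOne []  _  _ _ = z≤n
    sum-atMostOne (x ∷ xs) {f} (x∉ ∷ u) one f≤m with f x ℕ.≟ 0
    ... | yes fx≡0 rewrite fx≡0 = sum-atMostOne xs u one f≤m
    ... | no fx≢0 rewrite sum-zero xs {f}
            (All.map (λ {y} x≢y → decidable-stable (f y ℕ.≟ 0) (x≢y ∘ one x y fx≢0)) x∉)
          = ≤-trans (≤-reflexive (+-identityʳ _)) (f≤m x)

  module _ ⦃ _ : Finite A ⦄ where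

    abstract
      ∑-cong : ∀ {f g : A → ℕ} → (∀ x → f x ≡ g x) → ∑ f ≡ ∑ g
      ∑-cong f≗g = cong sum (map-cong f≗g elements)

      ∑-mono : ∀ {f g : A → ℕ} → (∀ x → f x ≤ g x) → ∑ f ≤ ∑ g
      ∑-mono = sum-mono elements

      ∑-+ : ∀ (f g : A → ℕ) → ∑ (λ x → f x + g x) ≡ ∑ f + ∑ g
      ∑-+ = sum-+ elements

      ∑-* : ∀ c (f : A → ℕ) → ∑ (λ x → c * f x) ≡ c * ∑ f
      ∑-* = sum-* elements

      ∑-const : ∀ c → ∑ {A} (λ _ → c) ≡ card A * c
      ∑-const = sum-const elements

      term≤∑ : ∀ (f : A → ℕ) x → f x ≤ ∑ f
      term≤∑ f x = sum-term f (complete x)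

      ∑-atMostOne : ∀ {f : A → ℕ} {m} → (∀ x y → f x ≢ 0 → f y ≢ 0 → x ≡ y) → (∀ x → f x ≤ m) → ∑ f ≤ m
      ∑-atMostOne = sum-atMostOne elements unique

    -- Read from right to left this introduces a new summation variable, which `∑-swap` then moves
    -- outwards; `∑-fibres` and `∑-levels` start in this way.
    ∑-δ : ∀ (x : A) (g : A → ℕ) → ∑ (λ y → 𝟏 (x ≟ y) * g y) ≡ g x
    ∑-δ x g = ≤-antisym (∑-atMostOne only bound)
      (≤-trans (≤-reflexive (sym at-x)) (term≤∑ (λ y → 𝟏 (x ≟ y) * g y) x))
      where
      at-x : 𝟏 (x ≟ x) * g x ≡ g x
      at-x = trans (cong (_* g x) (𝟏-yes (x ≟ x) refl)) (*-identityˡ (g x))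
      only : ∀ y z → 𝟏 (x ≟ y) * g y ≢ 0 → 𝟏 (x ≟ z) * g z ≢ 0 → y ≡ z
      only y z p r = trans (sym (𝟏-≢0 (x ≟ y) (*-≢0ˡ _ p))) (𝟏-≢0 (x ≟ z) (*-≢0ˡ _ r))
      bound : ∀ y → 𝟏 (x ≟ y) * g y ≤ g x
      bound y with x ≟ y
      ... | yes refl = ≤-reflexive (*-identityˡ (g x))
      ... | no _  = z≤n

    -- The exceptional term is traded for `c` on both sides, which avoids subtraction. It serves
    -- averages in which one index, the zero functional or a single level, escapes the bound.
    ∑-except : ∀ (x₀ : A) c (g : A → ℕ) → (∀ x → x ≢ x₀ → c ≤ g x) → card A * c + g x₀ ≤ ∑ g + c
    ∑-except x₀ c g c≤g = begin
      card A * c + g x₀  ≡⟨ cong₂ _+_ (∑-const c) (∑-δ x₀ g) ⟨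
      ∑ {A} (λ _ → c) + ∑ (λ x → 𝟏 (x₀ ≟ x) * g x)  ≡⟨ ∑-+ (λ _ → c) _ ⟨
      ∑ (λ x → c + 𝟏 (x₀ ≟ x) * g x)  ≤⟨ ∑-mono pointwise ⟩
      ∑ (λ x → g x + 𝟏 (x₀ ≟ x) * c)  ≡⟨ ∑-+ g _ ⟩
      ∑ g + ∑ (λ x → 𝟏 (x₀ ≟ x) * c)  ≡⟨ cong (∑ g +_) (∑-δ x₀ (λ _ → c)) ⟩
      ∑ g + c ∎
      where
      open ≤-Reasoning
      pointwise : ∀ x → c + 𝟏 (x₀ ≟ x) * g x ≤ g x + 𝟏 (x₀ ≟ x) * c
      pointwise x with x₀ ≟ x
      ... | yes _ rewrite *-identityˡ (g x) | *-identityˡ c = ≤-reflexive (+-comm c (g x))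
      ... | no x₀≢x = +-monoˡ-≤ 0 (c≤g x (x₀≢x ∘ sym))

    abstract
      ∃? : ∀ {p} {P : A → Set p} → (∀ x → Dec (P x)) → Dec (∃ P)
      ∃? P? = map′ (λ p → let (x , _ , px) = find p in x , px) (λ (x , px) → lose (complete x) px) (Any.any? P? elements)

      ∀? : ∀ {p} {P : A → Set p} → (∀ x → Dec (P x)) → Dec (∀ x → P x)
      ∀? P? = map′ (λ ps x → All.lookup ps (complete x)) (λ p → All.tabulate (λ {x} _ → p x)) (All.all? P? elements)

      ¬∀⇒∃¬ : ∀ {p} {P : A → Set p} → (∀ x → Dec (P x)) → ¬ (∀ x → P x) → ∃ λ x → ¬ P x
      ¬∀⇒∃¬ P? ¬∀ with ∃? (λ x → ¬? (P? x))
      ... | yes e = e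
      ... | no ¬e = contradiction (λ x → decidable-stable (P? x) (λ ¬px → ¬e (x , ¬px))) ¬∀

  module _ ⦃ _ : Finite A ⦄ ⦃ _ : Finite B ⦄ where

    abstract
      ∑-swap : ∀ (f : A → B → ℕ) → ∑ (λ x → ∑ (f x)) ≡ ∑ (λ y → ∑ (λ x → f x y))
      ∑-swap = sum-swap elements elements

    private
      ∑-fibres : ∀ (φ : A → B) (χ : A → ℕ) → ∑ χ ≡ ∑ (λ y → ∑ (λ x → 𝟏 (φ x ≟ y) * χ x))
      ∑-fibres φ χ = trans (∑-cong (λ x → sym (∑-δ (φ x) (λ _ → χ x)))) (∑-swap (λ x y → 𝟏 (φ x ≟ y) * χ x))

    -- Injectivity is needed only where `χ` is nonzero, since each fibre of `φ` then has at most one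
    -- contributing term. So indicator sums can be compared along maps that are injective only on
    -- the set indicated.
    ∑-≤-injective : ∀ (φ : A → B) {χ g} → (∀ x → χ x ≤ g (φ x)) →
      (∀ x y → χ x ≢ 0 → χ y ≢ 0 → φ x ≡ φ y → x ≡ y) → ∑ χ ≤ ∑ g
    ∑-≤-injective φ {χ} {g} χ≤g inj = ≤-trans (≤-reflexive (∑-fibres φ χ))
      (∑-mono λ y → ∑-atMostOne (only y) (bound y))
      where
      only : ∀ y x x′ → 𝟏 (φ x ≟ y) * χ x ≢ 0 → 𝟏 (φ x′ ≟ y) * χ x′ ≢ 0 → x ≡ x′
      only y x x′ p r = inj x x′ (*-≢0ʳ (𝟏 (φ x ≟ y)) p) (*-≢0ʳ (𝟏 (φ x′ ≟ y)) r)
        (trans (𝟏-≢0 (φ x ≟ y) (*-≢0ˡ _ p)) (sym (𝟏-≢0 (φ x′ ≟ y) (*-≢0ˡ _ r))))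
      bound : ∀ y x → 𝟏 (φ x ≟ y) * χ x ≤ g y
      bound y x with φ x ≟ y
      ... | yes refl = ≤-trans (≤-reflexive (*-identityˡ (χ x))) (χ≤g x)
      ... | no _  = z≤n

    ∑-≤-surjective : ∀ (φ : A → B) {χ g} → (∀ y → g y ≢ 0 → ∃ λ x → φ x ≡ y × g y ≤ χ x) → ∑ g ≤ ∑ χ
    ∑-≤-surjective φ {χ} {g} sur = ≤-trans (∑-mono covered) (≤-reflexive (sym (∑-fibres φ χ)))
      where
      covered : ∀ y → g y ≤ ∑ (λ x → 𝟏 (φ x ≟ y) * χ x)
      covered y with g y ℕ.≟ 0
      ... | yes g≡0 = ≤-trans (≤-reflexive g≡0) z≤n
      ... | no g≢0 with sur y g≢0
      ... | x , φx≡y , g≤χ = ≤-trans (≤-trans g≤χ (≤-reflexive (sym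
              (trans (cong (_* χ x) (𝟏-yes (φ x ≟ y) φx≡y)) (*-identityˡ (χ x))))))
            (term≤∑ (λ x → 𝟏 (φ x ≟ y) * χ x) x)

    ∑-reindex : ∀ (φ : A → B) (ψ : B → A) → (∀ x → ψ (φ x) ≡ x) → (∀ y → φ (ψ y) ≡ y) →
      ∀ (g : B → ℕ) → ∑ (λ x → g (φ x)) ≡ ∑ g
    ∑-reindex φ ψ ψφ φψ g = ≤-antisym
      (∑-≤-injective φ (λ _ → ≤-refl) (λ x y _ _ e → trans (sym (ψφ x)) (trans (cong ψ e) (ψφ y))))
      (∑-≤-surjective φ (λ y _ → ψ y , φψ y , ≤-reflexive (cong g (sym (φψ y)))))

    instance
      Finite-× : Finite (A × B)
      Finite-× = record
        { elements = cartesianProduct elements elements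
        ; complete = λ (x , y) → ∈-cartesianProduct⁺ (complete x) (complete y)
        ; unique   = cartesianProduct⁺ unique unique
        ; _≟_  = ≡-dec _≟_ _≟_
        }

    abstract
      ∑-× : ∀ (f : A → B → ℕ) → ∑ (uncurry f) ≡ ∑ (λ x → ∑ (f x))
      ∑-× f = go elements
        where
        go : ∀ xs → sum (mapᴸ (uncurry f) (cartesianProduct xs elements)) ≡ sum (mapᴸ (λ x → ∑ (f x)) xs)
        go [] = refl
        go (x ∷ xs) = trans
          (cong sum (map-++ (uncurry f) (mapᴸ (x ,_) elements) (cartesianProduct xs elements)))
          (trans (sum-++ (mapᴸ (uncurry f) (mapᴸ (x ,_) elements)) _)
                 (cong₂ _+_ (cong sum (sym (map-∘ (elements {B})))) (go xs)))

  ∑-≢ : ⦃ _ : Finite A ⦄ (y : A) → suc (∑ (λ z → 𝟏 (¬? (y ≟ z)))) ≡ card A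
  ∑-≢ {A} y = begin
    1 + ∑ (λ z → 𝟏 (¬? (y ≟ z)))  ≡⟨ cong (_+ ∑ (λ z → 𝟏 (¬? (y ≟ z)))) (∑-δ y (λ _ → 1)) ⟨
    ∑ (λ z → 𝟏 (y ≟ z) * 1) + ∑ (λ z → 𝟏 (¬? (y ≟ z)))   ≡⟨ ∑-+ (λ z → 𝟏 (y ≟ z) * 1) _ ⟨
    ∑ (λ z → 𝟏 (y ≟ z) * 1 + 𝟏 (¬? (y ≟ z)))  ≡⟨ ∑-cong (λ z → trans (cong (_+ 𝟏 (¬? (y ≟ z))) (*-identityʳ (𝟏 (y ≟ z)))) (𝟏-¬ (y ≟ z))) ⟩
    ∑ (λ _ → 1)  ≡⟨ ∑-const 1 ⟩
    card A * 1  ≡⟨ *-identityʳ _ ⟩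
    card A ∎
    where open ≡-Reasoning

  private
    -- If `y` were missed, `φ` would inject all of `A` into the complement of `y`, which by `∑-≢` is
    -- one element short.
    pigeonhole : ⦃ _ : Finite A ⦄ (φ : A → A) → (∀ x y → φ x ≡ φ y → x ≡ y) → ∀ y → ∃ λ x → φ x ≡ y
    pigeonhole {A} φ inj y with ∃? (λ x → φ x ≟ y)
    ... | yes e = e
    ... | no ¬e = contradiction too-many (<⇒≱ (≤-reflexive (trans (∑-≢ y) (sym (*-identityʳ _)))))
      where
      too-many : card A * 1 ≤ ∑ (λ z → 𝟏 (¬? (y ≟ z)))
      too-many = ≤-trans (≤-reflexive (sym (∑-const 1))) (∑-≤-injective φ
        (λ x → ≤-reflexive (sym (𝟏-yes (¬? (y ≟ φ x)) (λ y≡ → ¬e (x , sym y≡)))))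
        (λ x x′ _ _ → inj x x′))

  abstract
    injective⇒surjective : ⦃ _ : Finite A ⦄ (φ : A → A) → (∀ x y → φ x ≡ φ y → x ≡ y) → ∀ y → ∃ λ x → φ x ≡ y
    injective⇒surjective = pigeonhole

  instance
    Finite-Fin : ∀ {n} → Finite (Fin n)
    Finite-Fin = record { elements = allFin _ ; complete = ∈-allFin ; unique = allFin⁺ _ ; _≟_ = Finₚ._≟_ }

  abstract
    card-Fin : ∀ n → card (Fin n) ≡ n
    card-Fin n = length-tabulate {n = n} id

  module Representatives ⦃ _ : Finite A ⦄ {_~_ : A → A → Set} (_~?_ : ∀ x y → Dec (x ~ y))
    (~-refl : ∀ {x} → x ~ x) (~-sym : ∀ {x y} → x ~ y → y ~ x) (~-trans : ∀ {x y z} → x ~ y → y ~ z → x ~ z)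
    {P : A → Set} (P? : ∀ x → Dec (P x)) (P-resp : ∀ {x y} → x ~ y → P x → P y) where

    -- Coverage is asked only for the elements of `xs`, so that `build` can extend the system along
    -- the list. The fields have the shape of `HasCoaffinity`.
    record Transversal (k : ℕ) (xs : List A) : Set where
      field
        rep  : Fin k → A
        rep-P  : ∀ i → P (rep i)
        distinct : ∀ i j → i ≢ j → ¬ (rep i ~ rep j)
        covers   : ∀ x → x ∈ xs → P x → ∃ λ i → x ~ rep i

    private
      build : ∀ xs → ∃ λ k → Transversal k xs
      build [] = 0 , record { rep = λ () ; rep-P = λ () ; distinct = λ () ; covers = λ _ () }
      build (x ∷ xs) with build xs
      ... | k , T with P? x | ∃? (λ i → x ~? Transversal.rep T i)
      ... | no ¬px | _ = k , record { Transversal T hiding (covers) ; covers = cov }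
        where
        open Transversal T
        cov : ∀ y → y ∈ x ∷ xs → P y → ∃ λ i → y ~ rep i
        cov y (here refl) py = contradiction py ¬px
        cov y (there y∈)  py = covers y y∈ py
      ... | yes _ | yes e = k , record { Transversal T hiding (covers) ; covers = cov }
        where
        open Transversal T
        cov : ∀ y → y ∈ x ∷ xs → P y → ∃ λ i → y ~ rep i
        cov y (here refl) py = e
        cov y (there y∈)  py = covers y y∈ py
      ... | yes px | no ¬e = suc k , record
            { rep = x Functional.∷ rep
            ; rep-P = λ { zero → px ; (suc i) → rep-P i }
            ; distinct = λ { zero zero ne _ → ne refl
                           ; zero (suc j) _ s → ¬e (j , s)
                           ; (suc i) zero _ s → ¬e (i , ~-sym s)
                           ; (suc i) (suc j) ne → distinct i j (ne ∘ cong suc) }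
            ; covers = cov }
        where
        open Transversal T
        cov : ∀ y → y ∈ x ∷ xs → P y → ∃ λ i → y ~ (x Functional.∷ rep) i
        cov y (here refl) py = zero , ~-refl
        cov y (there y∈)  py = let (i , s) = covers y y∈ py in suc i , s

    transversal : ∃ λ k → Transversal k elements
    transversal = build elements

    -- Every element with `P` is equivalent to exactly one representative, so its indicator splits
    -- over the representatives and the two sums can be exchanged.
    ∑-classes : ∀ {k} (T : Transversal k elements) {m} →
      (∀ x → P x → ∑ (λ y → 𝟏 (y ~? x)) ≡ m) → ∑ (λ x → 𝟏 (P? x)) ≡ k * m
    ∑-classes {k} T {m} class = begin
      ∑ (λ x → 𝟏 (P? x))  ≡⟨ ∑-cong split ⟩
      ∑ (λ x → ∑ (λ i → 𝟏 (x ~? rep i)))  ≡⟨ ∑-swap _ ⟩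
      ∑ (λ i → ∑ (λ x → 𝟏 (x ~? rep i)))  ≡⟨ ∑-cong (λ i → class (rep i) (rep-P i)) ⟩
      ∑ {Fin k} (λ _ → m)  ≡⟨ ∑-const {Fin k} m ⟩
      card (Fin k) * m  ≡⟨ cong (_* m) (card-Fin k) ⟩
      k * m ∎
      where
      open Transversal T
      open ≡-Reasoning
      same : ∀ {x} i j → x ~ rep i → x ~ rep j → i ≡ j
      same i j s t = decidable-stable (i ≟ j) (λ i≢j → distinct i j i≢j (~-trans (~-sym s) t))
      split : ∀ x → 𝟏 (P? x) ≡ ∑ (λ i → 𝟏 (x ~? rep i))
      split x with P? x
      ... | yes px = let (i , s) = covers x (complete x) px in ≤-antisym
              (≤-trans (≤-reflexive (sym (𝟏-yes (x ~? rep i) s))) (term≤∑ (λ i → 𝟏 (x ~? rep i)) i))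
              (∑-atMostOne (λ i j p r → same i j (𝟏-≢0 (x ~? rep i) p) (𝟏-≢0 (x ~? rep j) r)) (λ i → 𝟏-≤1 (x ~? rep i)))
      ... | no ¬px = sym (trans (∑-cong (λ i → 𝟏-no (x ~? rep i) (λ s → ¬px (P-resp (~-sym s) (rep-P i))))) (trans (∑-const {Fin k} 0) (*-zeroʳ (card (Fin k)))))

open FiniteSums

-- A ring solver with integer coefficients.

module IntegerCoefficients (R : CommutativeRing 0ℓ 0ℓ) where
  open CommutativeRing R hiding (zero) renaming (sym to ≈-sym; trans to ≈-trans; refl to ≈-refl)
  open Algebra.Properties.Ring ring using (-‿distribˡ-*; -0#≈0#; -‿involutive)
  open Algebra.Properties.AbelianGroup +-abelianGroup using (⁻¹-∙-comm)
  open Algebra.Properties.Semiring.Mult.TCOptimised semiring renaming (_×_ to _×′_)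
  open import Relation.Binary.Reasoning.Setoid setoid

  open import Data.Integer using (+_)

  -- Integer coefficients compute, so normal forms can be compared by `refl`; constants of an
  -- abstract field would block this. With the optimised multiple `_×′_` the integers 0 and 1
  -- evaluate to `0#` and `1#` by definition.
  ⟦_⟧ℤ : ℤ → Carrier
  ⟦ + n ⟧ℤ  = n ×′ 1#
  ⟦ -[1+ n ] ⟧ℤ = - (suc n ×′ 1#)

  private
    sgn : Sign.Sign → Carrier
    sgn Sign.+ = 1#
    sgn Sign.- = - 1#

    sgn-* : ∀ s t → sgn (s Sign.* t) ≈ sgn s * sgn t
    sgn-* Sign.+ t  = ≈-sym (*-identityˡ (sgn t))
    sgn-* Sign.- Sign.+ = ≈-sym (*-identityʳ (- 1#))
    sgn-* Sign.- Sign.- = begin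
      1#  ≈⟨ -‿involutive 1# ⟨
      - (- 1#)  ≈⟨ -‿cong (*-identityˡ (- 1#)) ⟨
      - (1# * - 1#)  ≈⟨ -‿distribˡ-* 1# (- 1#) ⟩
      - 1# * - 1#  ∎

    -‿sgn : ∀ x → - x ≈ sgn Sign.- * x
    -‿sgn x = ≈-trans (-‿cong (≈-sym (*-identityˡ x))) (-‿distribˡ-* 1# x)

    ◃-homo : ∀ s n → ⟦ s ℤ.◃ n ⟧ℤ ≈ sgn s * (n ×′ 1#)
    ◃-homo s  zero  = ≈-sym (zeroʳ (sgn s))
    ◃-homo Sign.+ (suc n) = ≈-sym (*-identityˡ _)
    ◃-homo Sign.- (suc n) = -‿sgn _

    ∣∣-homo : ∀ i → ⟦ i ⟧ℤ ≈ sgn (ℤ.sign i) * (ℤ.∣ i ∣ ×′ 1#)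
    ∣∣-homo (+ n)  = ≈-sym (*-identityˡ _)
    ∣∣-homo -[1+ n ] = -‿sgn _

  *-homo : ∀ i j → ⟦ i ℤ.* j ⟧ℤ ≈ ⟦ i ⟧ℤ * ⟦ j ⟧ℤ
  *-homo i j = begin
    ⟦ i ℤ.* j ⟧ℤ  ≈⟨ ◃-homo (si Sign.* sj) (m ℕ.* n) ⟩
    sgn (si Sign.* sj) * ((m ℕ.* n) ×′ 1#)  ≈⟨ *-cong (sgn-* si sj) (×1-homo-* m n) ⟩
    (sgn si * sgn sj) * ((m ×′ 1#) * (n ×′ 1#))  ≈⟨ *-assoc _ _ _ ⟩
    sgn si * (sgn sj * ((m ×′ 1#) * (n ×′ 1#)))  ≈⟨ *-congˡ (≈-trans (≈-sym (*-assoc _ _ _)) (≈-trans (*-congʳ (*-comm _ _)) (*-assoc _ _ _))) ⟩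
    sgn si * ((m ×′ 1#) * (sgn sj * (n ×′ 1#)))  ≈⟨ *-assoc _ _ _ ⟨
    (sgn si * (m ×′ 1#)) * (sgn sj * (n ×′ 1#))  ≈⟨ *-cong (∣∣-homo i) (∣∣-homo j) ⟨
    ⟦ i ⟧ℤ * ⟦ j ⟧ℤ ∎
    where
    si sj : Sign.Sign
    si = ℤ.sign i
    sj = ℤ.sign j
    m n : ℕ
    m = ℤ.∣ i ∣
    n = ℤ.∣ j ∣

  private
    ⊖-homo : ∀ m n → ⟦ m ℤ.⊖ n ⟧ℤ ≈ m ×′ 1# + - (n ×′ 1#)
    ⊖-homo zero  zero  = ≈-sym (-‿inverseʳ 0#)
    ⊖-homo zero  (suc n) = ≈-sym (+-identityˡ _)
    ⊖-homo (suc m) zero  = ≈-sym (≈-trans (+-congˡ -0#≈0#) (+-identityʳ _))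
    ⊖-homo (suc m) (suc n) = begin
      ⟦ suc m ℤ.⊖ suc n ⟧ℤ  ≡⟨ cong ⟦_⟧ℤ (ℤₚ.[1+m]⊖[1+n]≡m⊖n m n) ⟩
      ⟦ m ℤ.⊖ n ⟧ℤ  ≈⟨ ⊖-homo m n ⟩
      a + - b  ≈⟨ +-congʳ (+-identityˡ a) ⟨
      (0# + a) + - b  ≈⟨ +-congʳ (+-congʳ (-‿inverseʳ 1#)) ⟨
      ((1# + - 1#) + a) + - b  ≈⟨ +-congʳ (+-assoc _ _ _) ⟩
      (1# + (- 1# + a)) + - b  ≈⟨ +-congʳ (+-congˡ (+-comm _ _)) ⟩
      (1# + (a + - 1#)) + - b  ≈⟨ +-congʳ (+-assoc _ _ _) ⟨
      ((1# + a) + - 1#) + - b  ≈⟨ +-assoc _ _ _ ⟩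
      (1# + a) + (- 1# + - b)  ≈⟨ +-congˡ (⁻¹-∙-comm 1# b) ⟩
      (1# + a) + - (1# + b)  ≈⟨ +-cong (1+× m 1#) (-‿cong (1+× n 1#)) ⟨
      suc m ×′ 1# + - (suc n ×′ 1#) ∎
      where
      a b : Carrier
      a = m ×′ 1#
      b = n ×′ 1#

  +-homo : ∀ i j → ⟦ i ℤ.+ j ⟧ℤ ≈ ⟦ i ⟧ℤ + ⟦ j ⟧ℤ
  +-homo (+ m)  (+ n)  = ×-homo-+ 1# m n
  +-homo (+ m)  -[1+ n ] = ⊖-homo m (suc n)
  +-homo -[1+ m ] (+ n)  = ≈-trans (⊖-homo n (suc m)) (+-comm _ _)
  +-homo -[1+ m ] -[1+ n ] = begin
    - (suc (suc (m ℕ.+ n)) ×′ 1#)  ≡⟨ cong (λ k → - (suc k ×′ 1#)) (ℕₚ.+-suc m n) ⟨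
    - ((suc m ℕ.+ suc n) ×′ 1#)  ≈⟨ -‿cong (×-homo-+ 1# (suc m) (suc n)) ⟩
    - (suc m ×′ 1# + suc n ×′ 1#)  ≈⟨ ⁻¹-∙-comm _ _ ⟨
    - (suc m ×′ 1#) + - (suc n ×′ 1#)  ∎

  -‿homo : ∀ i → ⟦ ℤ.- i ⟧ℤ ≈ - ⟦ i ⟧ℤ
  -‿homo (+ zero)  = ≈-sym -0#≈0#
  -‿homo (+ suc n) = ≈-refl
  -‿homo -[1+ n ]  = ≈-sym (-‿involutive _)

  almostRing : ACR.AlmostCommutativeRing 0ℓ 0ℓ
  almostRing = ACR.fromCommutativeRing R

  morphism : ℤ.+-*-rawRing ACR.-Raw-AlmostCommutative⟶ almostRing
  morphism = record { ⟦_⟧ = ⟦_⟧ℤ ; +-homo = +-homo ; *-homo = *-homo ; -‿homo = -‿homo ; 0-homo = ≈-refl ; 1-homo = ≈-refl }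

  _coeff≟_ : ∀ i j → Maybe (⟦ i ⟧ℤ ≈ ⟦ j ⟧ℤ)
  i coeff≟ j with i ℤ.≟ j
  ... | yes refl = just ≈-refl
  ... | no _  = nothing

  open Algebra.Solver.Ring ℤ.+-*-rawRing almostRing morphism _coeff≟_ public

-- The coordinate spaces of the theorem, presented by their operations and laws only, so that
-- comparing two vector terms never unfolds into coordinates.
record Space {q} (K : FiniteField q) (n : ℕ) : Set₁ where
  open FiniteField K
  field
    Point  : Set
    _⊕_  : Point → Point → Point
    _·_  : Carrier → Point → Point
    𝟘  : Point
    ⊕-assoc  : ∀ u v w → (u ⊕ v) ⊕ w ≡ u ⊕ (v ⊕ w)
    ⊕-comm  : ∀ v w → v ⊕ w ≡ w ⊕ v
    𝟘⊕  : ∀ v → 𝟘 ⊕ v ≡ v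
    ·-distribˡ : ∀ s v w → s · (v ⊕ w) ≡ (s · v) ⊕ (s · w)
    ·-distribʳ : ∀ s t v → (s + t) · v ≡ (s · v) ⊕ (t · v)
    ·-·  : ∀ s t v → s · (t · v) ≡ (s * t) · v
    1·  : ∀ v → 1# · v ≡ v
    0·  : ∀ v → 0# · v ≡ 𝟘
    ·𝟘  : ∀ s → s · 𝟘 ≡ 𝟘
    ⦃ finite ⦄ : Finite Point
    card-Point : card Point ≡ q ℕ.^ n
    _∙_  : Point → Point → Carrier
    ∙-comm : ∀ a b → a ∙ b ≡ b ∙ a
    ∙-⊕  : ∀ a u v → a ∙ (u ⊕ v) ≡ a ∙ u + a ∙ v
    ∙-·  : ∀ a t v → a ∙ (t · v) ≡ t * (a ∙ v)
    ∙-nondegenerate : ∀ a → a ≢ 𝟘 → ∃ λ u → a ∙ u ≡ 1#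

-- Deciding identities between scalars and between vectors.

module FieldSolver {q} (K : FiniteField q) where
  open FiniteField K

  commutativeRing : CommutativeRing 0ℓ 0ℓ
  commutativeRing = record { isCommutativeRing = isCommutativeRing }

  open IntegerCoefficients commutativeRing public
    using (Polynomial; con; var; :-_; _:+_; _:*_; _:-_; _:=_; prove; solve; ⟦_⟧; ⟦_⟧N; normalise)

module VectorSolver {q} {K : FiniteField q} {n} (S : Space K n) where
  open FiniteField K
  open FieldSolver K
  open Space S

  infixl 6 _⊞_
  infixl 7 _⊡_

  data Expr (k m : ℕ) : Set where
    vec  : Fin m → Expr k m
    𝟎  : Expr k m
    _⊞_  : Expr k m → Expr k m → Expr k m
    _⊡_  : Polynomial k → Expr k m → Expr k m

  ⟦_⟧ᵛ : ∀ {k m} → Expr k m → Vec Carrier k → Vec Point m → Point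
  ⟦ vec i ⟧ᵛ ρ θ   = lookup θ i
  ⟦ 𝟎 ⟧ᵛ ρ θ  = 𝟘
  ⟦ e ⊞ e′ ⟧ᵛ ρ θ  = ⟦ e ⟧ᵛ ρ θ ⊕ ⟦ e′ ⟧ᵛ ρ θ
  ⟦ s ⊡ e ⟧ᵛ ρ θ   = ⟦ s ⟧ ρ · ⟦ e ⟧ᵛ ρ θ

  -- An expression is linear in its vector variables, so one polynomial in the scalars for each of
  -- them determines its value.
  coefficient : ∀ {k m} → Expr k m → Fin m → Polynomial k
  coefficient (vec zero)  zero  = con (ℤ.+ 1)
  coefficient (vec zero)  (suc _) = con (ℤ.+ 0)
  coefficient (vec (suc _)) zero  = con (ℤ.+ 0)
  coefficient (vec (suc i)) (suc j) = coefficient (vec i) j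
  coefficient 𝟎  _  = con (ℤ.+ 0)
  coefficient (e ⊞ e′)  j  = coefficient e j :+ coefficient e′ j
  coefficient (s ⊡ e)  j  = s :* coefficient e j

  private
    ⊕𝟘 : ∀ v → v ⊕ 𝟘 ≡ v
    ⊕𝟘 v = trans (⊕-comm v 𝟘) (𝟘⊕ v)

    interchange : ∀ a b c d → (a ⊕ b) ⊕ (c ⊕ d) ≡ (a ⊕ c) ⊕ (b ⊕ d)
    interchange a b c d = begin
      (a ⊕ b) ⊕ (c ⊕ d)   ≡⟨ ⊕-assoc a b (c ⊕ d) ⟩
      a ⊕ (b ⊕ (c ⊕ d))   ≡⟨ cong (a ⊕_) (⊕-assoc b c d) ⟨
      a ⊕ ((b ⊕ c) ⊕ d)   ≡⟨ cong (λ x → a ⊕ (x ⊕ d)) (⊕-comm b c) ⟩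
      a ⊕ ((c ⊕ b) ⊕ d)   ≡⟨ cong (a ⊕_) (⊕-assoc c b d) ⟩
      a ⊕ (c ⊕ (b ⊕ d))   ≡⟨ ⊕-assoc a c (b ⊕ d) ⟨
      (a ⊕ c) ⊕ (b ⊕ d)   ∎
      where open ≡-Reasoning

    combination : ∀ {m} → (Fin m → Carrier) → Vec Point m → Point
    combination c []  = 𝟘
    combination c (x ∷ xs) = (c zero · x) ⊕ combination (c ∘ suc) xs

    combination-cong : ∀ {m} {c d : Fin m → Carrier} xs → (∀ j → c j ≡ d j) → combination c xs ≡ combination d xs
    combination-cong []  _   = refl
    combination-cong (x ∷ xs) c≗d = cong₂ (λ a b → (a · x) ⊕ b) (c≗d zero) (combination-cong xs (c≗d ∘ suc))

    combination-+ : ∀ {m} (c d : Fin m → Carrier) xs →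
      combination c xs ⊕ combination d xs ≡ combination (λ j → c j + d j) xs
    combination-+ c d []  = 𝟘⊕ 𝟘
    combination-+ c d (x ∷ xs) = trans (interchange _ _ _ _)
      (cong₂ _⊕_ (sym (·-distribʳ (c zero) (d zero) x)) (combination-+ (c ∘ suc) (d ∘ suc) xs))

    combination-* : ∀ {m} s (c : Fin m → Carrier) xs → s · combination c xs ≡ combination (λ j → s * c j) xs
    combination-* s c []  = ·𝟘 s
    combination-* s c (x ∷ xs) = trans (·-distribˡ s _ _) (cong₂ _⊕_ (·-· s (c zero) x) (combination-* s (c ∘ suc) xs))

    combination-0 : ∀ {m} (xs : Vec Point m) → combination (λ _ → 0#) xs ≡ 𝟘
    combination-0 []  = refl
    combination-0 (x ∷ xs) = trans (cong₂ _⊕_ (0· x) (combination-0 xs)) (𝟘⊕ 𝟘)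

    combination-vec : ∀ {k m} (i : Fin m) (ρ : Vec Carrier k) xs → lookup xs i ≡ combination (λ j → ⟦ coefficient (vec i) j ⟧ ρ) xs
    combination-vec zero  ρ (x ∷ xs) = sym (trans (cong₂ _⊕_ (1· x) (combination-0 xs)) (⊕𝟘 x))
    combination-vec (suc i) ρ (x ∷ xs) = sym (trans (cong₂ _⊕_ (0· x) (sym (combination-vec i ρ xs))) (𝟘⊕ _))

    coefficient-sound : ∀ {k m} (e : Expr k m) ρ θ → ⟦ e ⟧ᵛ ρ θ ≡ combination (λ j → ⟦ coefficient e j ⟧ ρ) θ
    coefficient-sound (vec j)  ρ θ = combination-vec j ρ θ
    coefficient-sound 𝟎  ρ θ = sym (combination-0 θ)
    coefficient-sound (e ⊞ e′) ρ θ = trans (cong₂ _⊕_ (coefficient-sound e ρ θ) (coefficient-sound e′ ρ θ)) (combination-+ _ _ θ)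
    coefficient-sound (s ⊡ e)  ρ θ = trans (cong (⟦ s ⟧ ρ ·_) (coefficient-sound e ρ θ)) (combination-* (⟦ s ⟧ ρ) _ θ)

    -- A nested product ending in `⊤`: a caller proves it by one `refl` for each vector variable,
    -- followed by `_`.
    SameCoefficients : ∀ {k} m → (c d : Fin m → Polynomial k) → Set
    SameCoefficients zero  c d = ⊤
    SameCoefficients (suc m) c d = normalise (c zero) ≡ normalise (d zero) × SameCoefficients m (c ∘ suc) (d ∘ suc)

    same : ∀ {k} m {c d : Fin m → Polynomial k} → SameCoefficients m c d → ∀ ρ j → ⟦ c j ⟧ ρ ≡ ⟦ d j ⟧ ρ
    same (suc m) {c} {d} (eq , _)  ρ zero  = prove ρ (c zero) (d zero) (cong (λ N → ⟦ N ⟧N ρ) eq)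
    same (suc m)  (_ , eqs) ρ (suc j) = same m eqs ρ j

  vsolve : ∀ {k m} (ρ : Vec Carrier k) (θ : Vec Point m) (e₁ e₂ : Expr k m) →
    SameCoefficients m (coefficient e₁) (coefficient e₂) → ⟦ e₁ ⟧ᵛ ρ θ ≡ ⟦ e₂ ⟧ᵛ ρ θ
  vsolve ρ θ e₁ e₂ eqs = trans (coefficient-sound e₁ ρ θ)
    (trans (combination-cong θ (same _ eqs ρ)) (sym (coefficient-sound e₂ ρ θ)))

-- Finite fields: enumeration, cancellation, number of vectors.

module FieldFacts {q} (K : FiniteField q) where
  open FiniteField K
  open FieldSolver K public using (commutativeRing; Polynomial; solve; _:=_; _:+_; _:*_; _:-_; :-_; con; var)
  open CommutativeRing commutativeRing public
    using (+-identityˡ; +-identityʳ; *-identityˡ; *-identityʳ; +-comm; *-comm; +-assoc; *-assoc; zeroˡ; zeroʳ; -‿inverseʳ)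

  private
    enum⁻¹-injective : ∀ {i j} → Inverse.from enum i ≡ Inverse.from enum j → i ≡ j
    enum⁻¹-injective = Injection.injective (↔⇒↣ (↔-sym enum))

  instance
    Finite-Carrier : Finite Carrier
    Finite-Carrier = record
      { elements = List.map (Inverse.from enum) (List.allFin q)
      ; complete = λ x → subst (_∈ List.map (Inverse.from enum) (List.allFin q)) (Inverse.strictlyInverseʳ enum x)
                           (Membershipₚ.∈-map⁺ (Inverse.from enum) (Membershipₚ.∈-allFin (Inverse.to enum x)))
      ; unique   = Uniqueₚ.map⁺ enum⁻¹-injective (Uniqueₚ.allFin⁺ q)
      ; _≟_  = λ x y → map′ (Injection.injective (↔⇒↣ enum)) (cong (Inverse.to enum))
                              (Inverse.to enum x Finₚ.≟ Inverse.to enum y)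
      }

  card-Carrier : card Carrier ≡ q
  card-Carrier = begin
    card Carrier  ≡⟨ ℕₚ.*-identityʳ _ ⟨
    card Carrier ℕ.* 1  ≡⟨ ∑-const {Carrier} 1 ⟨
    ∑ {Carrier} (λ _ → 1)  ≡⟨ ∑-reindex (Inverse.to enum) (Inverse.from enum) (Inverse.strictlyInverseʳ enum) (Inverse.strictlyInverseˡ enum) (λ _ → 1) ⟩
    ∑ {Fin q} (λ _ → 1)  ≡⟨ ∑-const {Fin q} 1 ⟩
    card (Fin q) ℕ.* 1  ≡⟨ ℕₚ.*-identityʳ _ ⟩
    card (Fin q)  ≡⟨ card-Fin q ⟩
    q ∎
    where open ≡-Reasoning

  ∑ᴷ-const : ∀ c → ∑ {Carrier} (λ _ → c) ≡ q ℕ.* c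
  ∑ᴷ-const c = trans (∑-const {Carrier} c) (cong (ℕ._* c) card-Carrier)

  module _ {x : Carrier} (x≢0 : x ≢ 0#) where

    *-cancelˡ : ∀ {y z} → x * y ≡ x * z → y ≡ z
    *-cancelˡ {y} {z} eq = let (x′ , xx′≡1) = inverse x x≢0 in begin
      y  ≡⟨ *-identityˡ y ⟨
      1# * y  ≡⟨ cong (_* y) xx′≡1 ⟨
      (x * x′) * y  ≡⟨ solve 3 (λ x x′ y → (x :* x′) :* y := x′ :* (x :* y)) refl x x′ y ⟩
      x′ * (x * y)  ≡⟨ cong (x′ *_) eq ⟩
      x′ * (x * z)  ≡⟨ solve 3 (λ x x′ y → x′ :* (x :* y) := (x :* x′) :* y) refl x x′ z ⟩
      (x * x′) * z  ≡⟨ cong (_* z) xx′≡1 ⟩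
      1# * z  ≡⟨ *-identityˡ z ⟩
      z ∎
      where open ≡-Reasoning

    inv : Carrier
    inv = proj₁ (inverse x x≢0)

    inv-right : x * inv ≡ 1#
    inv-right = proj₂ (inverse x x≢0)

    inv-left : inv * x ≡ 1#
    inv-left = trans (*-comm inv x) inv-right

    *-inv-cancel : ∀ y → x * (inv * y) ≡ y
    *-inv-cancel y = trans (sym (*-assoc x inv y)) (trans (cong (_* y) inv-right) (*-identityˡ y))

    inv-≢0 : inv ≢ 0#
    inv-≢0 inv≡0 = 0≢1 (trans (sym (zeroʳ x)) (trans (cong (x *_) (sym inv≡0)) inv-right))

  -‿≢0 : ∀ {x y} → x ≢ y → x + - y ≢ 0#
  -‿≢0 {x} {y} x≢y e = x≢y (begin
    x  ≡⟨ solve 2 (λ x y → x := (x :- y) :+ y) refl x y ⟩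
    (x + - y) + y   ≡⟨ cong (_+ y) e ⟩
    0# + y  ≡⟨ +-identityˡ y ⟩
    y ∎)
    where open ≡-Reasoning

  module _ (3≤q : 3 ℕ.≤ q) where

    -- Otherwise the indicators of 0 and 1 cover the field, and their total of 2 bounds `q`.
    ∃≢0,1 : ∃ λ α → α ≢ 0# × α ≢ 1#
    ∃≢0,1 with ∃? (λ α → ¬? (0# ≟ α) ×-dec ¬? (1# ≟ α))
      where open import Relation.Nullary.Decidable using (_×-dec_)
    ... | yes (α , 0≢α , 1≢α) = α , 0≢α ∘ sym , 1≢α ∘ sym
    ... | no none = contradiction 3≤q (ℕₚ.<⇒≱ (ℕ.s≤s (begin
      q  ≡⟨ ℕₚ.*-identityʳ q ⟨
      q ℕ.* 1  ≡⟨ ∑ᴷ-const 1 ⟨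
      ∑ {Carrier} (λ _ → 1)  ≤⟨ ∑-mono covered ⟩
      ∑ (λ α → 𝟏 (0# ≟ α) ℕ.* 1 ℕ.+ 𝟏 (1# ≟ α) ℕ.* 1)  ≡⟨ ∑-+ (λ α → 𝟏 (0# ≟ α) ℕ.* 1) _ ⟩
      ∑ (λ α → 𝟏 (0# ≟ α) ℕ.* 1) ℕ.+ ∑ (λ α → 𝟏 (1# ≟ α) ℕ.* 1)  ≡⟨ cong₂ ℕ._+_ (∑-δ 0# (λ _ → 1)) (∑-δ 1# (λ _ → 1)) ⟩
      2 ∎)))
      where
      open ℕₚ.≤-Reasoning
      covered : ∀ α → 1 ℕ.≤ 𝟏 (0# ≟ α) ℕ.* 1 ℕ.+ 𝟏 (1# ≟ α) ℕ.* 1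
      covered α with 0# ≟ α | 1# ≟ α
      ... | yes _   | _  = ℕ.s≤s ℕ.z≤n
      ... | no _  | yes _   = ℕ.s≤s ℕ.z≤n
      ... | no 0≢α  | no 1≢α  = contradiction (α , 0≢α , 1≢α) none

  private
    points : ∀ m → List.List (Vec Carrier m)
    points zero  = [] List.∷ List.[]
    points (suc m) = List.cartesianProductWith _∷_ elements (points m)

    ∈-points : ∀ {m} (v : Vec Carrier m) → v ∈ points m
    ∈-points []  = here refl
    ∈-points (x ∷ v) = Membershipₚ.∈-cartesianProductWith⁺ _∷_ (complete x) (∈-points v)

    points-unique : ∀ m → Unique (points m)
    points-unique zero  = All.[] ∷ []
    points-unique (suc m) = Uniqueₚ.cartesianProductWith⁺ _∷_ Vecₚ.∷-injective unique (points-unique m)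

  instance
    Finite-Vec : ∀ {m} → Finite (Vec Carrier m)
    Finite-Vec = record { elements = points _ ; complete = ∈-points ; unique = points-unique _ ; _≟_ = Vecₚ.≡-dec _≟_ }

  card-Vec : ∀ m → card (Vec Carrier m) ≡ q ℕ.^ m
  card-Vec m = trans (sym (ℕₚ.*-identityʳ _)) (trans (sym (∑-const {Vec Carrier m} 1)) (go m))
    where
    open ≡-Reasoning
    go : ∀ m → ∑ {Vec Carrier m} (λ _ → 1) ≡ q ℕ.^ m
    go zero  = ℕₚ.≤-antisym (∑-atMostOne (λ { [] [] _ _ → refl }) (λ _ → ℕₚ.≤-refl)) (term≤∑ (λ _ → 1) [])
    go (suc m) = begin
      ∑ {Vec Carrier (suc m)} (λ _ → 1)  ≡⟨ ∑-reindex (uncurry _∷_) (λ { (x ∷ v) → x , v }) (λ _ → refl) (λ { (_ ∷ _) → refl }) (λ _ → 1) ⟨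
      ∑ {Carrier × Vec Carrier m} (λ _ → 1)  ≡⟨ ∑-× {Carrier} {Vec Carrier m} (λ _ _ → 1) ⟩
      ∑ {Carrier} (λ _ → ∑ {Vec Carrier m} (λ _ → 1))  ≡⟨ ∑ᴷ-const _ ⟩
      q ℕ.* ∑ {Vec Carrier m} (λ _ → 1)  ≡⟨ cong (q ℕ.*_) (go m) ⟩
      q ℕ.* q ℕ.^ m ∎

-- Vector algebra and slicing by linear functionals.

module Vectors {q} {K : FiniteField q} {n : ℕ} (S : Space K n) where
  open FiniteField K
  open FieldFacts K public
  open Space S public
  open VectorSolver S public using (Expr; vec; 𝟎; _⊞_; _⊡_; vsolve)

  ∑ᴾ-const : ∀ c → ∑ {Point} (λ _ → c) ≡ q ℕ.^ n ℕ.* c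
  ∑ᴾ-const c = trans (∑-const {Point} c) (cong (ℕ._* c) card-Point)

  module Variables where
    one : ∀ {k} → Polynomial k
    one = con (ℤ.+ 1)
    s₀ : ∀ {k} → Polynomial (1 ℕ.+ k)
    s₀ = var 0F
    s₁ : ∀ {k} → Polynomial (2 ℕ.+ k)
    s₁ = var 1F
    s₂ : ∀ {k} → Polynomial (3 ℕ.+ k)
    s₂ = var 2F
    s₃ : ∀ {k} → Polynomial (4 ℕ.+ k)
    s₃ = var 3F
    s₄ : ∀ {k} → Polynomial (5 ℕ.+ k)
    s₄ = var 4F
    v₀ : ∀ {k m} → Expr k (1 ℕ.+ m)
    v₀ = vec 0F
    v₁ : ∀ {k m} → Expr k (2 ℕ.+ m)
    v₁ = vec 1F
    v₂ : ∀ {k m} → Expr k (3 ℕ.+ m)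
    v₂ = vec 2F
    v₃ : ∀ {k m} → Expr k (4 ℕ.+ m)
    v₃ = vec 3F
    v₄ : ∀ {k m} → Expr k (5 ℕ.+ m)
    v₄ = vec 4F
    infixl 6 _⊟_
    _⊟_ : ∀ {k m} → Expr k m → Expr k m → Expr k m
    e ⊟ e′ = e ⊞ (:- one) ⊡ e′

  open Variables

  -- This and the next notions repeat those of the statement over an abstract space. At
  -- `Coordinates.space` they unfold to the originals, so the final result needs no conversion.
  OnLine : Point → Point → Point → Set
  OnLine b v x = ∃ λ t → x ≡ b ⊕ (t · v)

  IsFieldAutomorphism : (Carrier → Carrier) → Set
  IsFieldAutomorphism σ =
    Bijective _≡_ _≡_ σ × (∀ x y → σ (x + y) ≡ σ x + σ y) × (∀ x y → σ (x * y) ≡ σ x * σ y) × σ 1# ≡ 1#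

  IsSemiAffine : (Point → Point) → Set
  IsSemiAffine h =
    Σ (Carrier → Carrier) λ σ → IsFieldAutomorphism σ ×
    Σ (Point → Point) λ g →
      Bijective _≡_ _≡_ g × (∀ x y → g (x ⊕ y) ≡ g x ⊕ g y) × (∀ α x → g (α · x) ≡ σ α · g x)
      × Σ Point λ b → ∀ x → h x ≡ g x ⊕ b

  IsLine : (Point → Set) → Set
  IsLine L = Σ Point λ b → Σ Point λ v → v ≢ 𝟘 × (∀ x → L x ⇔ OnLine b v x)

  Image : (Point → Point) → (Point → Set) → Point → Set
  Image f L y = ∃ λ x → L x × f x ≡ y

  BadLine : (Point → Point) → Point → Point → Set
  BadLine f b v = ¬ IsLine (Image f (OnLine b v))

  SameLine : Point → Point → Point → Point → Set
  SameLine b v b′ v′ = ∀ x → OnLine b v x ⇔ OnLine b′ v′ x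

  HasCoaffinity : (Point → Point) → ℕ → Set
  HasCoaffinity f k =
    Σ (Fin k → Point) λ bs → Σ (Fin k → Point) λ vs →
      (∀ i → vs i ≢ 𝟘)
      × (∀ i → BadLine f (bs i) (vs i))
      × (∀ i j → i ≢ j → ¬ SameLine (bs i) (vs i) (bs j) (vs j))
      × (∀ b v → v ≢ 𝟘 → BadLine f b v → ∃ λ i → SameLine b v (bs i) (vs i))

  IsTransposition : (Point → Point) → Set
  IsTransposition τ =
    Σ Point λ a → Σ Point λ c → a ≢ c × τ a ≡ c × τ c ≡ a × (∀ x → x ≢ a → x ≢ c → τ x ≡ x)

  InDoubleCoset : (Point → Point) → (Point → Point) → Set
  InDoubleCoset τ f =
    Σ (Point → Point) λ g → Σ (Point → Point) λ h →
      IsSemiAffine g × IsSemiAffine h × (∀ x → f x ≡ g (τ (h x)))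

  _⊝_ : Point → Point → Point
  p ⊝ r = p ⊕ ((- 1#) · r)

  ⊕-cancelʳ : ∀ {x y} z → x ⊕ z ≡ y ⊕ z → x ≡ y
  ⊕-cancelʳ {x} {y} z eq = trans (lemma x) (trans (cong (_⊝ z) eq) (sym (lemma y)))
    where
    lemma : ∀ x → x ≡ (x ⊕ z) ⊝ z
    lemma x = vsolve [] (x ∷ z ∷ []) v₀ ((v₀ ⊞ v₁) ⊟ v₁) (refl , refl , _)

  -- An equation follows from hypotheses X ≡ Y once the difference of its sides is the difference of X and Y.
  from-difference : ∀ {L R X Y} → X ≡ Y → L ⊕ Y ≡ R ⊕ X → L ≡ R
  from-difference {X = X} refl = ⊕-cancelʳ X

  ⊕𝟘 : ∀ v → v ⊕ 𝟘 ≡ v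
  ⊕𝟘 v = vsolve [] (v ∷ []) (v₀ ⊞ 𝟎) v₀ (refl , _)

  ⊕⊝ : ∀ v w → v ⊕ (w ⊝ v) ≡ w
  ⊕⊝ v w = vsolve [] (v ∷ w ∷ []) (v₀ ⊞ (v₁ ⊟ v₀)) v₁ (refl , refl , _)

  ⊕-⊝ : ∀ v w → (v ⊕ w) ⊝ v ≡ w
  ⊕-⊝ v w = vsolve [] (v ∷ w ∷ []) ((v₀ ⊞ v₁) ⊟ v₀) v₁ (refl , refl , _)

  ⊝≡𝟘 : ∀ {x y} → x ⊝ y ≡ 𝟘 → x ≡ y
  ⊝≡𝟘 {x} {y} e = trans (sym (⊕⊝ y x)) (trans (cong (y ⊕_) e) (⊕𝟘 y))

  inv-· : ∀ {s} (s≢0 : s ≢ 0#) v → inv s≢0 · (s · v) ≡ v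
  inv-· s≢0 v = trans (·-· _ _ v) (trans (cong (_· v) (inv-left s≢0)) (1· v))

  ·-inv : ∀ {s} (s≢0 : s ≢ 0#) v → s · (inv s≢0 · v) ≡ v
  ·-inv s≢0 v = trans (·-· _ _ v) (trans (cong (_· v) (inv-right s≢0)) (1· v))

  ·-cancel : ∀ {s v w} → s ≢ 0# → s · v ≡ s · w → v ≡ w
  ·-cancel {s} {v} {w} s≢0 e = trans (sym (inv-· s≢0 v)) (trans (cong (inv s≢0 ·_) e) (inv-· s≢0 w))

  ·-≢𝟘 : ∀ {s v} → s ≢ 0# → v ≢ 𝟘 → s · v ≢ 𝟘
  ·-≢𝟘 {s} s≢0 v≢𝟘 e = v≢𝟘 (·-cancel s≢0 (trans e (sym (·𝟘 s))))

  ·-injective : ∀ {s t v} → v ≢ 𝟘 → s · v ≡ t · v → s ≡ t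
  ·-injective {s} {t} {v} v≢𝟘 e with s ≟ t
  ... | yes s≡t = s≡t
  ... | no s≢t = contradiction
    (from-difference e (vsolve (s ∷ t ∷ []) (v ∷ []) ((s₀ :- s₁) ⊡ v₀ ⊞ s₁ ⊡ v₀) (𝟎 ⊞ s₀ ⊡ v₀) (refl , _)))
    (·-≢𝟘 (-‿≢0 s≢t) v≢𝟘)

  _∈⟨_⟩ : Point → Point → Set
  w ∈⟨ v ⟩ = ∃ λ t → w ≡ t · v

  _∈⟨_⟩? : ∀ w v → Dec (w ∈⟨ v ⟩)
  w ∈⟨ v ⟩? = ∃? (λ t → w ≟ t · v)

  ∈⟨⟩-sym : ∀ {v w} → v ≢ 𝟘 → v ∈⟨ w ⟩ → w ∈⟨ v ⟩
  ∈⟨⟩-sym {v} {w} v≢𝟘 (t , v≡tw) with t ≟ 0#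
  ... | yes t≡0 = contradiction (trans v≡tw (trans (cong (_· w) t≡0) (0· w))) v≢𝟘
  ... | no t≢0  = inv t≢0 , trans (sym (inv-· t≢0 w)) (cong (inv t≢0 ·_) (sym v≡tw))

  independent : ∀ {v w} → v ≢ 𝟘 → ¬ (w ∈⟨ v ⟩) → ∀ {s t} → (s · v) ⊕ (t · w) ≡ 𝟘 → s ≡ 0# × t ≡ 0#
  independent {v} {w} v≢𝟘 w∉ {s} {t} e with t ≟ 0#
  ... | yes refl = ·-injective v≢𝟘 (from-difference e
          (vsolve (s ∷ []) (v ∷ w ∷ []) (s₀ ⊡ v₀ ⊞ 𝟎) (con (ℤ.+ 0) ⊡ v₀ ⊞ (s₀ ⊡ v₀ ⊞ con (ℤ.+ 0) ⊡ v₁)) (refl , refl , _))) , refl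
  ... | no t≢0 = contradiction (inv t≢0 * - s , trans (sym (inv-· t≢0 w)) (trans (cong (inv t≢0 ·_) tw≡) (·-· _ _ v))) w∉
    where
    tw≡ : t · w ≡ (- s) · v
    tw≡ = from-difference e (vsolve (s ∷ t ∷ []) (v ∷ w ∷ []) (s₁ ⊡ v₁ ⊞ 𝟎) ((:- s₀) ⊡ v₀ ⊞ (s₀ ⊡ v₀ ⊞ s₁ ⊡ v₁)) (refl , refl , _))

  module _ (g : Point → ℕ) where

    ∑-shift : ∀ u → ∑ (λ p → g (u ⊕ p)) ≡ ∑ g
    ∑-shift u = ∑-reindex (u ⊕_) (_⊝ u) (⊕-⊝ u) (λ p → trans (⊕-comm u (p ⊝ u)) (lemma p)) g
      where
      lemma : ∀ p → (p ⊝ u) ⊕ u ≡ p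
      lemma p = vsolve [] (p ∷ u ∷ []) ((v₀ ⊟ v₁) ⊞ v₁) v₀ (refl , refl , _)

    ∑-scale : ∀ {s} → s ≢ 0# → ∑ (λ p → g (s · p)) ≡ ∑ g
    ∑-scale {s} s≢0 = ∑-reindex (s ·_) (inv s≢0 ·_) (inv-· s≢0) (·-inv s≢0) g

  ∙-𝟘 : ∀ a → a ∙ 𝟘 ≡ 0#
  ∙-𝟘 a = trans (cong (a ∙_) (sym (0· 𝟘))) (trans (∙-· a 0# 𝟘) (zeroˡ _))

  ∙-⊝ : ∀ (a u v : Point) → a ∙ (u ⊝ v) ≡ a ∙ u + - (a ∙ v)
  ∙-⊝ a u v = trans (∙-⊕ a u _) (cong (a ∙ u +_) (trans (∙-· a (- 1#) v) (solve 1 (λ x → (:- con (ℤ.+ 1)) :* x := :- x) refl (a ∙ v))))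

  χ : Point → Point → ℕ
  χ a w = 𝟏 (a ∙ w ≟ 0#)

  module _ (a u : Point) (au≡1 : a ∙ u ≡ 1#) where

    -- A point is uniquely `c · u` plus a kernel vector, with `c` its value under `a ∙_`. So a delta
    -- at `a ∙ p` is inserted, and each slice is shifted back into the kernel by `c · u`.
    ∑-levels : ∀ (g : Point → ℕ) → ∑ g ≡ ∑ (λ c → ∑ (λ w → χ a w ℕ.* g ((c · u) ⊕ w)))
    ∑-levels g = begin
      ∑ g  ≡⟨ ∑-cong (λ p → sym (∑-δ (a ∙ p) (λ _ → g p))) ⟩
      ∑ (λ p → ∑ (λ c → 𝟏 (a ∙ p ≟ c) ℕ.* g p))  ≡⟨ ∑-swap _ ⟩
      ∑ (λ c → ∑ (λ p → 𝟏 (a ∙ p ≟ c) ℕ.* g p))  ≡⟨ ∑-cong (λ c → sym (∑-shift (λ p → 𝟏 (a ∙ p ≟ c) ℕ.* g p) (c · u))) ⟩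
      ∑ (λ c → ∑ (λ w → 𝟏 (a ∙ ((c · u) ⊕ w) ≟ c) ℕ.* g ((c · u) ⊕ w))) ≡⟨ ∑-cong (λ c → ∑-cong (λ w → cong (ℕ._* g ((c · u) ⊕ w)) (same c w))) ⟩
      ∑ (λ c → ∑ (λ w → χ a w ℕ.* g ((c · u) ⊕ w))) ∎
      where
      open ≡-Reasoning
      value : ∀ c w → a ∙ ((c · u) ⊕ w) ≡ c + a ∙ w
      value c w = trans (∙-⊕ a (c · u) w) (cong (_+ a ∙ w) (trans (∙-· a c u) (trans (cong (c *_) au≡1) (*-identityʳ c))))
      same : ∀ c w → 𝟏 (a ∙ ((c · u) ⊕ w) ≟ c) ≡ χ a w
      same c w = 𝟏-cong (a ∙ ((c · u) ⊕ w) ≟ c) (a ∙ w ≟ 0#)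
        (λ e → trans (solve 2 (λ c x → x := (c :+ x) :- c) refl c (a ∙ w)) (trans (cong (_+ - c) (trans (sym (value c w)) e)) (-‿inverseʳ c)))
        (λ e → trans (value c w) (trans (cong (_+_ c) e) (+-identityʳ c)))

    kernel-size : q ℕ.* ∑ (χ a) ≡ q ℕ.^ n
    kernel-size = begin
      q ℕ.* ∑ (χ a)  ≡⟨ cong (q ℕ.*_) (∑-cong (λ w → sym (ℕₚ.*-identityʳ (χ a w)))) ⟩
      q ℕ.* ∑ (λ w → χ a w ℕ.* 1)  ≡⟨ ∑ᴷ-const _ ⟨
      ∑ {Carrier} (λ c → ∑ (λ w → χ a w ℕ.* 1))   ≡⟨ ∑-levels (λ _ → 1) ⟨
      ∑ {Point} (λ _ → 1)  ≡⟨ ∑ᴾ-const 1 ⟩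
      q ℕ.^ n ℕ.* 1  ≡⟨ ℕₚ.*-identityʳ _ ⟩
      q ℕ.^ n ∎
      where open ≡-Reasoning

-- The coordinate space as an instance of the abstract one.

module Coordinates {q} (K : FiniteField q) where
  open FiniteField K
  open FieldFacts K
  open Vecₚ using (zipWith-assoc; zipWith-comm; zipWith-identityˡ; map-∘; map-cong; map-id; map-const; map-replicate)

  _∙_ : ∀ {m} → Vec Carrier m → Vec Carrier m → Carrier
  []  ∙ []  = 0#
  (x ∷ a) ∙ (y ∷ b) = x * y + a ∙ b

  ∙-comm : ∀ {m} (a b : Vec Carrier m) → a ∙ b ≡ b ∙ a
  ∙-comm []  []  = refl
  ∙-comm (x ∷ a) (y ∷ b) = cong₂ _+_ (*-comm x y) (∙-comm a b)

  ∙-zipWith : ∀ {m} (a u v : Vec Carrier m) → a ∙ zipWith _+_ u v ≡ a ∙ u + a ∙ v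
  ∙-zipWith []  []  []  = sym (+-identityˡ 0#)
  ∙-zipWith (x ∷ a) (y ∷ u) (z ∷ v) rewrite ∙-zipWith a u v =
    solve 5 (λ x y z c d → x :* (y :+ z) :+ (c :+ d) := (x :* y :+ c) :+ (x :* z :+ d)) refl x y z (a ∙ u) (a ∙ v)

  ∙-map : ∀ {m} (a v : Vec Carrier m) t → a ∙ map (t *_) v ≡ t * (a ∙ v)
  ∙-map []  []  t = sym (zeroʳ t)
  ∙-map (x ∷ a) (y ∷ v) t rewrite ∙-map a v t =
    solve 4 (λ t x y c → x :* (t :* y) :+ t :* c := t :* (x :* y :+ c)) refl t x y (a ∙ v)

  ∙-replicate : ∀ {m} (a : Vec Carrier m) → a ∙ replicate m 0# ≡ 0#
  ∙-replicate []  = refl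
  ∙-replicate (x ∷ a) rewrite ∙-replicate a = trans (+-identityʳ _) (zeroʳ x)

  -- The witness inverts the first nonzero coordinate of `a` and is zero elsewhere.
  ∙-nondegenerate-Vec : ∀ {m} (a : Vec Carrier m) → a ≢ replicate m 0# → ∃ λ u → a ∙ u ≡ 1#
  ∙-nondegenerate-Vec []  a≢0 = contradiction refl a≢0
  ∙-nondegenerate-Vec (x ∷ a) a≢0 with x ≟ 0#
  ... | no x≢0 = inv x≢0 ∷ replicate _ 0# , trans (cong₂ _+_ (inv-right x≢0) (∙-replicate a)) (+-identityʳ 1#)
  ... | yes refl = let (u , au≡1) = ∙-nondegenerate-Vec a (a≢0 ∘ cong (0# ∷_)) in
        0# ∷ u , trans (cong₂ _+_ (zeroʳ 0#) au≡1) (+-identityˡ 1#)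


  space : ∀ n → Space K n
  space n = record
    { Geometry K n
    ; ⊕-assoc = zipWith-assoc +-assoc
    ; ⊕-comm = zipWith-comm +-comm
    ; 𝟘⊕ = zipWith-identityˡ +-identityˡ
    ; ·-distribˡ = map-zipWith-distrib
    ; ·-distribʳ = map-+
    ; ·-· = λ s t v → trans (sym (map-∘ (s *_) (t *_) v)) (map-cong (λ x → sym (*-assoc s t x)) v)
    ; 1· = λ v → trans (map-cong *-identityˡ v) (map-id v)
    ; 0· = λ v → trans (map-cong zeroˡ v) (map-const v 0#)
    ; ·𝟘 = λ s → trans (map-replicate (s *_) 0# n) (cong (replicate n) (zeroʳ s))
    ; finite = Finite-Vec
    ; card-Point = card-Vec n
    ; _∙_ = _∙_
    ; ∙-comm = ∙-comm
    ; ∙-⊕ = ∙-zipWith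
    ; ∙-· = λ a t v → ∙-map a v t
    ; ∙-nondegenerate = ∙-nondegenerate-Vec
    }
    where
    map-zipWith-distrib : ∀ {m} s (v w : Vec Carrier m) → map (s *_) (zipWith _+_ v w) ≡ zipWith _+_ (map (s *_) v) (map (s *_) w)
    map-zipWith-distrib s []  []  = refl
    map-zipWith-distrib s (x ∷ v) (y ∷ w) = cong₂ _∷_ (solve 3 (λ s x y → s :* (x :+ y) := s :* x :+ s :* y) refl s x y) (map-zipWith-distrib s v w)
    map-+ : ∀ {m} s t (v : Vec Carrier m) → map ((s + t) *_) v ≡ zipWith _+_ (map (s *_) v) (map (t *_) v)
    map-+ s t []  = refl
    map-+ s t (x ∷ v) = cong₂ _∷_ (solve 3 (λ s t x → (s :+ t) :* x := s :* x :+ t :* x) refl s t x) (map-+ s t v)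

-- Good and bad lines of an injective map.

module Lines {q} {K : FiniteField q} {n : ℕ} (S : Space K n) where
  open FiniteField K
  open Vectors S
  open Variables

  -- For an injective f and v ≢ 𝟘 this says that f maps the line b + ⟨v⟩ onto a line; it holds trivially for v ≡ 𝟘.
  record Good (f : Point → Point) (b v : Point) : Set where
    constructor good
    field
      origin direction : Point
      on : ∀ t → OnLine origin direction (f (b ⊕ (t · v)))

  Good? : ∀ f b v → Dec (Good f b v)
  Good? f b v = map′ (λ (c , d , on) → good c d on) (λ (good c d on) → c , d , on)
    (∃? λ c → ∃? λ d → ∀? λ t → ∃? λ s → f (b ⊕ (t · v)) ≟ c ⊕ (s · d))

  Good-on : ∀ {f b v} → Good f b v → ∃ λ c → ∃ λ d → ∀ {x} → OnLine b v x → OnLine c d (f x)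
  Good-on (good c d on) = c , d , λ { (t , refl) → on t }

  Good-reparametrise : ∀ {f b v b′ v′} → Good f b v → OnLine b v b′ → v′ ∈⟨ v ⟩ → Good f b′ v′
  Good-reparametrise {f} {b} {v} {b′} {v′} g (s , refl) (x , refl) = let (c , d , on) = Good-on g in
    good c d λ t → on (s + t * x , vsolve (s ∷ t ∷ x ∷ []) (b ∷ v ∷ [])
      (v₀ ⊞ s₀ ⊡ v₁ ⊞ s₁ ⊡ (s₂ ⊡ v₁)) (v₀ ⊞ (s₀ :+ s₁ :* s₂) ⊡ v₁) (refl , refl , _))

  Good-rebase : ∀ {f b b′ v} → Good f b v → OnLine b v b′ → Good f b′ v
  Good-rebase {v = v} g on = Good-reparametrise g on (1# , sym (1· v))

  -- It moves `b` and its image to the origin, the position that the pencil argument assumes.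
  translate : (Point → Point) → Point → Point → Point
  translate f b x = f (b ⊕ x) ⊝ f b

  translate-𝟘 : ∀ f b → translate f b 𝟘 ≡ 𝟘
  translate-𝟘 f b = trans (cong (λ p → f p ⊝ f b) (⊕𝟘 b)) (vsolve [] (f b ∷ []) (v₀ ⊟ v₀) 𝟎 (refl , _))

  translate-injective : ∀ {f} → (∀ x y → f x ≡ f y → x ≡ y) → ∀ b x y → translate f b x ≡ translate f b y → x ≡ y
  translate-injective inj b x y e = trans (sym (⊕-⊝ b x)) (trans (cong (_⊝ b) (inj _ _ (⊕-cancelʳ _ e))) (⊕-⊝ b y))

  Good-translate⁺ : ∀ {f b p v} → Good f (b ⊕ p) v → Good (translate f b) p v
  Good-translate⁺ {f} {b} {p} {v} (good c d on) = good (c ⊝ f b) d λ t → let (s , e) = on t in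
    s , trans (cong (_⊝ f b) (trans (cong f (sym (⊕-assoc b p (t · v)))) e))
          (vsolve (s ∷ []) (c ∷ d ∷ f b ∷ []) ((v₀ ⊞ s₀ ⊡ v₁) ⊟ v₂) ((v₀ ⊟ v₂) ⊞ s₀ ⊡ v₁) (refl , refl , refl , _))

  Good-translate⁻ : ∀ {f b p v} → Good (translate f b) p v → Good f (b ⊕ p) v
  Good-translate⁻ {f} {b} {p} {v} (good c d on) = good (f b ⊕ c) d λ t → let (s , e) = on t in
    s , trans (cong f (⊕-assoc b p (t · v))) (trans (sym (⊕⊝ (f b) _)) (trans (cong (f b ⊕_) e) (sym (⊕-assoc (f b) c (s · d)))))

  OnLine-base : ∀ b v → OnLine b v b
  OnLine-base b v = 0# , vsolve [] (b ∷ v ∷ []) v₀ (v₀ ⊞ con (ℤ.+ 0) ⊡ v₁) (refl , refl , _)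

  OnLine-tip : ∀ b v → OnLine b v (b ⊕ v)
  OnLine-tip b v = 1# , cong (b ⊕_) (sym (1· v))

  module _ {f : Point → Point} (inj : ∀ x y → f x ≡ f y → x ≡ y) where

    abstract
      -- If the images have parameters `i`, `j`, `k` on the image line, injectivity separates `i`
      -- from `j`, and the coefficient is the quotient of `k - i` by `j - i`.
      good-three : ∀ {b v x y z} → Good f b v → OnLine b v x → OnLine b v y → OnLine b v z → x ≢ y →
        ∃ λ s → f z ≡ f x ⊕ (s · (f y ⊝ f x))
      good-three {x = x} {y} {z} g onx ony onz x≢y
        with Good-on g
      ... | c , d , on with on onx | on ony | on onz
      ... | i , fx≡ | j , fy≡ | k , fz≡ = (k + - i) * u ,
          trans fz≡ (trans (from-difference (cong (_· ((k + - i) · d)) (sym (inv-right j-i≢0)))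
            (vsolve (i ∷ j ∷ k ∷ u ∷ []) (c ∷ d ∷ [])
              (v₀ ⊞ s₂ ⊡ v₁ ⊞ ((s₁ :- s₀) :* s₃) ⊡ ((s₂ :- s₀) ⊡ v₁))
              (v₀ ⊞ s₀ ⊡ v₁ ⊞ ((s₂ :- s₀) :* s₃) ⊡ ((v₀ ⊞ s₁ ⊡ v₁) ⊟ (v₀ ⊞ s₀ ⊡ v₁)) ⊞ one ⊡ ((s₂ :- s₀) ⊡ v₁)) (refl , refl , _)))
            (sym (cong₂ (λ P Q → P ⊕ (((k + - i) * u) · (Q ⊝ P))) fx≡ fy≡)))
        where
        j-i≢0 : j + - i ≢ 0#
        j-i≢0 = -‿≢0 (λ j≡i → x≢y (inj x y (trans fx≡ (trans (cong (λ i → c ⊕ (i · d)) (sym j≡i)) (sym fy≡)))))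
        u : Carrier
        u = inv j-i≢0

      -- The coefficient from `good-three` is an injective function of the parameter on a finite
      -- field, hence onto. This is why `Good` need only ask for containment in a line.
      good-onto : ∀ {b v x y} → Good f b v → OnLine b v x → OnLine b v y → x ≢ y →
        ∀ s → ∃ λ t → f (b ⊕ (t · v)) ≡ f x ⊕ (s · (f y ⊝ f x))
      good-onto {b} {v} {x} {y} g onx ony x≢y s = let (t , e) = injective⇒surjective coefficient coefficient-injective s in
        t , trans (proj₂ (at t)) (cong (λ s → f x ⊕ (s · (f y ⊝ f x))) e)
        where
        at : ∀ t → ∃ λ s → f (b ⊕ (t · v)) ≡ f x ⊕ (s · (f y ⊝ f x))
        at t = good-three g onx ony (t , refl) x≢y
        coefficient : Carrier → Carrier
        coefficient t = proj₁ (at t)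
        v≢𝟘 : v ≢ 𝟘
        v≢𝟘 refl = x≢y (trans (proj₂ onx) (trans (cong (b ⊕_) (trans (·𝟘 _) (sym (·𝟘 _)))) (sym (proj₂ ony))))
        coefficient-injective : ∀ t t′ → coefficient t ≡ coefficient t′ → t ≡ t′
        coefficient-injective t t′ e = ·-injective v≢𝟘 (trans (sym (⊕-⊝ b _)) (trans (cong (_⊝ b)
          (inj _ _ (trans (proj₂ (at t)) (trans (cong (λ s → f x ⊕ (s · (f y ⊝ f x))) e) (sym (proj₂ (at t′)))))))
          (⊕-⊝ b _)))

    private
      base≢tip : ∀ b {v} → v ≢ 𝟘 → b ≢ b ⊕ v
      base≢tip b {v} v≢𝟘 e = v≢𝟘 (trans (sym (⊕-⊝ b v)) (trans (cong (_⊝ b) (sym e)) (vsolve [] (b ∷ []) (v₀ ⊟ v₀) 𝟎 (refl , _))))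

    Good⇒IsLine : ∀ {b v} → v ≢ 𝟘 → Good f b v → IsLine (Image f (OnLine b v))
    Good⇒IsLine {b} {v} v≢𝟘 g = f b , f (b ⊕ v) ⊝ f b , nonzero , λ y → mk⇔ (to y) (from y)
      where
      b≢b+v : b ≢ b ⊕ v
      b≢b+v = base≢tip b v≢𝟘
      nonzero : f (b ⊕ v) ⊝ f b ≢ 𝟘
      nonzero e = b≢b+v (inj b (b ⊕ v) (sym (⊝≡𝟘 e)))
      to : ∀ y → Image f (OnLine b v) y → OnLine (f b) (f (b ⊕ v) ⊝ f b) y
      to y (x , onx , refl) = good-three g (OnLine-base b v) (OnLine-tip b v) onx b≢b+v
      from : ∀ y → OnLine (f b) (f (b ⊕ v) ⊝ f b) y → Image f (OnLine b v) y
      from y (s , e) = let (t , e′) = good-onto g (OnLine-base b v) (OnLine-tip b v) b≢b+v s in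
        b ⊕ (t · v) , (t , refl) , trans e′ (sym e)

    BadLine⇔¬Good : ∀ {b v} → v ≢ 𝟘 → BadLine f b v ⇔ (¬ Good f b v)
    BadLine⇔¬Good v≢𝟘 = mk⇔ (λ bad → bad ∘ Good⇒IsLine v≢𝟘)
      (λ ¬good (b′ , v′ , _ , on) → ¬good (good b′ v′ λ t → Equivalence.to (on _) (_ , (t , refl) , refl)))

  ¬Good⇒≢𝟘 : ∀ {f b v} → ¬ Good f b v → v ≢ 𝟘
  ¬Good⇒≢𝟘 {f} {b} ¬g refl = ¬g (good (f b) 𝟘 λ t → 0# , trans (cong f (trans (cong (b ⊕_) (·𝟘 t)) (⊕𝟘 b)))
    (sym (trans (cong (f b ⊕_) (0· 𝟘)) (⊕𝟘 (f b)))))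

  InSpan : Point → Point → Point → Set
  InSpan P R x = ∃ λ α → ∃ λ γ → x ≡ (α · P) ⊕ (γ · R)

  InSpan-· : ∀ {P R x} s → InSpan P R x → InSpan P R (s · x)
  InSpan-· {P} {R} s (α , γ , refl) = s * α , s * γ ,
    vsolve (s ∷ α ∷ γ ∷ []) (P ∷ R ∷ []) (s₀ ⊡ (s₁ ⊡ v₀ ⊞ s₂ ⊡ v₁)) ((s₀ :* s₁) ⊡ v₀ ⊞ (s₀ :* s₂) ⊡ v₁) (refl , refl , _)

  InSpan-line : ∀ {P R x y} s → InSpan P R x → InSpan P R y → InSpan P R (x ⊕ (s · (y ⊝ x)))
  InSpan-line {P} {R} s (α , γ , refl) (α′ , γ′ , refl) = α + s * (α′ + - α) , γ + s * (γ′ + - γ) ,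
    vsolve (s ∷ α ∷ γ ∷ α′ ∷ γ′ ∷ []) (P ∷ R ∷ [])
      ((s₁ ⊡ v₀ ⊞ s₂ ⊡ v₁) ⊞ s₀ ⊡ ((s₃ ⊡ v₀ ⊞ s₄ ⊡ v₁) ⊟ (s₁ ⊡ v₀ ⊞ s₂ ⊡ v₁)))
      ((s₁ :+ s₀ :* (s₃ :- s₁)) ⊡ v₀ ⊞ (s₂ :+ s₀ :* (s₄ :- s₂)) ⊡ v₁) (refl , refl , _)

  -- When `P + ⟨R⟩` is an image line, a nonzero coefficient at `P` thus exhibits a vector as a
  -- multiple of an image point, which the pencil argument refutes by injectivity.
  normalise-span : ∀ {P R α γ} (α≢0 : α ≢ 0#) → (α · P) ⊕ (γ · R) ≡ α · (P ⊕ ((inv α≢0 * γ) · R))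
  normalise-span {P} {R} {α} {γ} α≢0 = from-difference (cong (_· (γ · R)) (sym (inv-right α≢0)))
    (vsolve (α ∷ γ ∷ inv α≢0 ∷ []) (P ∷ R ∷ [])
      ((s₀ ⊡ v₀ ⊞ s₁ ⊡ v₁) ⊞ (s₀ :* s₂) ⊡ (s₁ ⊡ v₁))
      (s₀ ⊡ (v₀ ⊞ (s₂ :* s₁) ⊡ v₁) ⊞ one ⊡ (s₁ ⊡ v₁)) (refl , refl , _))

-- Pencils of good lines in a plane, and additivity on good subspaces.

module Pencil {q} {K : FiniteField q} {n : ℕ} (S : Space K n)
  {α : FiniteField.Carrier K} (α≢0 : α ≢ FiniteField.0# K) (α≢1 : α ≢ FiniteField.1# K) where
  open FiniteField K
  open Vectors S
  open Variables
  open Lines S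

  private
    α-1≢0 : α + - 1# ≢ 0#
    α-1≢0 = -‿≢0 α≢1
    α⁻¹ β : Carrier
    α⁻¹ = inv α≢0
    β = inv α-1≢0

  module _ (f : Point → Point) (inj : ∀ x y → f x ≡ f y → x ≡ y) (f𝟘 : f 𝟘 ≡ 𝟘) where

    private
      f≢𝟘 : ∀ {x} → x ≢ 𝟘 → f x ≢ 𝟘
      f≢𝟘 x≢𝟘 e = x≢𝟘 (inj _ _ (trans e (sym f𝟘)))

      from-𝟘 : ∀ s y → f 𝟘 ⊕ (s · (y ⊝ f 𝟘)) ≡ s · y
      from-𝟘 s y = trans (cong (λ o → o ⊕ (s · (y ⊝ o))) f𝟘)
        (vsolve (s ∷ []) (y ∷ []) (𝟎 ⊞ s₀ ⊡ (v₀ ⊟ 𝟎)) (s₀ ⊡ v₀) (refl , _))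

      on-ray : ∀ {u} κ → OnLine 𝟘 u (κ · u)
      on-ray κ = κ , sym (𝟘⊕ _)

      ray : ∀ {u} → Good f 𝟘 u → ∀ {y} → y ∈⟨ u ⟩ → y ≢ 𝟘 → ∀ κ → ∃ λ s → f (κ · u) ≡ s · f y
      ray {u} g {y} (t , refl) y≢𝟘 κ =
        let (s , e) = good-three inj g (OnLine-base 𝟘 u) (on-ray t) (on-ray κ) (y≢𝟘 ∘ sym)
        in s , trans e (from-𝟘 s (f y))

      ray-onto : ∀ {u} → Good f 𝟘 u → ∀ {y} → y ∈⟨ u ⟩ → y ≢ 𝟘 → ∀ s → ∃ λ κ → s · f y ≡ f (κ · u)
      ray-onto {u} g {y} (t , refl) y≢𝟘 s =
        let (κ , e) = good-onto inj g (OnLine-base 𝟘 u) (on-ray t) (y≢𝟘 ∘ sym) s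
        in κ , sym (trans (cong f (sym (𝟘⊕ _))) (trans e (from-𝟘 s (f y))))

    abstract
      scalar-closed : ∀ {u} → Good f 𝟘 u → ∀ s → ∃ λ κ → s · f u ≡ f (κ · u)
      scalar-closed {u} g s with u ≟ 𝟘
      ... | no u≢𝟘 = ray-onto g (1# , sym (1· u)) u≢𝟘 s
      ... | yes refl = 0# , trans (cong (s ·_) f𝟘) (trans (·𝟘 s) (sym (trans (cong f (0· 𝟘)) f𝟘)))

    module _ {v w : Point} (v≢𝟘 : v ≢ 𝟘) (w∉⟨v⟩ : ¬ (w ∈⟨ v ⟩)) where

      private
        -- These are the directions of the plane of `v` and `w` other than that of `v`, each once up
        -- to scaling.
        ℓ : Carrier → Point
        ℓ x = w ⊕ (x · v)

        tv≢κℓ : ∀ {t x κ} → t ≢ 0# → t · v ≢ κ · ℓ x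
        tv≢κℓ {t} {x} {κ} t≢0 e = t≢0 (begin
          t  ≡⟨ solve 3 (λ t x κ → t := (t :- κ :* x) :- (:- κ) :* x) refl t x κ ⟩
          (t + - (κ * x)) + - (- κ * x)   ≡⟨ cong₂ (λ a b → a + - (b * x)) (proj₁ coefficients) (proj₂ coefficients) ⟩
          0# + - (0# * x)  ≡⟨ solve 1 (λ x → con (ℤ.+ 0) :- con (ℤ.+ 0) :* x := con (ℤ.+ 0)) refl x ⟩
          0# ∎)
          where
          open ≡-Reasoning
          coefficients : t + - (κ * x) ≡ 0# × - κ ≡ 0#
          coefficients = independent v≢𝟘 w∉⟨v⟩ (from-difference e (vsolve (t ∷ x ∷ κ ∷ []) (v ∷ w ∷ [])
            ((s₀ :- s₂ :* s₁) ⊡ v₀ ⊞ (:- s₂) ⊡ v₁ ⊞ s₂ ⊡ (v₁ ⊞ s₁ ⊡ v₀)) (𝟎 ⊞ s₀ ⊡ v₀) (refl , refl , _)))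

        ℓ≢𝟘 : ∀ x → ℓ x ≢ 𝟘
        ℓ≢𝟘 x e = w∉⟨v⟩ (- x , from-difference e (vsolve (x ∷ []) (v ∷ w ∷ []) (v₁ ⊞ 𝟎) ((:- s₀) ⊡ v₀ ⊞ (v₁ ⊞ s₀ ⊡ v₀)) (refl , refl , _)))

        w≢𝟘 : w ≢ 𝟘
        w≢𝟘 e = w∉⟨v⟩ (0# , trans e (sym (0· v)))

        -- The line through tv in direction ℓ y meets the rays through ℓ (y + 1) and ℓ (y + α).
        meet : ∀ {t y P R} → t ≢ 0# → Good f (t · v) (ℓ y) →
          InSpan P R (f (t · ℓ (y + 1#))) → InSpan P R (f ((t * α⁻¹) · ℓ (y + α))) → InSpan P R (f (t · v))
        meet {t} {y} {P} {R} t≢0 g in₁ in₂ =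
          let (s , e) = good-three inj g on₁ on₂ (OnLine-base (t · v) (ℓ y)) z₁≢z₂
          in subst (InSpan P R) (sym e) (InSpan-line s in₁ in₂)
          where
          z₁ z₂ : Point
          z₁ = t · ℓ (y + 1#)
          z₂ = (t * α⁻¹) · ℓ (y + α)
          on₁ : OnLine (t · v) (ℓ y) z₁
          on₁ = t , vsolve (t ∷ y ∷ []) (v ∷ w ∷ []) (s₀ ⊡ (v₁ ⊞ (s₁ :+ one) ⊡ v₀)) (s₀ ⊡ v₀ ⊞ s₀ ⊡ (v₁ ⊞ s₁ ⊡ v₀)) (refl , refl , _)
          on₂ : OnLine (t · v) (ℓ y) z₂
          on₂ = t * α⁻¹ , from-difference (cong (_· (t · v)) (inv-right α≢0))
            (vsolve (t ∷ y ∷ α ∷ α⁻¹ ∷ []) (v ∷ w ∷ [])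
              ((s₀ :* s₃) ⊡ (v₁ ⊞ (s₁ :+ s₂) ⊡ v₀) ⊞ one ⊡ (s₀ ⊡ v₀))
              (s₀ ⊡ v₀ ⊞ (s₀ :* s₃) ⊡ (v₁ ⊞ s₁ ⊡ v₀) ⊞ (s₂ :* s₃) ⊡ (s₀ ⊡ v₀)) (refl , refl , _))
          z₁≢z₂ : z₁ ≢ z₂
          z₁≢z₂ e = -‿≢0 (α≢1 ∘ sym)
            (*-cancelˡ t≢0 (trans (*-cancelˡ (inv-≢0 α≢0) (trans lhs (trans (cong -_ (proj₂ (independent v≢𝟘 w∉⟨v⟩ {t * (y + 1#) + - (t * α⁻¹ * (y + α))} {t + - (t * α⁻¹)}
              (from-difference e (vsolve (t ∷ y ∷ α ∷ α⁻¹ ∷ []) (v ∷ w ∷ [])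
                ((s₀ :* (s₁ :+ one) :- s₀ :* s₃ :* (s₁ :+ s₂)) ⊡ v₀ ⊞ (s₀ :- s₀ :* s₃) ⊡ v₁ ⊞ (s₀ :* s₃) ⊡ (v₁ ⊞ (s₁ :+ s₂) ⊡ v₀))
                (𝟎 ⊞ s₀ ⊡ (v₁ ⊞ (s₁ :+ one) ⊡ v₀)) (refl , refl , _)))))) rhs))) (sym (zeroʳ t))))
            where
            open ≡-Reasoning
            lhs : α⁻¹ * (t * (1# + - α)) ≡ - (t + - (t * α⁻¹))
            lhs = begin
              α⁻¹ * (t * (1# + - α))  ≡⟨ solve 3 (λ t a b → b :* (t :* (con (ℤ.+ 1) :- a)) := t :* b :- t :* (a :* b)) refl t α α⁻¹ ⟩
              t * α⁻¹ + - (t * (α * α⁻¹))  ≡⟨ cong (λ x → t * α⁻¹ + - (t * x)) (inv-right α≢0) ⟩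
              t * α⁻¹ + - (t * 1#)  ≡⟨ solve 2 (λ t b → t :* b :- t :* con (ℤ.+ 1) := :- (t :- t :* b)) refl t α⁻¹ ⟩
              - (t + - (t * α⁻¹)) ∎
            rhs : - 0# ≡ α⁻¹ * 0#
            rhs = solve 1 (λ b → :- con (ℤ.+ 0) := b :* con (ℤ.+ 0)) refl α⁻¹

        good-from-rays : ∀ {R} → (∀ t → t ≢ 0# → ∃ λ s → f (t · v) ≡ s · R) → Good f 𝟘 v
        good-from-rays {R} rays = good 𝟘 R on
          where
          on : ∀ t → OnLine 𝟘 R (f (𝟘 ⊕ (t · v)))
          on t with t ≟ 0#
          ... | yes t≡0 = 0# , trans (cong f (trans (𝟘⊕ _) (trans (cong (_· v) t≡0) (0· v)))) (trans f𝟘 (sym (trans (𝟘⊕ _) (0· R))))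
          ... | no t≢0 = let (s , e) = rays t t≢0 in s , trans (cong f (𝟘⊕ _)) (trans e (sym (𝟘⊕ _)))

        ℓ∈ : ∀ x → ℓ x ∈⟨ ℓ x ⟩
        ℓ∈ x = 1# , sym (1· _)

        not-on-ray : (∀ x → Good f 𝟘 (ℓ x)) → ∀ {t x κ s} → t ≢ 0# → κ · ℓ x ≢ 𝟘 → f (t · v) ≢ s · f (κ · ℓ x)
        not-on-ray rays {t} {x} {κ} {s} t≢0 y≢𝟘 e =
          let (κ′ , e′) = ray-onto (rays x) (κ , refl) y≢𝟘 s in tv≢κℓ t≢0 (inj _ _ (trans e e′))

      module _ (rays : ∀ x → Good f 𝟘 (ℓ x)) where

        -- Each ray meets the good line `w + ⟨v⟩`, so the images of the rays lie in the span of `P`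
        -- and `R`, and by `meet` so does `f (t · v)`. A nonzero coefficient at `P` would place it
        -- on the image of a ray, against injectivity; so only multiples of `R` remain.
        pencil-parallel : Good f w v → (∀ t → t ≢ 0# → ∃ λ y → Good f (t · v) (ℓ y)) → Good f 𝟘 v
        pencil-parallel m crossing = good-from-rays λ t t≢0 →
          let (y , g) = crossing t t≢0
              (A , B , e) = meet t≢0 g (span _ t) (span _ (t * α⁻¹))
          in multiple t≢0 A B e
          where
          P R : Point
          P = f w
          R = f (w ⊕ v) ⊝ f w
          w≢w+v : w ≢ w ⊕ v
          w≢w+v e = v≢𝟘 (from-difference (sym e) (vsolve [] (v ∷ w ∷ []) (v₀ ⊞ v₁) (𝟎 ⊞ (v₁ ⊞ v₀)) (refl , refl , _)))
          span : ∀ x κ → InSpan P R (f (κ · ℓ x))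
          span x κ =
            let (s , e) = good-three inj m (OnLine-base w v) (OnLine-tip w v) (x , refl) w≢w+v
                (k , e′) = ray (rays x) (ℓ∈ x) (ℓ≢𝟘 x) κ
            in subst (InSpan P R) (sym e′) (InSpan-· k (1# , s , trans e (cong (_⊕ (s · R)) (sym (1· P)))))
          multiple : ∀ {t} → t ≢ 0# → ∀ A B → f (t · v) ≡ (A · P) ⊕ (B · R) → ∃ λ s → f (t · v) ≡ s · R
          multiple t≢0 A B e with A ≟ 0#
          ... | yes A≡0 = B , trans e (trans (cong (_⊕ (B · R)) (trans (cong (_· P) A≡0) (0· P))) (𝟘⊕ _))
          ... | no A≢0 =
            let (x , e′) = good-onto inj m (OnLine-base w v) (OnLine-tip w v) w≢w+v (inv A≢0 * B)
            in contradiction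
              (trans e (trans (normalise-span A≢0) (trans (cong (A ·_) (sym e′)) (cong (λ p → A · f p) (sym (1· _))))))
              (not-on-ray rays t≢0 (ℓ≢𝟘 x ∘ trans (sym (1· _))))

        -- No good parallel of `⟨v⟩` is at hand, so the good line `v + ⟨w⟩` has to span the image
        -- plane. It meets every ray except its own parallel `⟨w⟩`, which is treated apart. In that
        -- plane the images of the rays cover the multiples of `R` and of all points of `f v + ⟨R⟩`
        -- other than `f v`, so `f (t · v)` must be a multiple of `f v`.
        pencil-all : (∀ t x → Good f (t · v) (ℓ x)) → Good f 𝟘 v
        pencil-all crossing = good-from-rays λ t t≢0 →
          let (A , B , e) = meet t≢0 (crossing t 0#) (span′ _ t) (span′ _ (t * α⁻¹)) in multiple t≢0 A B e
          where
          P R : Point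
          P = f v
          R = f (v ⊕ w) ⊝ f v
          ℓ0≡w : ℓ 0# ≡ w
          ℓ0≡w = vsolve [] (v ∷ w ∷ []) (v₁ ⊞ con (ℤ.+ 0) ⊡ v₀) v₁ (refl , refl , _)
          m : Good f v w
          m = subst₂ (Good f) (1· v) ℓ0≡w (crossing 1# 0#)
          v≢v+w : v ≢ v ⊕ w
          v≢v+w e = w≢𝟘 (from-difference (sym e) (vsolve [] (v ∷ w ∷ []) (v₁ ⊞ v₀) (𝟎 ⊞ (v₀ ⊞ v₁)) (refl , refl , _)))
          v+sw≢κw : ∀ {s κ} → v ⊕ (s · w) ≢ κ · w
          v+sw≢κw {s} {κ} e = 0≢1 (sym (proj₁ (independent v≢𝟘 w∉⟨v⟩ {1#} {s + - κ}
            (from-difference e (vsolve (s ∷ κ ∷ []) (v ∷ w ∷ [])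
              (one ⊡ v₀ ⊞ (s₀ :- s₁) ⊡ v₁ ⊞ s₁ ⊡ v₁) (𝟎 ⊞ (v₀ ⊞ s₀ ⊡ v₁)) (refl , refl , _))))))
          -- The ray through ℓ x meets v + ⟨w⟩ at v + x⁻¹w.
          on-m : ∀ {x} (x≢0 : x ≢ 0#) → inv x≢0 · ℓ x ≡ v ⊕ (inv x≢0 · w)
          on-m {x} x≢0 = from-difference (cong (_· v) (inv-left x≢0))
            (vsolve (x ∷ inv x≢0 ∷ []) (v ∷ w ∷ []) (s₁ ⊡ (v₁ ⊞ s₀ ⊡ v₀) ⊞ one ⊡ v₀) (v₀ ⊞ s₁ ⊡ v₁ ⊞ (s₁ :* s₀) ⊡ v₀) (refl , refl , _))
          P-span : InSpan P R P
          P-span = 1# , 0# , vsolve [] (P ∷ R ∷ []) v₀ (one ⊡ v₀ ⊞ con (ℤ.+ 0) ⊡ v₁) (refl , refl , _)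
          span : ∀ {x} → x ≢ 0# → ∀ κ → InSpan P R (f (κ · ℓ x))
          span {x} x≢0 κ =
            let (s , e) = good-three inj m (OnLine-base v w) (OnLine-tip v w) (inv x≢0 , on-m x≢0) v≢v+w
                (k , e′) = ray (rays x) (inv x≢0 , refl) (·-≢𝟘 (inv-≢0 x≢0) (ℓ≢𝟘 x)) κ
            in subst (InSpan P R) (sym e′) (InSpan-· k (1# , s , trans e (cong (_⊕ (s · R)) (sym (1· P)))))
          -w : Point
          -w = (- 1#) · w
          -w-span : InSpan P R (f -w)
          -- The line through `v` in direction `ℓ 1#` contains `-w` and meets the ray of `ℓ α` in
          -- `β · ℓ α`, because `β * (α - 1) = 1`; both other points already have images in the
          -- span.
          -w-span =
            let (s , e) = good-three inj (subst (λ p → Good f p (ℓ 1#)) (1· v) (crossing 1# 1#))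
                            (OnLine-base v (ℓ 1#)) (β , on-z) (- 1# , on-w) v≢z
            in subst (InSpan P R) (sym e) (InSpan-line s P-span (span α≢0 β))
            where
            on-z : β · ℓ α ≡ v ⊕ (β · ℓ 1#)
            on-z = from-difference (cong (_· v) (inv-right α-1≢0))
              (vsolve (α ∷ β ∷ []) (v ∷ w ∷ []) (s₁ ⊡ (v₁ ⊞ s₀ ⊡ v₀) ⊞ one ⊡ v₀)
                (v₀ ⊞ s₁ ⊡ (v₁ ⊞ one ⊡ v₀) ⊞ ((s₀ :- one) :* s₁) ⊡ v₀) (refl , refl , _))
            on-w : -w ≡ v ⊕ ((- 1#) · ℓ 1#)
            on-w = vsolve [] (v ∷ w ∷ []) ((:- one) ⊡ v₁) (v₀ ⊞ (:- one) ⊡ (v₁ ⊞ one ⊡ v₀)) (refl , refl , _)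
            v≢z : v ≢ β · ℓ α
            v≢z e = tv≢κℓ {1#} {α} {β} (0≢1 ∘ sym) (trans (1· v) e)
          -w≢𝟘 : -w ≢ 𝟘
          -w≢𝟘 = ·-≢𝟘 (λ e → 0≢1 (trans (sym -‿0) (trans (cong -_ (sym e)) -‿1))) w≢𝟘
            where
            -‿0 : - 0# ≡ 0#
            -‿0 = solve 0 (:- con (ℤ.+ 0) := con (ℤ.+ 0)) refl
            -‿1 : - (- 1#) ≡ 1#
            -‿1 = solve 0 (:- (:- con (ℤ.+ 1)) := con (ℤ.+ 1)) refl
          good-w : Good f 𝟘 w
          good-w = subst (Good f 𝟘) ℓ0≡w (rays 0#)
          -- f v + ⟨R⟩ and the image of ⟨w⟩ are disjoint lines of one plane, hence parallel.
          ⟨w⟩-parallel : ∃ λ B → f -w ≡ B · R × B ≢ 0#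
          ⟨w⟩-parallel = go (proj₁ -w-span) (proj₁ (proj₂ -w-span)) (proj₂ (proj₂ -w-span))
            where
            go : ∀ A B → f -w ≡ (A · P) ⊕ (B · R) → ∃ λ B → f -w ≡ B · R × B ≢ 0#
            go A B e with A ≟ 0#
            ... | yes A≡0 = B , e′ , λ B≡0 → f≢𝟘 -w≢𝟘 (trans e′ (trans (cong (_· R) B≡0) (0· R)))
              where
              e′ : f -w ≡ B · R
              e′ = trans e (trans (cong (_⊕ (B · R)) (trans (cong (_· P) A≡0) (0· P))) (𝟘⊕ _))
            ... | no A≢0 =
              let (s , e₁) = good-onto inj m (OnLine-base v w) (OnLine-tip v w) v≢v+w (inv A≢0 * B)
                  (κ , e₂) = ray-onto good-w (- 1# , refl) -w≢𝟘 (inv A≢0)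
              in contradiction (inj _ _ (trans (trans e₁ (·-cancel A≢0 (trans (sym (normalise-span A≢0)) (trans (sym e) (sym (·-inv A≢0 _)))))) e₂)) v+sw≢κw
          B₀ : Carrier
          B₀ = proj₁ ⟨w⟩-parallel
          f-w≡ : f -w ≡ B₀ · R
          f-w≡ = proj₁ (proj₂ ⟨w⟩-parallel)
          B₀≢0 : B₀ ≢ 0#
          B₀≢0 = proj₂ (proj₂ ⟨w⟩-parallel)
          span′ : ∀ x κ → InSpan P R (f (κ · ℓ x))
          span′ x κ with x ≟ 0#
          ... | no x≢0 = span x≢0 κ
          ... | yes x≡0 =
            let (k , e) = ray good-w (- 1# , refl) -w≢𝟘 κ
            in subst (InSpan P R) (sym (trans (cong (λ u → f (κ · u)) (trans (cong ℓ x≡0) ℓ0≡w)) e))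
                 (InSpan-· k -w-span)
          multiple : ∀ {t} → t ≢ 0# → ∀ A B → f (t · v) ≡ (A · P) ⊕ (B · R) → ∃ λ s → f (t · v) ≡ s · P
          multiple {t} t≢0 A B e with A ≟ 0#
          ... | yes A≡0 = contradiction
            (trans e (trans (cong (_⊕ (B · R)) (trans (cong (_· P) A≡0) (0· P))) (trans (𝟘⊕ _)
              (trans (cong (B ·_) (trans (sym (inv-· B₀≢0 R)) (cong (inv B₀≢0 ·_) (sym f-w≡)))) (trans (·-· B (inv B₀≢0) _)
                (cong (λ u → (B * inv B₀≢0) · f ((- 1#) · u)) (sym ℓ0≡w)))))))
            (not-on-ray rays {t} {0#} { - 1#} t≢0 (-w≢𝟘 ∘ trans (cong ((- 1#) ·_) (sym ℓ0≡w))))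
          ... | no A≢0 = go (good-onto inj m (OnLine-base v w) (OnLine-tip v w) v≢v+w (inv A≢0 * B))
            where
            e′ : f (t · v) ≡ A · (P ⊕ ((inv A≢0 * B) · R))
            e′ = trans e (normalise-span A≢0)
            go : (∃ λ s → f (v ⊕ (s · w)) ≡ P ⊕ ((inv A≢0 * B) · R)) → ∃ λ s → f (t · v) ≡ s · P
            go (s , eₛ) with s ≟ 0#
            ... | yes s≡0 = A , trans e′ (cong (A ·_) (trans (sym eₛ) (cong f (trans (cong (λ s → v ⊕ (s · w)) s≡0) (sym (proj₂ (OnLine-base v w)))))))
            ... | no s≢0 = contradiction
              (trans e′ (cong (A ·_) (trans (sym eₛ) (cong f (sym on-ℓ)))))
              (not-on-ray rays {t} {inv s≢0} {s} t≢0 (·-≢𝟘 s≢0 (ℓ≢𝟘 _)))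
              where
              on-ℓ : s · ℓ (inv s≢0) ≡ v ⊕ (s · w)
              on-ℓ = from-difference (cong (_· v) (inv-right s≢0))
                (vsolve (s ∷ inv s≢0 ∷ []) (v ∷ w ∷ []) (s₀ ⊡ (v₁ ⊞ s₁ ⊡ v₀) ⊞ one ⊡ v₀) (v₀ ⊞ s₀ ⊡ v₁ ⊞ (s₀ :* s₁) ⊡ v₀) (refl , refl , _))

    module _ {V : Point → Set} (V-⊕ : ∀ {x y} → V x → V y → V (x ⊕ y)) (V-· : ∀ s {x} → V x → V (s · x))
      (goodV : ∀ {p u} → V p → V u → Good f p u) where

      private
        V𝟘 : ∀ {x} → V x → V 𝟘
        V𝟘 {x} Vx = subst V (0· x) (V-· 0# Vx)

        -- If `A` were not 1, the coefficient of `f v` would vanish at the parameter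
        -- `s = 1 / (1 - A)` of the image of `v + ⟨w⟩`. That image would then meet the image of
        -- `⟨w⟩`, although the two lines are disjoint.
        coefficient≡1 : ∀ {v w} → V v → V w → v ≢ 𝟘 → ¬ (w ∈⟨ v ⟩) → ∀ {A B} →
          f (v ⊕ w) ≡ (A · f v) ⊕ (B · f w) → A ≡ 1#
        coefficient≡1 {v} {w} Vv Vw v≢𝟘 w∉ {A} {B} e with 1# ≟ A
        ... | yes 1≡A = sym 1≡A
        ... | no 1≢A =
          let (τ , e₁) = good-onto inj (goodV Vv Vw) (OnLine-base v w) (OnLine-tip v w) v≢v+w s
              (κ , e₂) = ray-onto (goodV (V𝟘 Vw) Vw) (1# , sym (1· w)) w≢𝟘 (s * B)
          in contradiction (inj _ _ (trans (trans e₁ crossing) e₂)) v+τw≢κw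
          where
          s : Carrier
          s = inv (-‿≢0 1≢A)
          w≢𝟘 : w ≢ 𝟘
          w≢𝟘 e = w∉ (0# , trans e (sym (0· v)))
          v≢v+w : v ≢ v ⊕ w
          v≢v+w e = w≢𝟘 (from-difference (sym e) (vsolve [] (v ∷ w ∷ []) (v₁ ⊞ v₀) (𝟎 ⊞ (v₀ ⊞ v₁)) (refl , refl , _)))
          v+τw≢κw : ∀ {τ κ} → v ⊕ (τ · w) ≢ κ · w
          v+τw≢κw {τ} {κ} e = 0≢1 (sym (proj₁ (independent v≢𝟘 w∉ {1#} {τ + - κ}
            (from-difference e (vsolve (τ ∷ κ ∷ []) (v ∷ w ∷ [])
              (one ⊡ v₀ ⊞ (s₀ :- s₁) ⊡ v₁ ⊞ s₁ ⊡ v₁) (𝟎 ⊞ (v₀ ⊞ s₀ ⊡ v₁)) (refl , refl , _))))))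
          crossing : f v ⊕ (s · (f (v ⊕ w) ⊝ f v)) ≡ (s * B) · f w
          crossing = trans (cong (λ p → f v ⊕ (s · (p ⊝ f v))) e)
            (from-difference (cong (_· f v) (sym (inv-right (-‿≢0 1≢A))))
              (vsolve (A ∷ B ∷ s ∷ []) (f v ∷ f w ∷ [])
                (v₀ ⊞ s₂ ⊡ ((s₀ ⊡ v₀ ⊞ s₁ ⊡ v₁) ⊟ v₀) ⊞ ((one :- s₀) :* s₂) ⊡ v₀)
                ((s₂ :* s₁) ⊡ v₁ ⊞ one ⊡ v₀) (refl , refl , _)))

        -- v + w lies on the line through αv and αβw, since 1/α + 1/(αβ) = 1.
        sum-in-span : ∀ {v w} → V v → V w → v ≢ 𝟘 → ¬ (w ∈⟨ v ⟩) → InSpan (f v) (f w) (f (v ⊕ w))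
        sum-in-span {v} {w} Vv Vw v≢𝟘 w∉ =
          let (s , e) = good-three inj (goodV (V-· α Vv) (V-⊕ (V-· (α * β) Vw) (V-· (- 1#) (V-· α Vv))))
                          (OnLine-base _ _) (1# , on-w) (α⁻¹ * (α + - 1#) , on-sum) distinct
              (a , ea) = ray (goodV (V𝟘 Vv) Vv) (1# , sym (1· v)) v≢𝟘 α
              (c , ec) = ray (goodV (V𝟘 Vw) Vw) (1# , sym (1· w)) w≢𝟘 (α * β)
          in subst (InSpan (f v) (f w)) (sym e) (InSpan-line s
               (a , 0# , trans ea (vsolve (a ∷ []) (f v ∷ f w ∷ []) (s₀ ⊡ v₀) (s₀ ⊡ v₀ ⊞ con (ℤ.+ 0) ⊡ v₁) (refl , refl , _)))
               (0# , c , trans ec (vsolve (c ∷ []) (f v ∷ f w ∷ []) (s₀ ⊡ v₁) (con (ℤ.+ 0) ⊡ v₀ ⊞ s₀ ⊡ v₁) (refl , refl , _))))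
          where
          w≢𝟘 : w ≢ 𝟘
          w≢𝟘 e = w∉ (0# , trans e (sym (0· v)))
          on-w : (α * β) · w ≡ (α · v) ⊕ (1# · (((α * β) · w) ⊝ (α · v)))
          on-w = vsolve (α ∷ β ∷ []) (v ∷ w ∷ []) ((s₀ :* s₁) ⊡ v₁) (s₀ ⊡ v₀ ⊞ one ⊡ ((s₀ :* s₁) ⊡ v₁ ⊟ s₀ ⊡ v₀)) (refl , refl , _)
          on-sum : v ⊕ w ≡ (α · v) ⊕ ((α⁻¹ * (α + - 1#)) · (((α * β) · w) ⊝ (α · v)))
          on-sum = from-difference
            (cong₂ _⊕_ (cong (_· (((α + - 1#) · v) ⊝ w)) (inv-right α≢0)) (cong (_· ((α * α⁻¹) · w)) (sym (inv-right α-1≢0))))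
            (vsolve (α ∷ β ∷ α⁻¹ ∷ []) (v ∷ w ∷ [])
              (v₀ ⊞ v₁ ⊞ (one ⊡ ((s₀ :- one) ⊡ v₀ ⊟ v₁) ⊞ ((s₀ :- one) :* s₁) ⊡ ((s₀ :* s₂) ⊡ v₁)))
              (s₀ ⊡ v₀ ⊞ (s₂ :* (s₀ :- one)) ⊡ ((s₀ :* s₁) ⊡ v₁ ⊟ s₀ ⊡ v₀) ⊞ ((s₀ :* s₂) ⊡ ((s₀ :- one) ⊡ v₀ ⊟ v₁) ⊞ one ⊡ ((s₀ :* s₂) ⊡ v₁)))
              (refl , refl , _))
          distinct : α · v ≢ (α * β) · w
          distinct e = α≢0 (proj₁ (independent v≢𝟘 w∉ {α} { - (α * β)} (from-difference e
            (vsolve (α ∷ β ∷ []) (v ∷ w ∷ []) (s₀ ⊡ v₀ ⊞ (:- (s₀ :* s₁)) ⊡ v₁ ⊞ (s₀ :* s₁) ⊡ v₁) (𝟎 ⊞ s₀ ⊡ v₀) (refl , refl , _)))))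

        additive-independent : ∀ {v w} → V v → V w → v ≢ 𝟘 → ¬ (w ∈⟨ v ⟩) → f (v ⊕ w) ≡ f v ⊕ f w
        additive-independent {v} {w} Vv Vw v≢𝟘 w∉ =
          let (A , B , e) = sum-in-span Vv Vw v≢𝟘 w∉
              A≡1 = coefficient≡1 Vv Vw v≢𝟘 w∉ e
              B≡1 = coefficient≡1 Vw Vv (λ w≡𝟘 → w∉ (0# , trans w≡𝟘 (sym (0· v)))) (w∉ ∘ ∈⟨⟩-sym v≢𝟘)
                      (trans (cong f (⊕-comm w v)) (trans e (⊕-comm _ _)))
          in trans e (cong₂ _⊕_ (trans (cong (_· f v) A≡1) (1· _)) (trans (cong (_· f w) B≡1) (1· _)))

        f-⊕𝟘 : ∀ v → f (v ⊕ 𝟘) ≡ f v ⊕ f 𝟘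
        f-⊕𝟘 v = trans (cong f (⊕𝟘 v)) (sym (trans (cong (f v ⊕_) f𝟘) (⊕𝟘 _)))

        additive-outside : ∀ {v u y} → V v → V u → ¬ (u ∈⟨ v ⟩) → y ∈⟨ v ⟩ → f (y ⊕ u) ≡ f y ⊕ f u
        additive-outside {v} {u} {y} Vv Vu u∉ (c , refl) with c · v ≟ 𝟘
        ... | yes cv≡𝟘 = trans (cong f (⊕-comm _ u)) (trans (cong (λ p → f (u ⊕ p)) cv≡𝟘)
                (trans (f-⊕𝟘 u) (trans (⊕-comm _ _) (cong (λ p → f p ⊕ f u) (sym cv≡𝟘)))))
        ... | no cv≢𝟘 = additive-independent (V-· c Vv) Vu cv≢𝟘
                (λ (s , u≡) → u∉ (s * c , trans u≡ (·-· s c v)))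

      -- Two parallel vectors are added with the help of a third one outside their line.
      additive : (∀ v → ∃ λ u → V u × ¬ (u ∈⟨ v ⟩)) → ∀ {v w} → V v → V w → f (v ⊕ w) ≡ f v ⊕ f w
      additive outside {v} {w} Vv Vw with v ≟ 𝟘 | w ∈⟨ v ⟩?
      ... | yes v≡𝟘 | _ = trans (cong (λ p → f (p ⊕ w)) v≡𝟘) (trans (cong f (⊕-comm 𝟘 w))
              (trans (f-⊕𝟘 w) (trans (⊕-comm _ _) (cong (λ p → f p ⊕ f w) (sym v≡𝟘)))))
      ... | no v≢𝟘 | no w∉ = additive-independent Vv Vw v≢𝟘 w∉
      ... | no v≢𝟘 | yes (c , w≡cv) = let (u , Vu , u∉) = outside v in ⊕-cancelʳ (f u) (begin
        f (v ⊕ w) ⊕ f u  ≡⟨ additive-outside Vv Vu u∉ (1# + c , trans (cong (v ⊕_) w≡cv) (vsolve (c ∷ []) (v ∷ []) (v₀ ⊞ s₀ ⊡ v₀) ((one :+ s₀) ⊡ v₀) (refl , _))) ⟨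
        f ((v ⊕ w) ⊕ u)  ≡⟨ cong f (⊕-assoc v w u) ⟩
        f (v ⊕ (w ⊕ u))  ≡⟨ additive-independent Vv (V-⊕ Vw Vu) v≢𝟘 (λ (s , e) → u∉ (s + - c , from-difference (trans (cong (_⊕ u) (sym w≡cv)) e)
                                (vsolve (c ∷ s ∷ []) (v ∷ u ∷ []) (v₁ ⊞ s₁ ⊡ v₀) ((s₁ :- s₀) ⊡ v₀ ⊞ (s₀ ⊡ v₀ ⊞ v₁)) (refl , refl , _)))) ⟩
        f v ⊕ f (w ⊕ u)  ≡⟨ cong (f v ⊕_) (additive-outside Vv Vu u∉ (c , w≡cv)) ⟩
        f v ⊕ (f w ⊕ f u)   ≡⟨ ⊕-assoc _ _ _ ⟨
        (f v ⊕ f w) ⊕ f u   ∎)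
        where open ≡-Reasoning

-- Semi-affine maps.

module SemiAffine {q} {K : FiniteField q} {n : ℕ} (S : Space K n) where
  open FiniteField K
  open Vectors S
  open Variables
  open Lines S

  module _ {h : Point → Point} (sa : IsSemiAffine h) where

    private
      σ : Carrier → Carrier
      σ = proj₁ sa
      g : Point → Point
      g = proj₁ (proj₂ (proj₂ sa))
      g-bijective : Bijective _≡_ _≡_ g
      g-bijective = proj₁ (proj₂ (proj₂ (proj₂ sa)))
      g-⊕ : ∀ x y → g (x ⊕ y) ≡ g x ⊕ g y
      g-⊕ = proj₁ (proj₂ (proj₂ (proj₂ (proj₂ sa))))
      g-· : ∀ s x → g (s · x) ≡ σ s · g x
      g-· = proj₁ (proj₂ (proj₂ (proj₂ (proj₂ (proj₂ sa)))))
      c : Point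
      c = proj₁ (proj₂ (proj₂ (proj₂ (proj₂ (proj₂ (proj₂ sa))))))
      h≡ : ∀ x → h x ≡ g x ⊕ c
      h≡ = proj₂ (proj₂ (proj₂ (proj₂ (proj₂ (proj₂ (proj₂ sa))))))

    semiaffine-injective : ∀ x y → h x ≡ h y → x ≡ y
    semiaffine-injective x y e = proj₁ g-bijective (⊕-cancelʳ c (trans (sym (h≡ x)) (trans e (h≡ y))))

    semiaffine-surjective : ∀ y → ∃ λ x → h x ≡ y
    semiaffine-surjective y = let (x , e) = proj₂ g-bijective (y ⊝ c) in
      x , trans (h≡ x) (trans (cong (_⊕ c) (e refl)) (trans (⊕-comm _ c) (⊕⊝ c y)))

    semiaffine-good : ∀ p v → Good h p v
    semiaffine-good p v = good (h p) (g v) λ t → σ t , (begin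
      h (p ⊕ (t · v))  ≡⟨ h≡ _ ⟩
      g (p ⊕ (t · v)) ⊕ c  ≡⟨ cong (_⊕ c) (trans (g-⊕ p (t · v)) (cong (g p ⊕_) (g-· t v))) ⟩
      (g p ⊕ (σ t · g v)) ⊕ c  ≡⟨ vsolve (σ t ∷ []) (g p ∷ g v ∷ c ∷ []) (v₀ ⊞ s₀ ⊡ v₁ ⊞ v₂) (v₀ ⊞ v₂ ⊞ s₀ ⊡ v₁) (refl , refl , refl , _) ⟩
      (g p ⊕ c) ⊕ (σ t · g v)  ≡⟨ cong (_⊕ (σ t · g v)) (h≡ p) ⟨
      h p ⊕ (σ t · g v)  ∎)
      where open ≡-Reasoning

    semiaffine-cong : ∀ {f} → (∀ x → f x ≡ h x) → IsSemiAffine f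
    semiaffine-cong f≗h = let (σ , aut , g , bij , add , hom , c , h≡) = sa in
      σ , aut , g , bij , add , hom , c , λ x → trans (f≗h x) (h≡ x)

-- Two-transitivity and the double coset of a transposition.

module DoubleCosets {q} {K : FiniteField q} {n : ℕ} (S : Space K n) where
  open FiniteField K
  open Vectors S
  open Variables
  open Lines S
  open SemiAffine S

  semiaffine-∘ : ∀ {h k} → IsSemiAffine h → IsSemiAffine k → IsSemiAffine (h ∘ k)
  semiaffine-∘ {h} {k} (σ , (σ-bij , σ-+ , σ-* , σ-1) , g , g-bij , g-⊕ , g-· , c , h≡)
                       (σ′ , (σ′-bij , σ′-+ , σ′-* , σ′-1) , g′ , g′-bij , g′-⊕ , g′-· , c′ , k≡) =
    σ ∘ σ′ , (Compose.bijective _≡_ _≡_ _≡_ σ′-bij σ-bij ,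
      (λ x y → trans (cong σ (σ′-+ x y)) (σ-+ _ _)) , (λ x y → trans (cong σ (σ′-* x y)) (σ-* _ _)) , trans (cong σ σ′-1) σ-1) ,
    g ∘ g′ , Compose.bijective _≡_ _≡_ _≡_ g′-bij g-bij ,
    (λ x y → trans (cong g (g′-⊕ x y)) (g-⊕ _ _)) , (λ s x → trans (cong g (g′-· s x)) (g-· _ _)) ,
    (g c′ ⊕ c) , λ x → trans (h≡ (k x)) (trans (cong (_⊕ c) (trans (cong g (k≡ x)) (g-⊕ _ _))) (⊕-assoc _ _ _))

  -- The transvection along w ⊝ v that sends v to w.
  module Transvection (φ : Point) {v w : Point} (φv≢0 : φ ∙ v ≢ 0#) (φw≢0 : φ ∙ w ≢ 0#) where

    i j : Carrier
    i = inv φv≢0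
    j = inv φw≢0

    L L⁻¹ : Point → Point
    L x = x ⊕ (((φ ∙ x) * i) · (w ⊝ v))
    L⁻¹ x = x ⊕ (((φ ∙ x) * j) · (v ⊝ w))

  -- The value `φ ∙ L x` is `(φ ∙ x) * i * (φ ∙ w)`, so `L⁻¹` removes exactly the multiple of
  -- `w ⊝ v` that `L` has added. Exchanging `v` and `w` exchanges `L` and `L⁻¹`, so both inverse
  -- laws follow.
  transvection-inverse : ∀ φ {v w} (φv≢0 : φ ∙ v ≢ 0#) (φw≢0 : φ ∙ w ≢ 0#) x →
    Transvection.L⁻¹ φ φv≢0 φw≢0 (Transvection.L φ φv≢0 φw≢0 x) ≡ x
  transvection-inverse φ {v} {w} φv≢0 φw≢0 x = begin
    L x ⊕ (((φ ∙ L x) * j) · (v ⊝ w))  ≡⟨ cong (λ c → L x ⊕ (c · (v ⊝ w))) value ⟩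
    L x ⊕ (((φ ∙ x) * i) · (v ⊝ w))  ≡⟨ vsolve ((φ ∙ x) * i ∷ []) (x ∷ v ∷ w ∷ []) (v₀ ⊞ s₀ ⊡ (v₂ ⊟ v₁) ⊞ s₀ ⊡ (v₁ ⊟ v₂)) v₀ (refl , refl , refl , _) ⟩
    x ∎
    where
    open ≡-Reasoning
    open Transvection φ φv≢0 φw≢0
    value : (φ ∙ L x) * j ≡ (φ ∙ x) * i
    value = begin
      (φ ∙ L x) * j  ≡⟨ cong (_* j) (trans (∙-⊕ φ x _) (cong (φ ∙ x +_) (trans (∙-· φ _ _) (cong (((φ ∙ x) * i) *_) (∙-⊝ φ w v))))) ⟩
      (φ ∙ x + ((φ ∙ x) * i) * (φ ∙ w + - (φ ∙ v))) * j  ≡⟨ solve 5 (λ x i j v w → (x :+ (x :* i) :* (w :- v)) :* j := x :* j :+ x :* i :* (w :* j) :- x :* (v :* i) :* j) refl (φ ∙ x) i j (φ ∙ v) (φ ∙ w) ⟩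
      (φ ∙ x) * j + (φ ∙ x) * i * ((φ ∙ w) * j) + - ((φ ∙ x) * ((φ ∙ v) * i) * j)  ≡⟨ cong₂ (λ a b → (φ ∙ x) * j + (φ ∙ x) * i * a + - ((φ ∙ x) * b * j)) (inv-right φw≢0) (inv-right φv≢0) ⟩
      (φ ∙ x) * j + (φ ∙ x) * i * 1# + - ((φ ∙ x) * 1# * j)  ≡⟨ solve 3 (λ x i j → x :* j :+ x :* i :* con (ℤ.+ 1) :- x :* con (ℤ.+ 1) :* j := x :* i) refl (φ ∙ x) i j ⟩
      (φ ∙ x) * i ∎

  abstract
    -- Take `φ` with value 1 at `v` and `ψ` with value 1 at `w`. If `φ` vanishes at `w` and `ψ` at
    -- `v`, their sum has value 1 at both.
    common-functional : ∀ {v w} → v ≢ 𝟘 → w ≢ 𝟘 → ∃ λ φ → φ ∙ v ≢ 0# × φ ∙ w ≢ 0#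
    common-functional {v} {w} v≢𝟘 w≢𝟘 with ∙-nondegenerate v v≢𝟘 | ∙-nondegenerate w w≢𝟘
    ... | φ , vφ≡1 | ψ , wψ≡1 with φ ∙ w ≟ 0# | ψ ∙ v ≟ 0#
    ... | no φw≢0 | _ = φ , (λ e → 0≢1 (trans (sym e) (trans (∙-comm φ v) vφ≡1))) , φw≢0
    ... | yes _ | no ψv≢0 = ψ , ψv≢0 , (λ e → 0≢1 (trans (sym e) (trans (∙-comm ψ w) wψ≡1)))
    ... | yes φw≡0 | yes ψv≡0 = φ ⊕ ψ ,
      (λ e → 0≢1 (trans (sym e) (trans (∙-comm (φ ⊕ ψ) v) (trans (∙-⊕ v φ ψ) (trans (cong₂ _+_ vφ≡1 (trans (∙-comm v ψ) ψv≡0)) (+-identityʳ 1#)))))) ,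
      (λ e → 0≢1 (trans (sym e) (trans (∙-comm (φ ⊕ ψ) w) (trans (∙-⊕ w φ ψ) (trans (cong₂ _+_ (trans (∙-comm w φ) φw≡0) wψ≡1) (+-identityˡ 1#))))))

  module _ (φ : Point) {v w : Point} (φv≢0 : φ ∙ v ≢ 0#) (φw≢0 : φ ∙ w ≢ 0#) where
    open Transvection φ φv≢0 φw≢0

    transvection-semiaffine : ∀ c → IsSemiAffine (λ x → L x ⊕ c)
    transvection-semiaffine c = id , ((id , λ y → y , id) , (λ _ _ → refl) , (λ _ _ → refl) , refl) ,
      L , (injective , λ y → L⁻¹ y , λ z≡ → trans (cong L z≡) (transvection-inverse φ φw≢0 φv≢0 y)) ,
      (λ x y → trans (cong (λ a → (x ⊕ y) ⊕ ((a * i) · (w ⊝ v))) (∙-⊕ φ x y))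
        (vsolve (φ ∙ x ∷ φ ∙ y ∷ i ∷ []) (x ∷ y ∷ w ⊝ v ∷ []) (v₀ ⊞ v₁ ⊞ ((s₀ :+ s₁) :* s₂) ⊡ v₂) (v₀ ⊞ (s₀ :* s₂) ⊡ v₂ ⊞ (v₁ ⊞ (s₁ :* s₂) ⊡ v₂)) (refl , refl , refl , _))) ,
      (λ s x → trans (cong (λ a → (s · x) ⊕ ((a * i) · (w ⊝ v))) (∙-· φ s x))
        (vsolve (s ∷ φ ∙ x ∷ i ∷ []) (x ∷ w ⊝ v ∷ []) (s₀ ⊡ v₀ ⊞ (s₀ :* s₁ :* s₂) ⊡ v₁) (s₀ ⊡ (v₀ ⊞ (s₁ :* s₂) ⊡ v₁)) (refl , refl , _))) ,
      c , λ _ → refl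
      where
      injective : ∀ {x y} → L x ≡ L y → x ≡ y
      injective {x} {y} e = trans (sym (transvection-inverse φ φv≢0 φw≢0 x)) (trans (cong L⁻¹ e) (transvection-inverse φ φv≢0 φw≢0 y))

  abstract
    -- A linear map takes `r ⊝ p` to `y ⊝ x`, and a translation then moves the image of `p` to `x`.
    -- The inverse is returned as well, because `swap⇒double-coset` needs it as a semi-affine map.
    two-transitive : ∀ {p r x y} → p ≢ r → x ≢ y → Σ (Point → Point) λ H → Σ (Point → Point) λ H⁻¹ →
      IsSemiAffine H × IsSemiAffine H⁻¹ × (∀ z → H⁻¹ (H z) ≡ z) × H p ≡ x × H r ≡ y
    two-transitive {p} {r} {x} {y} p≢r x≢y =
      H , H⁻¹ , transvection-semiaffine φ φv≢0 φw≢0 (x ⊝ L p) , transvection-semiaffine φ φw≢0 φv≢0 (p ⊝ L⁻¹ x) , inverse′ , ⊕⊝ (L p) x , Hr≡y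
      where
      v w : Point
      v = r ⊝ p
      w = y ⊝ x
      functional : ∃ λ φ → φ ∙ v ≢ 0# × φ ∙ w ≢ 0#
      functional = common-functional (λ e → p≢r (sym (⊝≡𝟘 e))) (λ e → x≢y (sym (⊝≡𝟘 e)))
      φ : Point
      φ = proj₁ functional
      φv≢0 : φ ∙ v ≢ 0#
      φv≢0 = proj₁ (proj₂ functional)
      φw≢0 : φ ∙ w ≢ 0#
      φw≢0 = proj₂ (proj₂ functional)
      open Transvection φ φv≢0 φw≢0
      H H⁻¹ : Point → Point
      H z = L z ⊕ (x ⊝ L p)
      H⁻¹ z = L⁻¹ z ⊕ (p ⊝ L⁻¹ x)
      L⁻¹-⊕ : ∀ u z → L⁻¹ (u ⊕ z) ≡ L⁻¹ u ⊕ L⁻¹ z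
      L⁻¹-⊕ = proj₁ (proj₂ (proj₂ (proj₂ (proj₂ (transvection-semiaffine φ φw≢0 φv≢0 𝟘)))))
      L⁻¹-· : ∀ s z → L⁻¹ (s · z) ≡ s · L⁻¹ z
      L⁻¹-· = proj₁ (proj₂ (proj₂ (proj₂ (proj₂ (proj₂ (transvection-semiaffine φ φw≢0 φv≢0 𝟘))))))
      inverse′ : ∀ z → H⁻¹ (H z) ≡ z
      inverse′ z = trans (cong (_⊕ (p ⊝ L⁻¹ x)) (trans (L⁻¹-⊕ (L z) _) (cong₂ _⊕_ (transvection-inverse φ φv≢0 φw≢0 z)
          (trans (L⁻¹-⊕ x _) (cong (L⁻¹ x ⊕_) (trans (L⁻¹-· (- 1#) (L p)) (cong ((- 1#) ·_) (transvection-inverse φ φv≢0 φw≢0 p))))))))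
        (vsolve [] (z ∷ L⁻¹ x ∷ p ∷ []) (v₀ ⊞ (v₁ ⊟ v₂) ⊞ (v₂ ⊟ v₁)) v₀ (refl , refl , refl , _))
      Hr≡y : H r ≡ y
      Hr≡y = from-difference (cong (_· (w ⊝ v)) (trans (cong (_* i) (sym (∙-⊝ φ r p))) (inv-right φv≢0)))
        (vsolve (φ ∙ r ∷ φ ∙ p ∷ i ∷ []) (p ∷ r ∷ x ∷ y ∷ [])
          (v₁ ⊞ (s₀ :* s₂) ⊡ ((v₃ ⊟ v₂) ⊟ (v₁ ⊟ v₀)) ⊞ (v₂ ⊟ (v₀ ⊞ (s₁ :* s₂) ⊡ ((v₃ ⊟ v₂) ⊟ (v₁ ⊟ v₀)))) ⊞ one ⊡ ((v₃ ⊟ v₂) ⊟ (v₁ ⊟ v₀)))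
          (v₃ ⊞ ((s₀ :- s₁) :* s₂) ⊡ ((v₃ ⊟ v₂) ⊟ (v₁ ⊟ v₀))) (refl , refl , refl , refl , _))

  -- Here `f` is `h` preceded by the transposition of `p` and `r`, and conjugation by a map taking
  -- `p` to `x` and `r` to `y` turns `τ` into that transposition.
  swap⇒double-coset : ∀ {f h p r} → IsSemiAffine h → p ≢ r → f p ≡ h r → f r ≡ h p →
    (∀ x → x ≢ p → x ≢ r → f x ≡ h x) → ∀ τ → IsTransposition τ → InDoubleCoset τ f
  swap⇒double-coset {f} {h} {p} {r} sa p≢r fp fr rest τ (x , y , x≢y , τx , τy , τ-rest) =
    h ∘ H⁻¹ , H , semiaffine-∘ sa sa⁻¹ , saH , agree
    where
    maps : Σ (Point → Point) λ H → Σ (Point → Point) λ H⁻¹ →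
      IsSemiAffine H × IsSemiAffine H⁻¹ × (∀ z → H⁻¹ (H z) ≡ z) × H p ≡ x × H r ≡ y
    maps = two-transitive p≢r x≢y
    H H⁻¹ : Point → Point
    H = proj₁ maps
    H⁻¹ = proj₁ (proj₂ maps)
    saH : IsSemiAffine H
    saH = proj₁ (proj₂ (proj₂ maps))
    sa⁻¹ : IsSemiAffine H⁻¹
    sa⁻¹ = proj₁ (proj₂ (proj₂ (proj₂ maps)))
    H⁻¹H : ∀ z → H⁻¹ (H z) ≡ z
    H⁻¹H = proj₁ (proj₂ (proj₂ (proj₂ (proj₂ maps))))
    Hp : H p ≡ x
    Hp = proj₁ (proj₂ (proj₂ (proj₂ (proj₂ (proj₂ maps)))))
    Hr : H r ≡ y
    Hr = proj₂ (proj₂ (proj₂ (proj₂ (proj₂ (proj₂ maps)))))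
    H-inj : ∀ {z z′} → H z ≡ H z′ → z ≡ z′
    H-inj {z} {z′} e = trans (sym (H⁻¹H z)) (trans (cong H⁻¹ e) (H⁻¹H z′))
    agree : ∀ z → f z ≡ h (H⁻¹ (τ (H z)))
    agree z with z ≟ p | z ≟ r
    ... | yes refl | _ = trans fp (cong h (sym (trans (cong H⁻¹ (trans (cong τ Hp) (trans τx (sym Hr)))) (H⁻¹H r))))
    ... | no _ | yes refl = trans fr (cong h (sym (trans (cong H⁻¹ (trans (cong τ Hr) (trans τy (sym Hp)))) (H⁻¹H p))))
    ... | no z≢p | no z≢r = trans (rest z z≢p z≢r) (cong h (sym (trans (cong H⁻¹
            (τ-rest (H z) (λ e → z≢p (H-inj (trans e (sym Hp)))) (λ e → z≢r (H-inj (trans e (sym Hr)))))) (H⁻¹H z))))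

open import Data.Nat using (_+_; _*_; _^_; _∸_; _≤_; _<_; _≤?_; z≤n; s≤s; s≤s⁻¹; NonZero; >-nonZero)
open import Data.Nat.Properties hiding (_≟_)

-- Lower bounds for the bad lines of a plane and of a hyperplane.

module BadLineCounts {q} {K : FiniteField q} {n : ℕ} (S : Space K n)
  {α : FiniteField.Carrier K} (α≢0 : α ≢ FiniteField.0# K) (α≢1 : α ≢ FiniteField.1# K)
  (f : Space.Point S → Space.Point S) (inj : ∀ x y → f x ≡ f y → x ≡ y) where
  open FiniteField K using (Carrier; 0#; 1#; -_; 0≢1) renaming (_+_ to _+ᴷ_; _*_ to _*ᴷ_)
  open Vectors S hiding (+-comm; +-assoc; *-comm; *-assoc; +-identityʳ; +-identityˡ; *-identityʳ; *-identityˡ; *-cancelˡ)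
  open Variables
  open Lines S
  open Pencil S α≢0 α≢1

  β : Point → Point → ℕ
  β b v = 𝟏 (¬? (Good? f b v))

  β-cong : ∀ {b v b′ v′} → (Good f b v → Good f b′ v′) → (Good f b′ v′ → Good f b v) → β b v ≡ β b′ v′
  β-cong to from = 𝟏-cong (¬? (Good? f _ _)) (¬? (Good? f _ _)) (_∘ from) (_∘ to)

  β-bad : ∀ {b v} → ¬ Good f b v → β b v ≡ 1
  β-bad = 𝟏-yes (¬? (Good? f _ _))

  β-good : ∀ {b v} → β b v ≡ 0 → Good f b v
  β-good {b} {v} β≡0 = decidable-stable (Good? f b v) (λ bad → contradiction (trans (sym (β-bad bad)) β≡0) λ ())

  OnLine-sym : ∀ {b v b′} → OnLine b v b′ → OnLine b′ v b
  OnLine-sym {b} {v} (t , refl) = - t , vsolve (t ∷ []) (b ∷ v ∷ []) v₀ (v₀ ⊞ s₀ ⊡ v₁ ⊞ (:- s₀) ⊡ v₁) (refl , refl , _)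

  β-rebase : ∀ {b b′ v} → OnLine b v b′ → β b v ≡ β b′ v
  β-rebase on = β-cong (λ g → Good-rebase g on) (λ g → Good-rebase g (OnLine-sym on))

  β-scale : ∀ {b v x} → x ≢ 0# → β b (x · v) ≡ β b v
  β-scale {b} {v} {x} x≢0 = β-cong
    (λ g → Good-reparametrise g (OnLine-base b _) (inv x≢0 , sym (inv-· x≢0 v)))
    (λ g → Good-reparametrise g (OnLine-base b _) (x , refl))

  nonzero : Carrier → ℕ
  nonzero t = 𝟏 (¬? (0# ≟ t))

  N : ℕ
  N = ∑ nonzero

  1+N≡q : suc N ≡ q
  1+N≡q = trans (∑-≢ 0#) card-Carrier

  private
    ∑ᴷ-≥ : ∀ {c} {g : Carrier → ℕ} → (∀ t → c ≤ g t) → q * c ≤ ∑ g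
    ∑ᴷ-≥ {c} c≤g = ≤-trans (≤-reflexive (sym (∑ᴷ-const c))) (∑-mono c≤g)

    one≤ : ∀ {g : Carrier → ℕ} {t} → g t ≡ 1 → 1 ≤ ∑ g
    one≤ {g} {t} e = ≤-trans (≤-reflexive (sym e)) (term≤∑ g t)

    ∑-zero : ∀ {g : Carrier → ℕ} → ∑ g ≡ 0 → ∀ t → g t ≡ 0
    ∑-zero {g} e t = n≤0⇒n≡0 (≤-trans (term≤∑ g t) (≤-reflexive e))

  module _ {b v w : Point} (bad : ¬ Good f b v) (w∉ : ¬ (w ∈⟨ v ⟩)) where

    -- A crossing line is fixed by its point on the given line and its direction `w ⊕ (x · v)`, a
    -- parallel one by `t`, so every other line of the plane is counted exactly once.
    crossing-lines parallel-lines : ℕ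
    crossing-lines = ∑ (λ s → ∑ (λ x → β (b ⊕ (s · v)) (w ⊕ (x · v))))
    parallel-lines = ∑ (λ t → nonzero t * β (b ⊕ (t · w)) v)

    private
      v≢𝟘 : v ≢ 𝟘
      v≢𝟘 = ¬Good⇒≢𝟘 bad

      module Few (few : crossing-lines + parallel-lines < q) where

        crossing<q : crossing-lines < q
        crossing<q = ≤-<-trans (m≤m+n _ _) few

        -- Fewer than `q` bad crossing lines cannot touch all `q` points of the line; nor can they,
        -- in `some-good-at`, use up all `q` directions at one point.
        all-good-at : ∃ λ s → ∀ x → Good f (b ⊕ (s · v)) (w ⊕ (x · v))
        all-good-at with ∃? (λ s → ∀? (λ x → Good? f (b ⊕ (s · v)) (w ⊕ (x · v))))
        ... | yes e = e
        ... | no none = contradiction crossing<q (≤⇒≯ (≤-trans (≤-reflexive (sym (*-identityʳ q)))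
          (∑ᴷ-≥ {1} (λ s → let (x , bad′) = ¬∀⇒∃¬ (λ x → Good? f (b ⊕ (s · v)) (w ⊕ (x · v))) (λ all → none (s , all))
                           in one≤ {t = x} (β-bad bad′)))))

        some-good-at : ∀ s → ∃ λ x → Good f (b ⊕ (s · v)) (w ⊕ (x · v))
        some-good-at s with ∃? (λ x → Good? f (b ⊕ (s · v)) (w ⊕ (x · v)))
        ... | yes e = e
        ... | no none = contradiction crossing<q (≤⇒≯ (≤-trans
          (≤-trans (≤-reflexive (sym (*-identityʳ q))) (∑ᴷ-≥ {1} (λ x → ≤-reflexive (sym (β-bad (λ g → none (x , g)))))))
          (term≤∑ (λ s → ∑ (λ x → β (b ⊕ (s · v)) (w ⊕ (x · v)))) s)))

        -- The point found by `all-good-at` becomes the origin. The offset is scaled to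
        -- `w′ = t₀ · w`, so that the good parallel passes through `w′` as `pencil-parallel`
        -- expects; the directions are rescaled with it.
        with-parallel : ∀ {t₀} → t₀ ≢ 0# → Good f (b ⊕ (t₀ · w)) v → Good f b v
        with-parallel {t₀} t₀≢0 m = Good-rebase (subst (λ p → Good f p v) (⊕𝟘 b′) (Good-translate⁻ straight)) (OnLine-sym (s , refl))
          where
          s : Carrier
          s = proj₁ all-good-at
          b′ w′ : Point
          b′ = b ⊕ (s · v)
          w′ = t₀ · w
          w′∉ : ¬ (w′ ∈⟨ v ⟩)
          w′∉ (c , e) = w∉ (inv t₀≢0 *ᴷ c , trans (sym (inv-· t₀≢0 w)) (trans (cong (inv t₀≢0 ·_) e) (·-· _ _ v)))
          scaled : ∀ {p} x → Good f p (w ⊕ (x · v)) → Good f p (w′ ⊕ ((t₀ *ᴷ x) · v))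
          scaled {p} x g = Good-reparametrise g (OnLine-base p _) (t₀ ,
            vsolve (t₀ ∷ x ∷ []) (v ∷ w ∷ []) (s₀ ⊡ v₁ ⊞ (s₀ :* s₁) ⊡ v₀) (s₀ ⊡ (v₁ ⊞ s₁ ⊡ v₀)) (refl , refl , _))
          rays : ∀ x → Good (translate f b′) 𝟘 (w′ ⊕ (x · v))
          rays x = Good-translate⁺ (subst (λ p → Good f p (w′ ⊕ (x · v))) (sym (⊕𝟘 b′))
            (subst (λ y → Good f b′ (w′ ⊕ (y · v))) (*-inv-cancel t₀≢0 x) (scaled (inv t₀≢0 *ᴷ x) (proj₂ all-good-at _))))
          crossing : ∀ t → t ≢ 0# → ∃ λ y → Good (translate f b′) (t · v) (w′ ⊕ (y · v))
          crossing t _ = let (x , g) = some-good-at (s +ᴷ t) in t₀ *ᴷ x , Good-translate⁺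
            (subst (λ p → Good f p (w′ ⊕ ((t₀ *ᴷ x) · v)))
              (vsolve (s ∷ t ∷ []) (b ∷ v ∷ []) (v₀ ⊞ (s₀ :+ s₁) ⊡ v₁) (v₀ ⊞ s₀ ⊡ v₁ ⊞ s₁ ⊡ v₁) (refl , refl , _)) (scaled x g))
          straight : Good (translate f b′) 𝟘 v
          straight = pencil-parallel (translate f b′) (translate-injective inj b′) (translate-𝟘 f b′) v≢𝟘 w′∉ rays
            (Good-translate⁺ (Good-rebase m (s , vsolve (s ∷ []) (b ∷ v ∷ w′ ∷ []) (v₀ ⊞ s₀ ⊡ v₁ ⊞ v₂) (v₀ ⊞ v₂ ⊞ s₀ ⊡ v₁) (refl , refl , refl , _))))
            crossing

        -- The `q - 1` bad parallels exhaust the allowance of fewer than `q` bad lines, so every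
        -- crossing line is good.
        without-parallel : (∀ t → t ≢ 0# → ¬ Good f (b ⊕ (t · w)) v) → Good f b v
        without-parallel none = subst (λ p → Good f p v) (⊕𝟘 b) (Good-translate⁻
          (pencil-all (translate f b) (translate-injective inj b) (translate-𝟘 f b) v≢𝟘 w∉
            (λ x → subst (λ p → Good (translate f b) p (w ⊕ (x · v))) (0· v) (all-good 0# x)) all-good))
          where
          parallel≡N : parallel-lines ≡ N
          parallel≡N = ∑-cong pointwise
            where
            pointwise : ∀ t → nonzero t * β (b ⊕ (t · w)) v ≡ nonzero t
            pointwise t with 0# ≟ t
            ... | yes _  = refl
            ... | no 0≢t = trans (*-identityˡ _) (β-bad (none t (0≢t ∘ sym)))
          crossing≡0 : crossing-lines ≡ 0
          crossing≡0 = n≤0⇒n≡0 (+-cancelʳ-≤ N _ 0 (s≤s⁻¹ (≤-trans (subst (λ y → crossing-lines + y < q) parallel≡N few) (≤-reflexive (sym 1+N≡q)))))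
          all-good : ∀ t x → Good (translate f b) (t · v) (w ⊕ (x · v))
          all-good t x = Good-translate⁺ (β-good (∑-zero (∑-zero crossing≡0 t) x))

    plane-count : q ≤ crossing-lines + parallel-lines
    plane-count with q ≤? crossing-lines + parallel-lines
    ... | yes q≤ = q≤
    ... | no q≰ with ∃? (λ t → ¬? (t ≟ 0#) ×-dec Good? f (b ⊕ (t · w)) v)
      where open import Relation.Nullary.Decidable using (_×-dec_)
    ... | yes (t , t≢0 , m) = contradiction (Few.with-parallel (≰⇒> q≰) t≢0 m) bad
    ... | no none = contradiction (Few.without-parallel (≰⇒> q≰) (λ t t≢0 m → none (t , t≢0 , m))) bad

  ∙-shift : ∀ {a v} → a ∙ v ≡ 0# → ∀ x w → a ∙ (w ⊕ (x · v)) ≡ a ∙ w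
  ∙-shift {a} {v} av≡0 x w = trans (∙-⊕ a w (x · v)) (trans (cong (a ∙ w +ᴷ_) (trans (∙-· a x v) (cong (x *ᴷ_) av≡0)))
    (solve 2 (λ y x → y :+ x :* con (ℤ.+ 0) := y) refl (a ∙ w) x))

  ∙-scaled : ∀ {a v} → a ∙ v ≡ 0# → ∀ x → a ∙ (x · v) ≡ 0#
  ∙-scaled {a} {v} av≡0 x = trans (∙-· a x v) (trans (cong (x *ᴷ_) av≡0) (zeroʳ x))

  module _ {a b v : Point} (av≡0 : a ∙ v ≡ 0#) (bad : ¬ Good f b v) where

    private
      v≢𝟘 : v ≢ 𝟘
      v≢𝟘 = ¬Good⇒≢𝟘 bad

      inside outside : Point → ℕ
      inside w  = 𝟏 (w ∈⟨ v ⟩?)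
      outside w = χ a w * 𝟏 (¬? (w ∈⟨ v ⟩?))

      χ-inside : ∀ w → χ a w ≡ outside w + inside w
      χ-inside w with w ∈⟨ v ⟩?
      ... | yes (t , refl) = trans (𝟏-yes (a ∙ (t · v) ≟ 0#) (∙-scaled av≡0 t)) (cong (_+ 1) (sym (*-zeroʳ (χ a (t · v)))))
      ... | no _ = sym (trans (+-identityʳ _) (*-identityʳ _))

      ∑-χ : ∀ (g : Point → ℕ) → ∑ (λ w → χ a w * g w) ≡ ∑ (λ w → outside w * g w) + ∑ (λ w → inside w * g w)
      ∑-χ g = trans (∑-cong (λ w → trans (cong (_* g w) (χ-inside w)) (*-distribʳ-+ (g w) (outside w) (inside w)))) (∑-+ _ _)

      ∑-inside-≥ : ∀ (g : Point → ℕ) → ∑ (λ t → g (t · v)) ≤ ∑ (λ w → inside w * g w)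
      ∑-inside-≥ g = ∑-≤-injective (_· v)
        (λ t → ≤-reflexive (sym (trans (cong (_* g (t · v)) (𝟏-yes ((t · v) ∈⟨ v ⟩?) (t , refl))) (*-identityˡ _))))
        (λ _ _ _ _ → ·-injective v≢𝟘)

      ∑-inside-≤ : ∑ inside ≤ q
      ∑-inside-≤ = ≤-trans (∑-≤-surjective (_· v) {χ = λ _ → 1} (λ w in≢0 → let (t , e) = 𝟏-≢0 (w ∈⟨ v ⟩?) in≢0 in t , sym e , 𝟏-≤1 (w ∈⟨ v ⟩?)))
        (≤-reflexive (trans (∑ᴷ-const 1) (*-identityʳ q)))

      outside-shift : ∀ x w → outside (w ⊕ (x · v)) ≡ outside w
      outside-shift x w = cong₂ _*_
        (𝟏-cong (_ ≟ 0#) (_ ≟ 0#) (trans (sym (∙-shift av≡0 x w))) (trans (∙-shift av≡0 x w)))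
        (𝟏-cong (¬? (_ ∈⟨ v ⟩?)) (¬? (w ∈⟨ v ⟩?))
          (λ ∉ (t , w≡) → ∉ (t +ᴷ x , trans (cong (_⊕ (x · v)) w≡) (sym (·-distribʳ t x v))))
          (λ ∉ (t , e) → ∉ (t +ᴷ - x , from-difference e (vsolve (t ∷ x ∷ []) (w ∷ v ∷ []) (v₀ ⊞ s₀ ⊡ v₁) ((s₀ :- s₁) ⊡ v₁ ⊞ (v₀ ⊞ s₁ ⊡ v₁)) (refl , refl , _)))))

      outside-scale : ∀ {x} → x ≢ 0# → ∀ w → outside (x · w) ≡ outside w
      outside-scale {x} x≢0 w = cong₂ _*_
        (𝟏-cong (_ ≟ 0#) (_ ≟ 0#)
          (λ e → Vectors.*-cancelˡ S x≢0 (trans (sym (∙-· a x w)) (trans e (sym (zeroʳ x)))))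
          (λ e → ∙-scaled e x))
        (𝟏-cong (¬? (_ ∈⟨ v ⟩?)) (¬? (w ∈⟨ v ⟩?))
          (λ ∉ (t , w≡) → ∉ (x *ᴷ t , trans (cong (x ·_) w≡) (·-· x t v)))
          (λ ∉ (t , e) → ∉ (inv x≢0 *ᴷ t , trans (sym (inv-· x≢0 w)) (trans (cong (inv x≢0 ·_) e) (·-· _ t v)))))

      h : Point → ℕ
      h u = ∑ (λ s → β (b ⊕ (s · v)) u)

      -- X counts (up to scaling) the bad lines of the hyperplane meeting L = b + ⟨v⟩ in a point,
      -- Y the base points of the bad lines parallel to L.
      X Y : ℕ
      X = ∑ (λ u → outside u * h u)
      Y = ∑ (λ w → outside w * β (b ⊕ w) v)

      -- `plane-count` is summed over the kernel vectors `w` outside `⟨v⟩`. This set is stable under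
      -- `w ⊕ (x · v)` and under nonzero multiples, so each of the `q` shifts contributes `X` and
      -- each of the `N` nonzero scalars contributes `Y`.
      ∑-planes : q * ∑ outside ≤ q * X + N * Y
      ∑-planes = begin
        q * ∑ outside  ≡⟨ ∑-* q outside ⟨
        ∑ (λ w → q * outside w)  ≤⟨ ∑-mono pointwise ⟩
        ∑ (λ w → ∑ (λ x → outside (w ⊕ (x · v)) * h (w ⊕ (x · v))) + ∑ (λ t → nonzero t * (outside w * β (b ⊕ (t · w)) v)))  ≡⟨ ∑-+ _ _ ⟩
        ∑ (λ w → ∑ (λ x → outside (w ⊕ (x · v)) * h (w ⊕ (x · v)))) + ∑ (λ w → ∑ (λ t → nonzero t * (outside w * β (b ⊕ (t · w)) v))) ≡⟨ cong₂ _+_ crossing parallel ⟩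
        q * X + N * Y ∎
        where
        open ≤-Reasoning
        pointwise : ∀ w → q * outside w ≤ ∑ (λ x → outside (w ⊕ (x · v)) * h (w ⊕ (x · v))) + ∑ (λ t → nonzero t * (outside w * β (b ⊕ (t · w)) v))
        pointwise w = begin
          q * outside w  ≡⟨ *-comm q _ ⟩
          outside w * q  ≤⟨ bound ⟩
          outside w * (crossing′ + parallel′)  ≡⟨ *-distribˡ-+ (outside w) crossing′ parallel′ ⟩
          outside w * crossing′ + outside w * parallel′  ≡⟨ cong₂ _+_ (trans (cong (outside w *_) (∑-swap _)) (sym (∑-* (outside w) _))) (sym (∑-* (outside w) _)) ⟩
          ∑ (λ x → outside w * h (w ⊕ (x · v))) + ∑ (λ t → outside w * (nonzero t * β (b ⊕ (t · w)) v))
            ≡⟨ cong₂ _+_ (∑-cong (λ x → cong (_* h (w ⊕ (x · v))) (sym (outside-shift x w)))) (∑-cong (λ t → x∙yz≈y∙xz (outside w) (nonzero t) _)) ⟩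
          ∑ (λ x → outside (w ⊕ (x · v)) * h (w ⊕ (x · v))) + ∑ (λ t → nonzero t * (outside w * β (b ⊕ (t · w)) v)) ∎
          where
          crossing′ parallel′ : ℕ
          crossing′ = ∑ (λ s → ∑ (λ x → β (b ⊕ (s · v)) (w ⊕ (x · v))))
          parallel′ = ∑ (λ t → nonzero t * β (b ⊕ (t · w)) v)
          bound : outside w * q ≤ outside w * (crossing′ + parallel′)
          bound with w ∈⟨ v ⟩?
          ... | yes _ = ≤-trans (≤-reflexive (cong (_* q) (*-zeroʳ (χ a w)))) z≤n
          ... | no w∉ = *-monoʳ-≤ (χ a w * 1) (plane-count bad w∉)
        crossing : ∑ (λ w → ∑ (λ x → outside (w ⊕ (x · v)) * h (w ⊕ (x · v)))) ≡ q * X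
        crossing = trans (∑-swap _) (trans (∑-cong (λ x → trans (∑-cong (λ w → cong (λ u → outside u * h u) (⊕-comm w (x · v)))) (∑-shift (λ u → outside u * h u) (x · v)))) (∑ᴷ-const X))
        parallel : ∑ (λ w → ∑ (λ t → nonzero t * (outside w * β (b ⊕ (t · w)) v))) ≡ N * Y
        parallel = trans (∑-swap _) (trans (∑-cong each) (trans (∑-cong (λ t → *-comm (nonzero t) Y)) (trans (∑-* Y nonzero) (*-comm Y N))))
          where
          each : ∀ t → ∑ (λ w → nonzero t * (outside w * β (b ⊕ (t · w)) v)) ≡ nonzero t * Y
          each t with 0# ≟ t
          ... | yes _  = ∑-* 0 (λ w → outside w * β (b ⊕ (t · w)) v)
          ... | no 0≢t = trans (∑-* 1 _) (cong (1 *_) (trans (∑-cong (λ w → cong (_* β (b ⊕ (t · w)) v) (sym (outside-scale (0≢t ∘ sym) w))))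
                           (∑-scale (λ w → outside w * β (b ⊕ w) v) (0≢t ∘ sym))))

      H : Point → ℕ
      H u = ∑ (λ w → χ a w * β (b ⊕ w) u)

      -- A crossing line enters `H u` once for each of its `q` base points: moving by `t · u` stays
      -- on the line, and `(s · v) ⊕ (t · u)` determines `s` and `t`.
      H-crossing : ∀ u → outside u * (q * h u) ≤ outside u * H u
      H-crossing u with a ∙ u ≟ 0# | u ∈⟨ v ⟩?
      ... | no _ | _ = z≤n
      ... | yes _ | yes _ = z≤n
      ... | yes au≡0 | no u∉ = *-monoʳ-≤ 1 (begin
        q * h u  ≡⟨ ∑ᴷ-const (h u) ⟨
        ∑ {Carrier} (λ t → ∑ (λ s → β (b ⊕ (s · v)) u))  ≡⟨ ∑-cong (λ t → ∑-cong (λ s → β-rebase (t , ⊕-assoc-sym s t))) ⟩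
        ∑ (λ t → ∑ (λ s → β (b ⊕ ((s · v) ⊕ (t · u))) u))  ≡⟨ ∑-× _ ⟨
        ∑ (uncurry (λ t s → β (b ⊕ ((s · v) ⊕ (t · u))) u))  ≤⟨ ∑-≤-injective (uncurry (λ t s → (s · v) ⊕ (t · u))) in-kernel (λ x y _ _ → injective x y) ⟩
        H u ∎)
        where
        open ≤-Reasoning
        ⊕-assoc-sym : ∀ s t → b ⊕ ((s · v) ⊕ (t · u)) ≡ (b ⊕ (s · v)) ⊕ (t · u)
        ⊕-assoc-sym s t = sym (⊕-assoc b (s · v) (t · u))
        in-kernel : ∀ x → uncurry (λ t s → β (b ⊕ ((s · v) ⊕ (t · u))) u) x ≤ χ a (uncurry (λ t s → (s · v) ⊕ (t · u)) x) * β (b ⊕ uncurry (λ t s → (s · v) ⊕ (t · u)) x) u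
        in-kernel (t , s) = ≤-reflexive (sym (trans (cong (_* β (b ⊕ ((s · v) ⊕ (t · u))) u)
          (𝟏-yes (a ∙ ((s · v) ⊕ (t · u)) ≟ 0#) (trans (∙-shift au≡0 t (s · v)) (∙-scaled av≡0 s)))) (*-identityˡ _)))
        injective : ∀ (x y : Carrier × Carrier) → (proj₂ x · v) ⊕ (proj₁ x · u) ≡ (proj₂ y · v) ⊕ (proj₁ y · u) → x ≡ y
        injective (t , s) (t′ , s′) e = cong₂ _,_ (diff (proj₂ same)) (diff (proj₁ same))
          where
          same : s +ᴷ - s′ ≡ 0# × t +ᴷ - t′ ≡ 0#
          same = independent v≢𝟘 u∉ (from-difference e (vsolve (s ∷ t ∷ s′ ∷ t′ ∷ []) (v ∷ u ∷ [])
            ((s₀ :- s₂) ⊡ v₀ ⊞ (s₁ :- s₃) ⊡ v₁ ⊞ (s₂ ⊡ v₀ ⊞ s₃ ⊡ v₁)) (𝟎 ⊞ (s₀ ⊡ v₀ ⊞ s₁ ⊡ v₁)) (refl , refl , _)))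
          diff : ∀ {x y} → x +ᴷ - y ≡ 0# → x ≡ y
          diff {x} {y} e = decidable-stable (x ≟ y) (λ x≢y → -‿≢0 x≢y e)

      -- The summand `∑ inside` belongs to the line `b + ⟨v⟩` itself, which `Y` leaves out.
      H-parallel : H v ≡ Y + ∑ inside
      H-parallel = trans (∑-χ (λ w → β (b ⊕ w) v)) (cong (Y +_) (∑-cong pointwise))
        where
        pointwise : ∀ w → inside w * β (b ⊕ w) v ≡ inside w
        pointwise w with w ∈⟨ v ⟩?
        ... | yes (t , refl) = trans (*-identityˡ _) (trans (sym (β-rebase (t , refl))) (β-bad bad))
        ... | no _ = refl

      ∑-inside : ∑ inside ≡ q
      ∑-inside = ≤-antisym ∑-inside-≤ (≤-trans (≤-reflexive (trans (sym (*-identityʳ q)) (sym (∑ᴷ-const 1))))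
        (≤-trans (∑-inside-≥ (λ _ → 1)) (≤-reflexive (∑-cong (λ w → *-identityʳ (inside w))))))

      H-multiples : N * H v ≤ ∑ (λ u → inside u * H u)
      H-multiples = begin
        N * H v  ≡⟨ *-comm N (H v) ⟩
        H v * N  ≡⟨ ∑-* (H v) nonzero ⟨
        ∑ (λ x → H v * nonzero x)  ≤⟨ ∑-mono pointwise ⟩
        ∑ (λ x → H (x · v))  ≤⟨ ∑-inside-≥ H ⟩
        ∑ (λ u → inside u * H u)  ∎
        where
        open ≤-Reasoning
        pointwise : ∀ x → H v * nonzero x ≤ H (x · v)
        pointwise x with 0# ≟ x
        ... | yes _  = ≤-trans (≤-reflexive (*-zeroʳ (H v))) z≤n
        ... | no 0≢x = ≤-reflexive (trans (*-identityʳ (H v)) (∑-cong (λ w → cong (χ a w *_) (sym (β-scale (0≢x ∘ sym))))))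

    -- Each line has weight `q * (q - 1)` in the double sum, so for nonzero `a` this amounts to
    -- `(q^(n-1) - 1) / (q - 1) = 1 + q[n-2]` bad lines. The final `+ q` replaces a subtraction on
    -- the left.
    hyperplane-count : q * ∑ (χ a) ≤ ∑ (λ u → χ a u * ∑ (λ w → χ a w * β (b ⊕ w) u)) + q
    hyperplane-count = begin
      q * ∑ (χ a)  ≡⟨ cong (q *_) (trans (∑-cong (λ w → sym (*-identityʳ (χ a w)))) (trans (∑-χ (λ _ → 1)) (cong₂ _+_ (∑-cong (λ w → *-identityʳ (outside w))) (∑-cong (λ w → *-identityʳ (inside w)))))) ⟩
      q * (∑ outside + ∑ inside)  ≡⟨ *-distribˡ-+ q (∑ outside) (∑ inside) ⟩
      q * ∑ outside + q * ∑ inside  ≤⟨ +-monoˡ-≤ (q * ∑ inside) ∑-planes ⟩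
      q * X + N * Y + q * ∑ inside  ≡⟨ cong (λ x → q * X + N * Y + q * x) ∑-inside ⟩
      -- Splitting `q * q` as `N * q + q` lets the given line join its parallels, since `Y + q` is
      -- `H v`.
      q * X + N * Y + q * q  ≡⟨ cong (λ x → q * X + N * Y + x * q) (sym 1+N≡q) ⟩
      q * X + N * Y + suc N * q  ≡⟨ solve′ 4 (λ x y z w → (x :+′ y :*′ z) :+′ (con′ 1 :+′ y) :*′ w :=′ x :+′ y :*′ (z :+′ w) :+′ w) refl (q * X) N Y q ⟩
      q * X + N * (Y + q) + q  ≡⟨ cong (λ x → q * X + N * x + q) (trans (cong (Y +_) (sym ∑-inside)) (sym H-parallel)) ⟩
      q * X + N * H v + q  ≤⟨ +-monoˡ-≤ q (+-mono-≤ crossing H-multiples) ⟩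
      ∑ (λ u → outside u * H u) + ∑ (λ u → inside u * H u) + q  ≡⟨ cong (_+ q) (∑-χ H) ⟨
      ∑ (λ u → χ a u * H u) + q  ∎
      where
      open ≤-Reasoning
      open +-*-Solver using () renaming (solve to solve′; _:+_ to _:+′_; _:*_ to _:*′_; _:=_ to _:=′_; con to con′)
      crossing : q * X ≤ ∑ (λ u → outside u * H u)
      crossing = ≤-trans (≤-reflexive (sym (∑-* q (λ u → outside u * h u)))) (∑-mono (λ u → ≤-trans (≤-reflexive
        (trans (sym (*-assoc q (outside u) (h u))) (trans (cong (_* h u) (*-comm q (outside u))) (*-assoc (outside u) q (h u))))) (H-crossing u)))

-- Averaging over hyperplanes.

-- Below, suc m is the number q^(n-1) of vectors in a hyperplane through the origin.
module GoodLevels {q} {K : FiniteField q} {n : ℕ} (S : Space K n)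
  {α : FiniteField.Carrier K} (α≢0 : α ≢ FiniteField.0# K) (α≢1 : α ≢ FiniteField.1# K)
  (3≤q : 3 ≤ q) {m : ℕ} (size : q * suc m ≡ q ^ n) (q²≤ : q * q ≤ suc m)
  (f : Space.Point S → Space.Point S) (inj : ∀ x y → f x ≡ f y → x ≡ y) where
  open FiniteField K using (Carrier; 0#; 1#; -_; 0≢1) renaming (_+_ to _+ᴷ_; _*_ to _*ᴷ_)
  open Vectors S hiding (+-comm; +-assoc; *-comm; *-assoc; +-identityʳ; +-identityˡ; *-identityʳ; *-identityˡ; *-cancelˡ)
  open Variables
  open Lines S
  open BadLineCounts S α≢0 α≢1 f inj public

  instance
    q-nonZero : NonZero q
    q-nonZero = >-nonZero (≤-trans (s≤s z≤n) 3≤q)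

  q≤m : q ≤ m
  q≤m = s≤s⁻¹ (begin
    1 + q  ≤⟨ +-monoˡ-≤ q (≤-trans (s≤s z≤n) 3≤q) ⟩
    q + q  ≡⟨ cong (q +_) (+-identityʳ q) ⟨
    2 * q  ≤⟨ *-monoˡ-≤ q (≤-trans (s≤s (s≤s z≤n)) 3≤q) ⟩
    q * q  ≤⟨ q²≤ ⟩
    suc m ∎)
    where open ≤-Reasoning

  2≤N : 2 ≤ N
  2≤N = s≤s⁻¹ (≤-trans 3≤q (≤-reflexive (sym 1+N≡q)))

  ∑χ : ∀ {a} → a ≢ 𝟘 → ∑ (χ a) ≡ suc m
  ∑χ {a} a≢𝟘 = let (u , au≡1) = ∙-nondegenerate a a≢𝟘 in
    *-cancelˡ-≡ _ _ q (trans (kernel-size a u au≡1) (sym size))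

  -- A bad line contributes once for each of its q(q - 1) pairs of a base point and a direction vector.
  W : ℕ
  W = ∑ (λ v → ∑ (λ p → β p v))

  GoodLevel : Point → Carrier → Set
  GoodLevel a c = ∀ p v → a ∙ p ≡ c → a ∙ v ≡ 0# → Good f p v

  GoodLevel? : ∀ a c → Dec (GoodLevel a c)
  GoodLevel? a c = ∀? λ p → ∀? λ v → (a ∙ p ≟ c) →-dec ((a ∙ v ≟ 0#) →-dec Good? f p v)

  TwoGoodLevels : Point → Set
  TwoGoodLevels a = ∃ λ c → ∃ λ c′ → c ≢ c′ × GoodLevel a c × GoodLevel a c′

  TwoGoodLevels? : ∀ a → Dec (TwoGoodLevels a)
  TwoGoodLevels? a = ∃? λ c → ∃? λ c′ → ¬? (c ≟ c′) ×-dec (GoodLevel? a c ×-dec GoodLevel? a c′)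

  private
    F : Point → ℕ
    F a = ∑ (λ v → χ a v * ∑ (λ p → β p v))

    module _ {a : Point} (a≢𝟘 : a ≢ 𝟘) where

      u : Point
      u = proj₁ (∙-nondegenerate a a≢𝟘)
      au≡1 : a ∙ u ≡ 1#
      au≡1 = proj₂ (∙-nondegenerate a a≢𝟘)

      level : Carrier → ℕ
      level c = ∑ (λ v → χ a v * ∑ (λ w → χ a w * β ((c · u) ⊕ w) v))

      F-levels : F a ≡ ∑ level
      F-levels = trans (∑-cong (λ v → trans (cong (χ a v *_) (∑-levels a u au≡1 (λ p → β p v))) (sym (∑-* (χ a v) _)))) (∑-swap _)

      bad-level : ∀ {c} → ¬ GoodLevel a c → q * m ≤ level c
      bad-level {c} ¬good =
        let (p , ¬p) = ¬∀⇒∃¬ (λ p → ∀? λ v → (a ∙ p ≟ c) →-dec ((a ∙ v ≟ 0#) →-dec Good? f p v)) ¬good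
            (v , ¬v) = ¬∀⇒∃¬ (λ v → (a ∙ p ≟ c) →-dec ((a ∙ v ≟ 0#) →-dec Good? f p v)) ¬p
            ap≡c = decidable-stable (a ∙ p ≟ c) (λ ne → ¬v (λ e → contradiction e ne))
            av≡0 = decidable-stable (a ∙ v ≟ 0#) (λ ne → ¬v (λ _ e → contradiction e ne))
        in go p v ap≡c av≡0 (λ g → ¬v (λ _ _ → g))
        where
        open ≤-Reasoning
        go : ∀ p v → a ∙ p ≡ c → a ∙ v ≡ 0# → ¬ Good f p v → q * m ≤ level c
        go p v ap≡c av≡0 bad = +-cancelʳ-≤ q (q * m) (level c) (begin
          q * m + q  ≡⟨ +-comm (q * m) q ⟩
          q + q * m  ≡⟨ *-suc q m ⟨
          q * suc m  ≡⟨ cong (q *_) (∑χ a≢𝟘) ⟨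
          q * ∑ (χ a)  ≤⟨ hyperplane-count av≡0 bad ⟩
          ∑ (λ v → χ a v * ∑ (λ w → χ a w * β (p ⊕ w) v)) + q  ≡⟨ cong (_+ q) (∑-cong (λ v → cong (χ a v *_) (rebase v))) ⟩
          level c + q ∎)
          where
          w₀ : Point
          w₀ = p ⊝ (c · u)
          aw₀≡0 : a ∙ w₀ ≡ 0#
          aw₀≡0 = trans (∙-⊝ a p (c · u)) (trans (cong₂ (λ x y → x +ᴷ - y) ap≡c (trans (∙-· a c u) (cong (c *ᴷ_) au≡1)))
            (solve 1 (λ c → c :- c :* con (ℤ.+ 1) := con (ℤ.+ 0)) refl c))
          -- `hyperplane-count` is centred at a point of the bad line; a shift inside the kernel
          -- moves the centre to `c · u`.
          rebase : ∀ v → ∑ (λ w → χ a w * β (p ⊕ w) v) ≡ ∑ (λ w → χ a w * β ((c · u) ⊕ w) v)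
          rebase v = trans (∑-cong (λ w → cong₂ (λ x y → x * β y v)
              (𝟏-cong (a ∙ w ≟ 0#) (a ∙ (w₀ ⊕ w) ≟ 0#)
                (λ e → trans (same w) e) (λ e → trans (sym (same w)) e))
              (vsolve (c ∷ []) (p ∷ w ∷ u ∷ []) (v₀ ⊞ v₁) (s₀ ⊡ v₂ ⊞ ((v₀ ⊟ s₀ ⊡ v₂) ⊞ v₁)) (refl , refl , refl , _))))
            (∑-shift (λ w → χ a w * β ((c · u) ⊕ w) v) w₀)
            where
            same : ∀ w → a ∙ (w₀ ⊕ w) ≡ a ∙ w
            same w = trans (∙-⊕ a w₀ w) (trans (cong (_+ᴷ a ∙ w) aw₀≡0) (solve 1 (λ x → con (ℤ.+ 0) :+ x := x) refl (a ∙ w)))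

      -- All of the `q` levels except at most one contain a bad line. The exempted level `c₀` is the
      -- good one if it exists and arbitrary otherwise.
      F-bound : ¬ TwoGoodLevels a → N * (q * m) ≤ F a
      F-bound ¬two = +-cancelʳ-≤ (q * m) _ _ (begin
        N * (q * m) + q * m  ≡⟨ +-comm (N * (q * m)) (q * m) ⟩
        suc N * (q * m)  ≡⟨ cong (_* (q * m)) (trans 1+N≡q (sym card-Carrier)) ⟩
        card Carrier * (q * m)  ≤⟨ m≤m+n _ _ ⟩
        card Carrier * (q * m) + level c₀  ≤⟨ ∑-except c₀ (q * m) level (λ c c≢c₀ → bad-level (rest c c≢c₀)) ⟩
        ∑ level + q * m  ≡⟨ cong (_+ q * m) F-levels ⟨
        F a + q * m ∎)
        where
        open ≤-Reasoning
        exceptional : ∃ λ c₀ → ∀ c → c ≢ c₀ → ¬ GoodLevel a c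
        exceptional with ∃? (GoodLevel? a)
        ... | yes (c₀ , g) = c₀ , λ c c≢c₀ g′ → ¬two (c , c₀ , c≢c₀ , g′ , g)
        ... | no none = 0# , λ c _ g → none (c , g)
        c₀ : Carrier
        c₀ = proj₁ exceptional
        rest : ∀ c → c ≢ c₀ → ¬ GoodLevel a c
        rest = proj₂ exceptional

    F-𝟘 : F 𝟘 ≡ W
    F-𝟘 = ∑-cong (λ v → trans (cong (_* ∑ (λ p → β p v)) (𝟏-yes (𝟘 ∙ v ≟ 0#) (trans (∙-comm 𝟘 v) (∙-𝟘 v)))) (*-identityˡ _))

    -- After exchanging the sums, a direction `v` is weighted by the number of `a` with
    -- `a ∙ v ≡ 0#`. By symmetry of `_∙_` this is the size of a kernel; only `v ≡ 𝟘` differs, and it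
    -- is never a bad direction.
    ∑-F : ∑ F ≡ suc m * W
    ∑-F = trans (∑-swap _) (trans (∑-cong each) (∑-* (suc m) (λ v → ∑ (λ p → β p v))))
      where
      each : ∀ v → ∑ (λ a → χ a v * ∑ (λ p → β p v)) ≡ suc m * ∑ (λ p → β p v)
      each v with v ≟ 𝟘
      ... | no v≢𝟘 = begin
        ∑ (λ a → χ a v * Bᵥ)  ≡⟨ ∑-cong (λ a → *-comm (χ a v) Bᵥ) ⟩
        ∑ (λ a → Bᵥ * χ a v)  ≡⟨ ∑-* Bᵥ (λ a → χ a v) ⟩
        Bᵥ * ∑ (λ a → χ a v)  ≡⟨ cong (Bᵥ *_) (∑-cong (λ a → 𝟏-cong (a ∙ v ≟ 0#) (v ∙ a ≟ 0#) (trans (∙-comm v a)) (trans (∙-comm a v)))) ⟩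
        Bᵥ * ∑ (χ v)  ≡⟨ cong (Bᵥ *_) (∑χ v≢𝟘) ⟩
        Bᵥ * suc m  ≡⟨ *-comm Bᵥ (suc m) ⟩
        suc m * Bᵥ ∎
        where
        open ≡-Reasoning
        Bᵥ : ℕ
        Bᵥ = ∑ (λ p → β p v)
      ... | yes refl = trans (∑-cong (λ a → trans (cong (χ a 𝟘 *_) none) (*-zeroʳ (χ a 𝟘)))) (trans (∑-* 0 (λ (_ : Point) → 0)) (sym (trans (cong (suc m *_) none) (*-zeroʳ (suc m)))))
        where
        none : ∑ (λ p → β p 𝟘) ≡ 0
        none = trans (∑-cong (λ p → 𝟏-no (¬? (Good? f p 𝟘)) (λ bad → ¬Good⇒≢𝟘 bad refl))) (∑-* 0 (λ (_ : Point) → 0))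

  -- Without such an `a`, averaging over the nonzero functionals yields
  -- `W ≥ (q^n - 1) * (q - 1) * q`. This exceeds `2 * q * (q * m)`, since `q - 1 ≥ 2` and
  -- `q^n - 1 > q^n - q = q * m`.
  few⇒two-good-levels : W ≤ 2 * q * (q * m) → ∃ λ a → a ≢ 𝟘 × TwoGoodLevels a
  few⇒two-good-levels few with ∃? (λ a → ¬? (a ≟ 𝟘) ×-dec TwoGoodLevels? a)
  ... | yes e = e
  ... | no none = contradiction few (<⇒≱ (<-≤-trans two many))
    where
    open ≤-Reasoning
    open +-*-Solver using () renaming (solve to solve′; _:+_ to _:+′_; _:*_ to _:*′_; _:=_ to _:=′_; con to con′)
    A : ℕ
    A = N + q * m
    q^n≡ : q ^ n ≡ suc A
    q^n≡ = trans (sym size) (trans (*-suc q m) (cong (_+ q * m) (sym 1+N≡q)))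
    instance
      Nq-nonZero : NonZero (N * q)
      Nq-nonZero = >-nonZero (*-mono-≤ (≤-trans (s≤s z≤n) 2≤N) (≤-trans (s≤s z≤n) 3≤q))
      m-nonZero : NonZero m
      m-nonZero = >-nonZero (≤-trans (≤-trans (s≤s z≤n) 3≤q) q≤m)
    two : 2 * q * (q * m) < A * (N * q)
    two = begin-strict
      2 * q * (q * m)  ≤⟨ *-monoˡ-≤ (q * m) (*-monoˡ-≤ q 2≤N) ⟩
      N * q * (q * m)  <⟨ *-monoʳ-< (N * q) (+-monoˡ-< (q * m) (≤-trans (s≤s z≤n) 2≤N)) ⟩
      N * q * A  ≡⟨ *-comm (N * q) A ⟩
      A * (N * q) ∎
    many : A * (N * q) ≤ W
    many = *-cancelʳ-≤ (A * (N * q)) W m (+-cancelʳ-≤ (N * (q * m) + W) _ _ (begin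
      A * (N * q) * m + (N * (q * m) + W)  ≡⟨ solve′ 5 (λ a n q m w → a :*′ (n :*′ q) :*′ m :+′ (n :*′ (q :*′ m) :+′ w) :=′ (con′ 1 :+′ a) :*′ (n :*′ (q :*′ m)) :+′ w) refl A N q m W ⟩
      suc A * (N * (q * m)) + W  ≡⟨ cong₂ (λ x y → x * (N * (q * m)) + y) (trans (sym q^n≡) (sym card-Point)) (sym F-𝟘) ⟩
      card Point * (N * (q * m)) + F 𝟘  ≤⟨ ∑-except 𝟘 (N * (q * m)) F (λ a a≢𝟘 → F-bound a≢𝟘 (λ two → none (a , a≢𝟘 , two))) ⟩
      ∑ F + N * (q * m)  ≡⟨ cong (_+ N * (q * m)) ∑-F ⟩
      suc m * W + N * (q * m)  ≡⟨ solve′ 3 (λ m w x → (con′ 1 :+′ m) :*′ w :+′ x :=′ w :*′ m :+′ (x :+′ w)) refl m W (N * (q * m)) ⟩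
      W * m + (N * (q * m) + W) ∎))

-- Gluing the restrictions to two good levels into a semi-affine map.

module Gluing {q} {K : FiniteField q} {n : ℕ} (S : Space K n)
  {α : FiniteField.Carrier K} (α≢0 : α ≢ FiniteField.0# K) (α≢1 : α ≢ FiniteField.1# K)
  (3≤q : 3 ≤ q) {m : ℕ} (size : q * suc m ≡ q ^ n) (q²≤ : q * q ≤ suc m)
  (f : Space.Point S → Space.Point S) (inj : ∀ x y → f x ≡ f y → x ≡ y)
  {a e b₁ : Space.Point S} (ae≡1 : Space._∙_ S a e ≡ FiniteField.1# K)
  (good₁ : ∀ r v → Space._∙_ S a r ≡ FiniteField.0# K → Space._∙_ S a v ≡ FiniteField.0# K →
    Lines.Good S f (Space._⊕_ S b₁ r) v)
  (good₂ : ∀ r v → Space._∙_ S a r ≡ FiniteField.0# K → Space._∙_ S a v ≡ FiniteField.0# K →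
    Lines.Good S f (Space._⊕_ S (Space._⊕_ S b₁ e) r) v) where
  open FiniteField K using (Carrier; 0#; 1#; -_; 0≢1) renaming (_+_ to _+ᴷ_; _*_ to _*ᴷ_)
  open Vectors S hiding (+-comm; +-assoc; *-comm; *-assoc; +-identityʳ; +-identityˡ; *-identityʳ; *-identityˡ; *-cancelˡ)
  open Variables
  open Lines S
  open Pencil S α≢0 α≢1
  open GoodLevels S α≢0 α≢1 3≤q size q²≤ f inj

  V : Point → Set
  V x = a ∙ x ≡ 0#

  V-· : ∀ s {x} → V x → V (s · x)
  V-· s Vx = ∙-scaled Vx s

  V-⊕ : ∀ {x y} → V x → V y → V (x ⊕ y)
  V-⊕ {x} {y} Vx Vy = trans (∙-⊕ a x y) (trans (cong₂ _+ᴷ_ Vx Vy) (solve 0 (con (ℤ.+ 0) :+ con (ℤ.+ 0) := con (ℤ.+ 0)) refl))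

  V-⊝ : ∀ {x y} → V x → V y → V (x ⊝ y)
  V-⊝ Vx Vy = V-⊕ Vx (V-· (- 1#) Vy)

  a≢𝟘 : a ≢ 𝟘
  a≢𝟘 refl = 0≢1 (trans (sym (trans (∙-comm 𝟘 e) (∙-𝟘 e))) ae≡1)

  ∙-e : ∀ {r} → V r → ∀ t → a ∙ (r ⊕ (t · e)) ≡ t
  ∙-e {r} Vr t = trans (∙-⊕ a r (t · e)) (trans (cong₂ _+ᴷ_ Vr (trans (∙-· a t e) (cong (t *ᴷ_) ae≡1)))
    (solve 1 (λ t → con (ℤ.+ 0) :+ t :* con (ℤ.+ 1) := t) refl t))

  abstract
    -- The kernel has `suc m` vectors, more than the `q` multiples of `v`; this rests on n ≥ 3.
    outside-line : ∀ v → ∃ λ u → V u × ¬ (u ∈⟨ v ⟩)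
    outside-line v with ∃? (λ u → (a ∙ u ≟ 0#) ×-dec ¬? (u ∈⟨ v ⟩?))
    ... | yes found = found
    ... | no none = contradiction (≤-trans (≤-reflexive (sym (∑χ a≢𝟘))) inside) (<⇒≱ (s≤s q≤m))
      where
      inside : ∑ (χ a) ≤ q
      inside = ≤-trans (∑-≤-surjective (_· v) {χ = λ _ → 1} (λ u χ≢0 →
          let (t , eq) = decidable-stable (u ∈⟨ v ⟩?) (λ u∉ → none (u , 𝟏-≢0 (a ∙ u ≟ 0#) χ≢0 , u∉)) in t , sym eq , 𝟏-≤1 (a ∙ u ≟ 0#)))
        (≤-reflexive (trans (∑ᴷ-const 1) (*-identityʳ q)))

  module Restriction (b : Point) (good-b : ∀ r v → V r → V v → Good f (b ⊕ r) v) where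

    G : Point → Point
    G = translate f b

    G-inj : ∀ x y → G x ≡ G y → x ≡ y
    G-inj = translate-injective inj b

    G-𝟘 : G 𝟘 ≡ 𝟘
    G-𝟘 = translate-𝟘 f b

    f-G : ∀ r → f (b ⊕ r) ≡ f b ⊕ G r
    f-G r = sym (⊕⊝ (f b) (f (b ⊕ r)))

    abstract
      G-⊕ : ∀ {x y} → V x → V y → G (x ⊕ y) ≡ G x ⊕ G y
      G-⊕ = additive G G-inj G-𝟘 V-⊕ V-· (λ Vp Vu → Good-translate⁺ (good-b _ _ Vp Vu)) outside-line

      G-scalar : ∀ s {x} → V x → ∃ λ κ → s · G x ≡ G (κ · x)
      G-scalar s Vx = scalar-closed G G-inj G-𝟘 (Good-translate⁺ (good-b 𝟘 _ (∙-𝟘 a) Vx)) s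

      G-neg : ∀ {x} → V x → G ((- 1#) · x) ≡ (- 1#) · G x
      G-neg {x} Vx = from-difference
        (trans (sym (G-⊕ Vx (V-· (- 1#) Vx))) (trans (cong G (vsolve [] (x ∷ []) (v₀ ⊟ v₀) 𝟎 (refl , _))) G-𝟘))
        (vsolve [] (G x ∷ G ((- 1#) · x) ∷ []) (v₁ ⊞ 𝟎) ((:- one) ⊡ v₀ ⊞ (v₀ ⊞ v₁)) (refl , refl , _))

      G-⊝ : ∀ {x y} → V x → V y → G (x ⊝ y) ≡ G x ⊝ G y
      G-⊝ {x} Vx Vy = trans (G-⊕ Vx (V-· (- 1#) Vy)) (cong (G x ⊕_) (G-neg Vy))

  b₂ : Point
  b₂ = b₁ ⊕ e

  open Restriction b₁ good₁ using () renaming (G to G₁; G-inj to G₁-inj; G-𝟘 to G₁-𝟘; f-G to f-G₁; G-⊕ to G₁-⊕; G-scalar to G₁-scalar; G-neg to G₁-neg; G-⊝ to G₁-⊝)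
  open Restriction b₂ good₂ using () renaming (G to G₂; G-inj to G₂-inj; G-𝟘 to G₂-𝟘; f-G to f-G₂; G-⊕ to G₂-⊕; G-scalar to G₂-scalar; G-neg to G₂-neg)

  e′ : Point
  e′ = f b₂ ⊝ f b₁

  -- The projection onto the kernel of `a` along `e`.
  flat : Point → Point
  flat p = p ⊝ ((a ∙ p) · e)

  -- Distinct levels have disjoint images, so e′ is independent of the image of G₁.
  abstract
    e′-independent : ∀ {y s} → V y → s · e′ ≡ G₁ y → s ≡ 0#
    e′-independent {y} {s} Vy eq with s ≟ 0#
    ... | yes s≡0 = s≡0
    ... | no s≢0 = contradiction (trans (sym (∙-e (∙-𝟘 a) 1#)) (trans (cong (a ∙_) 𝟘+e≡) (V-· κ Vy))) (0≢1 ∘ sym)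
      where
      κ : Carrier
      κ = proj₁ (G₁-scalar (inv s≢0) Vy)
      e′≡ : e′ ≡ G₁ (κ · y)
      e′≡ = trans (sym (inv-· s≢0 e′)) (trans (cong (inv s≢0 ·_) eq) (proj₂ (G₁-scalar (inv s≢0) Vy)))
      b₂≡ : b₂ ≡ b₁ ⊕ (κ · y)
      b₂≡ = inj _ _ (trans (sym (⊕⊝ (f b₁) (f b₂))) (trans (cong (f b₁ ⊕_) e′≡) (sym (f-G₁ (κ · y)))))
      𝟘+e≡ : 𝟘 ⊕ (1# · e) ≡ κ · y
      𝟘+e≡ = from-difference b₂≡ (vsolve (κ ∷ []) (b₁ ∷ e ∷ y ∷ []) (𝟎 ⊞ one ⊡ v₁ ⊞ (v₀ ⊞ s₀ ⊡ v₂)) (s₀ ⊡ v₂ ⊞ (v₀ ⊞ v₁)) (refl , refl , refl , _))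

    level-unique : ∀ {x y s t} → V x → V y → G₁ x ⊕ (s · e′) ≡ G₁ y ⊕ (t · e′) → s ≡ t
    level-unique {x} {y} {s} {t} Vx Vy eq = decidable-stable (s ≟ t) (λ s≢t → -‿≢0 s≢t (e′-independent (V-⊝ Vy Vx)
      (trans (from-difference eq (vsolve (s ∷ t ∷ []) (G₁ x ∷ G₁ y ∷ e′ ∷ [])
        ((s₀ :- s₁) ⊡ v₂ ⊞ (v₁ ⊞ s₁ ⊡ v₂)) (v₁ ⊟ v₀ ⊞ (v₀ ⊞ s₀ ⊡ v₂)) (refl , refl , refl , _))) (sym (G₁-⊝ Vy Vx)))))

    V-flat : ∀ p → V (flat p)
    V-flat p = trans (∙-⊝ a p _) (trans (cong (λ x → a ∙ p +ᴷ - x) (trans (∙-· a (a ∙ p) e) (cong ((a ∙ p) *ᴷ_) ae≡1)))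
      (solve 1 (λ x → x :- x :* con (ℤ.+ 1) := con (ℤ.+ 0)) refl (a ∙ p)))

    flat-⊕ : ∀ p → p ≡ flat p ⊕ ((a ∙ p) · e)
    flat-⊕ p = vsolve (a ∙ p ∷ []) (p ∷ e ∷ []) v₀ (v₀ ⊟ s₀ ⊡ v₁ ⊞ s₀ ⊡ v₁) (refl , refl , _)

    -- The image of `G₁` and the multiples of `e′` give coordinates on the target: the map is
    -- injective by `level-unique`, hence onto by finiteness, although `G₁` is not yet known to be
    -- semilinear.
    decompose : ∀ z → ∃ λ r → ∃ λ t → V r × z ≡ G₁ r ⊕ (t · e′)
    decompose z = let (p , eq) = injective⇒surjective (λ p → G₁ (flat p) ⊕ ((a ∙ p) · e′)) injective z in
      flat p , a ∙ p , V-flat p , sym eq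
      where
      injective : ∀ p r → G₁ (flat p) ⊕ ((a ∙ p) · e′) ≡ G₁ (flat r) ⊕ ((a ∙ r) · e′) → p ≡ r
      injective p r eq = trans (flat-⊕ p) (trans (cong₂ (λ x t → x ⊕ (t · e)) flat≡ level≡) (sym (flat-⊕ r)))
        where
        level≡ : a ∙ p ≡ a ∙ r
        level≡ = level-unique (V-flat p) (V-flat r) eq
        flat≡ : flat p ≡ flat r
        flat≡ = G₁-inj _ _ (⊕-cancelʳ ((a ∙ p) · e′) (trans eq (cong (λ t → G₁ (flat r) ⊕ (t · e′)) (sym level≡))))

    -- This makes the images of the two levels parallel. If some `G₂ r` had a component `t ≢ 0#` at
    -- `e′`, then adding `- 1 / t` times it to `f b₂` would cancel `e′` and land in the image of the
    -- first level, against injectivity.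
    G₂⊆G₁ : ∀ {r} → V r → ∃ λ y → V y × G₂ r ≡ G₁ y
    G₂⊆G₁ {r} Vr = go (decompose (G₂ r))
      where
      go : (∃ λ y → ∃ λ t → V y × G₂ r ≡ G₁ y ⊕ (t · e′)) → ∃ λ y → V y × G₂ r ≡ G₁ y
      go (y , t , Vy , eq) with t ≟ 0#
      ... | yes t≡0 = y , Vy , trans eq (trans (cong (G₁ y ⊕_) (trans (cong (_· e′) t≡0) (0· e′))) (⊕𝟘 _))
      ... | no t≢0 = contradiction (trans (sym (∙-e (V-· κ₂ Vr) 1#)) (trans (cong (a ∙_) crossing) (V-· κ₁ Vy))) (0≢1 ∘ sym)
        where
        i : Carrier
        i = inv t≢0
        κ₁ κ₂ : Carrier
        κ₁ = proj₁ (G₁-scalar (- i) Vy)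
        κ₂ = proj₁ (G₂-scalar (- i) Vr)
        images : f (b₂ ⊕ (κ₂ · r)) ≡ f (b₁ ⊕ (κ₁ · y))
        images = begin
          f (b₂ ⊕ (κ₂ · r))  ≡⟨ f-G₂ (κ₂ · r) ⟩
          f b₂ ⊕ G₂ (κ₂ · r)  ≡⟨ cong (f b₂ ⊕_) (proj₂ (G₂-scalar (- i) Vr)) ⟨
          f b₂ ⊕ ((- i) · G₂ r)  ≡⟨ cong (λ x → f b₂ ⊕ ((- i) · x)) eq ⟩
          f b₂ ⊕ ((- i) · (G₁ y ⊕ (t · e′)))  ≡⟨ from-difference (cong (_· e′) (sym (inv-right t≢0)))
                                                              (vsolve (t ∷ i ∷ []) (f b₁ ∷ f b₂ ∷ G₁ y ∷ [])
                                                                (v₁ ⊞ (:- s₁) ⊡ (v₂ ⊞ s₀ ⊡ (v₁ ⊟ v₀)) ⊞ (s₀ :* s₁) ⊡ (v₁ ⊟ v₀))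
                                                                (v₀ ⊞ (:- s₁) ⊡ v₂ ⊞ one ⊡ (v₁ ⊟ v₀)) (refl , refl , refl , _)) ⟩
          f b₁ ⊕ ((- i) · G₁ y)  ≡⟨ cong (f b₁ ⊕_) (proj₂ (G₁-scalar (- i) Vy)) ⟩
          f b₁ ⊕ G₁ (κ₁ · y)  ≡⟨ f-G₁ (κ₁ · y) ⟨
          f (b₁ ⊕ (κ₁ · y))  ∎
          where open ≡-Reasoning
        crossing : (κ₂ · r) ⊕ (1# · e) ≡ κ₁ · y
        crossing = from-difference (inj _ _ images) (vsolve (κ₁ ∷ κ₂ ∷ []) (b₁ ∷ e ∷ r ∷ y ∷ [])
          (s₁ ⊡ v₂ ⊞ one ⊡ v₁ ⊞ (v₀ ⊞ s₀ ⊡ v₃)) (s₀ ⊡ v₃ ⊞ (v₀ ⊞ v₁ ⊞ s₁ ⊡ v₂)) (refl , refl , refl , refl , _))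

  module AtLevel (t : Carrier) where

    z : Point → Point
    z r = (b₁ ⊕ (t · e)) ⊕ r

    v′ : Point → Point
    v′ r = proj₁ (decompose (f (z r) ⊝ f b₁))

    -- The height of the image point over the image of the first level. At this stage it may depend
    -- on `r` and not only on `t`.
    lam : Point → Carrier
    lam r = proj₁ (proj₂ (decompose (f (z r) ⊝ f b₁)))

    V-v′ : ∀ r → V (v′ r)
    V-v′ r = proj₁ (proj₂ (proj₂ (decompose (f (z r) ⊝ f b₁))))

    f-z : ∀ r → f (z r) ≡ f b₁ ⊕ (G₁ (v′ r) ⊕ (lam r · e′))
    f-z r = trans (sym (⊕⊝ (f b₁) (f (z r)))) (cong (f b₁ ⊕_) (proj₂ (proj₂ (proj₂ (decompose (f (z r) ⊝ f b₁))))))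

    Ψ : Point → Point → Point
    Ψ r w = ((1# +ᴷ - lam r) · G₁ (r ⊕ ((- t) · w))) ⊕ (lam r · G₂ (r ⊕ ((1# +ᴷ - t) · w)))

    Δ : Point → Point → Point
    Δ r δ = ((1# +ᴷ - lam r) · G₁ ((- t) · δ)) ⊕ (lam r · G₂ ((1# +ᴷ - t) · δ))

    -- The image of z r lies on the line through the images of the points where the line z r + ⟨e ⊕ w⟩
    -- meets the two good levels.
    Aligned : Point → Point → Set
    Aligned r w = G₁ (v′ r) ≡ Ψ r w

    abstract
      -- Three points of a good line have collinear images with some coefficient `s`. By `G₂⊆G₁`
      -- everything besides `s · e′` lies in the image of `G₁`, so comparing components at `e′`
      -- gives `s ≡ lam r`.
      good⇒aligned : ∀ {r w} → V r → V w → Good f (z r) (e ⊕ w) → Aligned r w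
      good⇒aligned {r} {w} Vr Vw g = go (good-three inj g on-x on-y (OnLine-base _ _) x≢y)
        where
        x₁ y₁ x y X Y : Point
        x₁ = r ⊕ ((- t) · w)
        y₁ = r ⊕ ((1# +ᴷ - t) · w)
        x = b₁ ⊕ x₁
        y = b₂ ⊕ y₁
        X = G₁ x₁
        Y = G₂ y₁
        Vx : V x₁
        Vx = V-⊕ Vr (V-· _ Vw)
        Vy : V y₁
        Vy = V-⊕ Vr (V-· _ Vw)
        on-x : OnLine (z r) (e ⊕ w) x
        on-x = - t , vsolve (t ∷ []) (b₁ ∷ e ∷ r ∷ w ∷ []) (v₀ ⊞ (v₂ ⊞ (:- s₀) ⊡ v₃)) (v₀ ⊞ s₀ ⊡ v₁ ⊞ v₂ ⊞ (:- s₀) ⊡ (v₁ ⊞ v₃)) (refl , refl , refl , refl , _)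
        on-y : OnLine (z r) (e ⊕ w) y
        on-y = 1# +ᴷ - t , vsolve (t ∷ []) (b₁ ∷ e ∷ r ∷ w ∷ []) (v₀ ⊞ v₁ ⊞ (v₂ ⊞ (one :- s₀) ⊡ v₃)) (v₀ ⊞ s₀ ⊡ v₁ ⊞ v₂ ⊞ (one :- s₀) ⊡ (v₁ ⊞ v₃)) (refl , refl , refl , refl , _)
        x≢y : x ≢ y
        x≢y eq = 0≢1 (trans (sym (∙-𝟘 a)) (trans (cong (a ∙_) w+e≡𝟘) (∙-e Vw 1#)))
          where
          w+e≡𝟘 : 𝟘 ≡ w ⊕ (1# · e)
          w+e≡𝟘 = from-difference eq (vsolve (t ∷ []) (b₁ ∷ e ∷ r ∷ w ∷ [])
            (𝟎 ⊞ (v₀ ⊞ v₁ ⊞ (v₂ ⊞ (one :- s₀) ⊡ v₃))) (v₃ ⊞ one ⊡ v₁ ⊞ (v₀ ⊞ (v₂ ⊞ (:- s₀) ⊡ v₃))) (refl , refl , refl , refl , _))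
        go : (∃ λ s → f (z r) ≡ f x ⊕ (s · (f y ⊝ f x))) → Aligned r w
        go (s , eq) = trans (⊕-cancelʳ (lam r · e′) (trans split (cong (λ c → (X ⊕ (s · (Y ⊝ X))) ⊕ (c · e′)) (sym lam≡))))
            (trans (cong (λ c → X ⊕ (c · (Y ⊝ X))) (sym lam≡))
              (vsolve (lam r ∷ []) (X ∷ Y ∷ []) (v₀ ⊞ s₀ ⊡ (v₁ ⊟ v₀)) ((one :- s₀) ⊡ v₀ ⊞ s₀ ⊡ v₁) (refl , refl , _)))
          where
          y₂ : Point
          y₂ = proj₁ (G₂⊆G₁ Vy)
          Vy₂ : V y₂
          Vy₂ = proj₁ (proj₂ (G₂⊆G₁ Vy))
          κ : Carrier
          κ = proj₁ (G₁-scalar s (V-⊝ Vy₂ Vx))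
          split : G₁ (v′ r) ⊕ (lam r · e′) ≡ (X ⊕ (s · (Y ⊝ X))) ⊕ (s · e′)
          split = from-difference (trans (sym (f-z r)) (trans eq (cong₂ (λ P Q → P ⊕ (s · (Q ⊝ P))) (f-G₁ x₁) (f-G₂ y₁))))
            (vsolve (lam r ∷ s ∷ []) (f b₁ ∷ f b₂ ∷ G₁ (v′ r) ∷ X ∷ Y ∷ [])
              (v₂ ⊞ s₀ ⊡ (v₁ ⊟ v₀) ⊞ (v₀ ⊞ v₃ ⊞ s₁ ⊡ ((v₁ ⊞ v₄) ⊟ (v₀ ⊞ v₃))))
              (v₃ ⊞ s₁ ⊡ (v₄ ⊟ v₃) ⊞ s₁ ⊡ (v₁ ⊟ v₀) ⊞ (v₀ ⊞ (v₂ ⊞ s₀ ⊡ (v₁ ⊟ v₀)))) (refl , refl , refl , refl , refl , _))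
          in-G₁ : X ⊕ (s · (Y ⊝ X)) ≡ G₁ (x₁ ⊕ (κ · (y₂ ⊝ x₁)))
          in-G₁ = begin
            X ⊕ (s · (Y ⊝ X))  ≡⟨ cong (λ p → X ⊕ (s · (p ⊝ X))) (proj₂ (proj₂ (G₂⊆G₁ Vy))) ⟩
            X ⊕ (s · (G₁ y₂ ⊝ G₁ x₁))  ≡⟨ cong (λ p → X ⊕ (s · p)) (G₁-⊝ Vy₂ Vx) ⟨
            X ⊕ (s · G₁ (y₂ ⊝ x₁))  ≡⟨ cong (X ⊕_) (proj₂ (G₁-scalar s (V-⊝ Vy₂ Vx))) ⟩
            X ⊕ G₁ (κ · (y₂ ⊝ x₁))  ≡⟨ G₁-⊕ Vx (V-· κ (V-⊝ Vy₂ Vx)) ⟨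
            G₁ (x₁ ⊕ (κ · (y₂ ⊝ x₁)))  ∎
            where open ≡-Reasoning
          lam≡ : lam r ≡ s
          lam≡ = level-unique (V-v′ r) (V-⊕ Vx (V-· κ (V-⊝ Vy₂ Vx))) (trans split (cong (_⊕ (s · e′)) in-G₁))

      Ψ-⊕ : ∀ {r w δ} → V r → V w → V δ → Ψ r (w ⊕ δ) ≡ Ψ r w ⊕ Δ r δ
      Ψ-⊕ {r} {w} {δ} Vr Vw Vδ = trans
        (cong₂ (λ P Q → ((1# +ᴷ - lam r) · P) ⊕ (lam r · Q))
          (trans (cong G₁ (shift (- t))) (G₁-⊕ (V-⊕ Vr (V-· _ Vw)) (V-· _ Vδ)))
          (trans (cong G₂ (shift (1# +ᴷ - t))) (G₂-⊕ (V-⊕ Vr (V-· _ Vw)) (V-· _ Vδ))))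
        (vsolve (lam r ∷ []) (G₁ (r ⊕ ((- t) · w)) ∷ G₁ ((- t) · δ) ∷ G₂ (r ⊕ ((1# +ᴷ - t) · w)) ∷ G₂ ((1# +ᴷ - t) · δ) ∷ [])
          ((one :- s₀) ⊡ (v₀ ⊞ v₁) ⊞ s₀ ⊡ (v₂ ⊞ v₃))
          ((one :- s₀) ⊡ v₀ ⊞ s₀ ⊡ v₂ ⊞ ((one :- s₀) ⊡ v₁ ⊞ s₀ ⊡ v₃)) (refl , refl , refl , refl , _))
        where
        shift : ∀ s → r ⊕ (s · (w ⊕ δ)) ≡ (r ⊕ (s · w)) ⊕ (s · δ)
        shift s = vsolve (s ∷ []) (r ∷ w ∷ δ ∷ []) (v₀ ⊞ s₀ ⊡ (v₁ ⊞ v₂)) (v₀ ⊞ s₀ ⊡ v₁ ⊞ s₀ ⊡ v₂) (refl , refl , refl , _)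

      Ψ-affine : ∀ {r w x δ} → V r → V w → V x → V δ → Ψ r (w ⊕ δ) ⊕ Ψ r x ≡ Ψ r (x ⊕ δ) ⊕ Ψ r w
      Ψ-affine {r} {w} {x} {δ} Vr Vw Vx Vδ = begin
        Ψ r (w ⊕ δ) ⊕ Ψ r x  ≡⟨ cong (_⊕ Ψ r x) (Ψ-⊕ Vr Vw Vδ) ⟩
        (Ψ r w ⊕ Δ r δ) ⊕ Ψ r x  ≡⟨ vsolve [] (Ψ r w ∷ Δ r δ ∷ Ψ r x ∷ []) (v₀ ⊞ v₁ ⊞ v₂) (v₂ ⊞ v₁ ⊞ v₀) (refl , refl , refl , _) ⟩
        (Ψ r x ⊕ Δ r δ) ⊕ Ψ r w  ≡⟨ cong (_⊕ Ψ r w) (Ψ-⊕ Vr Vx Vδ) ⟨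
        Ψ r (x ⊕ δ) ⊕ Ψ r w  ∎
        where
        open ≡-Reasoning

    Central : Point → Set
    Central r = ∀ w → V w → Aligned r w

    Central? : ∀ r → Dec (Central r)
    Central? r = ∀? (λ w → (a ∙ w ≟ 0#) →-dec (G₁ (v′ r) ≟ Ψ r w))

    -- The alignment condition is affine in w: if it fails somewhere, then of w and w + δ,
    -- for a suitable δ, it always fails at one.
    private
      shift-out : ∀ {r} → V r → ¬ Central r → ∃ λ δ → V δ × (∀ w → V w → ¬ Aligned r w ⊎ ¬ Aligned r (w ⊕ δ))
      shift-out {r} Vr ¬central
        with ¬∀⇒∃¬ (λ w → (a ∙ w ≟ 0#) →-dec (G₁ (v′ r) ≟ Ψ r w)) ¬central
           | ∃? (λ w → (a ∙ w ≟ 0#) ×-dec (G₁ (v′ r) ≟ Ψ r w))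
      ... | _ | no none = 𝟘 , ∙-𝟘 a , λ w Vw → inj₁ (λ al → none (w , Vw , al))
      ... | w₁ , ¬al | yes (w₂ , Vw₂ , al₂) = w₁ ⊝ w₂ , V-⊝ Vw₁ Vw₂ , λ w Vw → split w Vw (G₁ (v′ r) ≟ Ψ r w)
        where
        Vw₁ : V w₁
        Vw₁ = decidable-stable (a ∙ w₁ ≟ 0#) (λ ne → ¬al (λ Vw → contradiction Vw ne))
        split : ∀ w → V w → Dec (Aligned r w) → ¬ Aligned r w ⊎ ¬ Aligned r (w ⊕ (w₁ ⊝ w₂))
        split w Vw (no ¬al′) = inj₁ ¬al′
        split w Vw (yes al) = inj₂ λ al′ → ¬al λ _ → trans (⊕-cancelʳ (Ψ r w)
          (trans (trans (cong (G₁ (v′ r) ⊕_) (sym al)) (cong₂ _⊕_ al′ al₂))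
            (Ψ-affine Vr Vw Vw₂ (V-⊝ Vw₁ Vw₂)))) (cong (Ψ r) (⊕⊝ w₂ w₁))

    -- By `shift-out` each kernel vector `w` gives a bad line for `w` or for `w ⊕ δ`. Both run once
    -- through the kernel, so at least half of its vectors give bad lines.
    half-bad : ∀ {r} → V r → ¬ Central r → suc m ≤ 2 * ∑ (λ w → χ a w * β (z r) (e ⊕ w))
    half-bad {r} Vr ¬central = go (shift-out Vr ¬central)
      where
      open ≤-Reasoning
      B : Point → ℕ
      B w = χ a w * β (z r) (e ⊕ w)
      bad : ∀ {w} → V w → ¬ Aligned r w → 1 ≤ B w
      bad {w} Vw ¬al = ≤-reflexive (sym (cong₂ _*_ (𝟏-yes (a ∙ w ≟ 0#) Vw) (β-bad (λ g → ¬al (good⇒aligned Vr Vw g)))))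
      go : (∃ λ δ → V δ × (∀ w → V w → ¬ Aligned r w ⊎ ¬ Aligned r (w ⊕ δ))) → suc m ≤ 2 * ∑ B
      go (δ , Vδ , out) = begin
        suc m  ≡⟨ ∑χ a≢𝟘 ⟨
        ∑ (χ a)  ≤⟨ ∑-mono pointwise ⟩
        ∑ (λ w → B w + B (δ ⊕ w))  ≡⟨ ∑-+ B _ ⟩
        ∑ B + ∑ (λ w → B (δ ⊕ w))  ≡⟨ cong (∑ B +_) (trans (∑-shift B δ) (sym (+-identityʳ (∑ B)))) ⟩
        2 * ∑ B ∎
        where
        pointwise : ∀ w → χ a w ≤ B w + B (δ ⊕ w)
        pointwise w with a ∙ w ≟ 0#
        ... | no _ = z≤n
        ... | yes Vw with out w Vw
        ... | inj₁ ¬al = ≤-trans (≤-reflexive (sym (trans (*-identityˡ _) (β-bad (λ g → ¬al (good⇒aligned Vr Vw g)))))) (m≤m+n _ _)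
        ... | inj₂ ¬al = ≤-trans (bad (V-⊕ Vδ Vw) (λ al → ¬al (subst (Aligned r) (⊕-comm δ w) al))) (m≤n+m _ _)

    transversals : ℕ
    transversals = ∑ (λ r → χ a r * ∑ (λ w → χ a w * β (z r) (e ⊕ w)))

    -- A bad line in direction `e ⊕ w` meets the level in one point, whereas `W` counts its `q` base
    -- points and the `N` nonzero multiples of its direction.
    transversals-bound : N * (q * transversals) ≤ W
    transversals-bound = begin
      N * (q * transversals)  ≡⟨ cong (λ x → N * (q * x)) reorder ⟩
      N * (q * ∑ (λ w → χ a w * ∑ (λ r → χ a r * β (z r) (e ⊕ w))))  ≡⟨ cong (N *_) (∑-* q _) ⟨
      N * ∑ (λ w → q * (χ a w * ∑ (λ r → χ a r * β (z r) (e ⊕ w))))  ≡⟨ cong (N *_) (∑-cong through) ⟩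
      N * ∑ (λ w → χ a w * ∑ (λ p → β p (e ⊕ w)))  ≡⟨ *-comm N _ ⟩
      ∑ (λ w → χ a w * ∑ (λ p → β p (e ⊕ w))) * N  ≡⟨ ∑-* (∑ (λ w → χ a w * ∑ (λ p → β p (e ⊕ w)))) nonzero ⟨
      ∑ (λ y → ∑ (λ w → χ a w * ∑ (λ p → β p (e ⊕ w))) * nonzero y)  ≡⟨ ∑-cong scale ⟩
      ∑ (λ y → ∑ (λ w → nonzero y * χ a w * ∑ (λ p → β p (y · (e ⊕ w))))) ≡⟨ ∑-× _ ⟨
      ∑ (uncurry (λ y w → nonzero y * χ a w * ∑ (λ p → β p (y · (e ⊕ w)))))  ≤⟨ ∑-≤-injective (uncurry (λ y w → y · (e ⊕ w))) bound injective ⟩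
      W ∎
      where
      open ≤-Reasoning
      reorder : transversals ≡ ∑ (λ w → χ a w * ∑ (λ r → χ a r * β (z r) (e ⊕ w)))
      reorder = trans (∑-cong (λ r → sym (∑-* (χ a r) _))) (trans (∑-swap _)
        (∑-cong (λ w → trans (∑-cong (λ r → x∙yz≈y∙xz (χ a r) (χ a w) _)) (∑-* (χ a w) _))))
      through : ∀ w → q * (χ a w * ∑ (λ r → χ a r * β (z r) (e ⊕ w))) ≡ χ a w * ∑ (λ p → β p (e ⊕ w))
      through w with a ∙ w ≟ 0#
      ... | no _ = *-zeroʳ q
      ... | yes Vw = trans (cong (q *_) (*-identityˡ _)) (sym (trans (*-identityˡ _) (begin-equality
        ∑ (λ p → β p (e ⊕ w))  ≡⟨ ∑-shift (λ p → β p (e ⊕ w)) (b₁ ⊕ (t · e)) ⟨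
        ∑ (λ p → β ((b₁ ⊕ (t · e)) ⊕ p) (e ⊕ w))  ≡⟨ ∑-levels a (e ⊕ w) a∙≡1 (λ p → β ((b₁ ⊕ (t · e)) ⊕ p) (e ⊕ w)) ⟩
        ∑ (λ c → ∑ (λ r → χ a r * β ((b₁ ⊕ (t · e)) ⊕ ((c · (e ⊕ w)) ⊕ r)) (e ⊕ w)))  ≡⟨ ∑-cong (λ c → ∑-cong (λ r → cong (χ a r *_) (sym (β-rebase (c ,
                                                                                          vsolve (c ∷ []) (b₁ ⊕ (t · e) ∷ e ⊕ w ∷ r ∷ []) (v₀ ⊞ (s₀ ⊡ v₁ ⊞ v₂)) (v₀ ⊞ v₂ ⊞ s₀ ⊡ v₁) (refl , refl , refl , _)))))) ⟩
        ∑ {Carrier} (λ c → ∑ (λ r → χ a r * β (z r) (e ⊕ w)))  ≡⟨ ∑ᴷ-const _ ⟩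
        q * ∑ (λ r → χ a r * β (z r) (e ⊕ w)) ∎)))
        where
        a∙≡1 : a ∙ (e ⊕ w) ≡ 1#
        a∙≡1 = trans (cong (a ∙_) (trans (⊕-comm e w) (cong (w ⊕_) (sym (1· e))))) (∙-e Vw 1#)
      scale : ∀ y → ∑ (λ w → χ a w * ∑ (λ p → β p (e ⊕ w))) * nonzero y ≡ ∑ (λ w → nonzero y * χ a w * ∑ (λ p → β p (y · (e ⊕ w))))
      scale y with 0# ≟ y
      ... | yes _ = trans (*-zeroʳ (∑ (λ w → χ a w * ∑ (λ p → β p (e ⊕ w))))) (sym (∑-* 0 (λ (_ : Point) → 0)))
      ... | no 0≢y = trans (*-identityʳ (∑ (λ w → χ a w * ∑ (λ p → β p (e ⊕ w))))) (∑-cong (λ w → cong₂ _*_ (sym (*-identityˡ (χ a w))) (∑-cong (λ p → sym (β-scale (0≢y ∘ sym))))))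
      bound : ∀ x → uncurry (λ y w → nonzero y * χ a w * ∑ (λ p → β p (y · (e ⊕ w)))) x ≤ ∑ (λ p → β p (uncurry (λ y w → y · (e ⊕ w)) x))
      bound (y , w) = ≤-trans (*-monoˡ-≤ _ (*-mono-≤ (𝟏-≤1 (¬? (0# ≟ y))) (𝟏-≤1 (a ∙ w ≟ 0#)))) (≤-reflexive (*-identityˡ _))
      injective : ∀ (x x′ : Carrier × Point) → uncurry (λ y w → nonzero y * χ a w * ∑ (λ p → β p (y · (e ⊕ w)))) x ≢ 0 →
        uncurry (λ y w → nonzero y * χ a w * ∑ (λ p → β p (y · (e ⊕ w)))) x′ ≢ 0 →
        uncurry (λ y w → y · (e ⊕ w)) x ≡ uncurry (λ y w → y · (e ⊕ w)) x′ → x ≡ x′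
      injective (y , w) (y′ , w′) ≢0 ≢0′ eq = cong₂ _,_ y≡y′
        (⊕-cancelʳ e (trans (⊕-comm w e) (trans (·-cancel y≢0 (trans eq (cong (_· (e ⊕ w′)) (sym y≡y′)))) (⊕-comm e w′))))
        where
        y≢0 : y ≢ 0#
        y≢0 = 𝟏-≢0 (¬? (0# ≟ y)) (*-≢0ˡ (nonzero y) (*-≢0ˡ (nonzero y * χ a w) ≢0)) ∘ sym
        level : ∀ y w → V w → a ∙ (y · (e ⊕ w)) ≡ y
        level y w Vw = trans (cong (a ∙_) (vsolve (y ∷ []) (e ∷ w ∷ []) (s₀ ⊡ (v₀ ⊞ v₁)) (s₀ ⊡ v₁ ⊞ s₀ ⊡ v₀) (refl , refl , _))) (∙-e (V-· y Vw) y)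
        y≡y′ : y ≡ y′
        y≡y′ = trans (sym (level y w (𝟏-≢0 (a ∙ w ≟ 0#) (*-≢0ʳ (nonzero y) (*-≢0ˡ (nonzero y * χ a w) ≢0)))))
          (trans (cong (a ∙_) eq) (level y′ w′ (𝟏-≢0 (a ∙ w′ ≟ 0#) (*-≢0ʳ (nonzero y′) (*-≢0ˡ (nonzero y′ * χ a w′) ≢0′)))))

    exceptions : ℕ
    exceptions = ∑ (λ r → χ a r * 𝟏 (¬? (Central? r)))

    module _ (few : W ≤ 2 * q * (q * m)) where

      -- By `half-bad` and `transversals-bound`, `N * q * suc m * exceptions` is at most `2 * W`;
      -- strictness comes from `m < suc m`.
      exceptions-bound : N * exceptions < 4 * q
      exceptions-bound = *-cancelʳ-< (q * suc m) (N * exceptions) (4 * q) (begin-strict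
        N * exceptions * (q * suc m)  ≡⟨ solve′ 4 (λ n x q m → n :*′ x :*′ (q :*′ m) :=′ n :*′ (q :*′ (m :*′ x))) refl N exceptions q (suc m) ⟩
        N * (q * (suc m * exceptions))  ≤⟨ *-monoʳ-≤ N (*-monoʳ-≤ q halves) ⟩
        N * (q * (2 * transversals))  ≡⟨ solve′ 3 (λ n q x → n :*′ (q :*′ (con′ 2 :*′ x)) :=′ con′ 2 :*′ (n :*′ (q :*′ x))) refl N q transversals ⟩
        2 * (N * (q * transversals))  ≤⟨ *-monoʳ-≤ 2 (≤-trans transversals-bound few) ⟩
        2 * (2 * q * (q * m))  <⟨ *-monoʳ-< 2 (*-monoʳ-< (2 * q) (*-monoʳ-< q (n<1+n m))) ⟩
        2 * (2 * q * (q * suc m))  ≡⟨ solve′ 2 (λ q m → con′ 2 :*′ (con′ 2 :*′ q :*′ (q :*′ m)) :=′ con′ 4 :*′ q :*′ (q :*′ m)) refl q (suc m) ⟩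
        4 * q * (q * suc m) ∎)
        where
        open ≤-Reasoning
        open +-*-Solver using () renaming (solve to solve′; _:+_ to _:+′_; _:*_ to _:*′_; _:=_ to _:=′_; con to con′)
        instance
          2q-nonZero : NonZero (2 * q)
          2q-nonZero = >-nonZero (*-mono-≤ {1} {2} (s≤s z≤n) (≤-trans (s≤s z≤n) 3≤q))
        halves : suc m * exceptions ≤ 2 * transversals
        halves = begin
          suc m * exceptions  ≡⟨ ∑-* (suc m) _ ⟨
          ∑ (λ r → suc m * (χ a r * 𝟏 (¬? (Central? r))))  ≤⟨ ∑-mono pointwise ⟩
          ∑ (λ r → 2 * (χ a r * ∑ (λ w → χ a w * β (z r) (e ⊕ w))))  ≡⟨ ∑-* 2 _ ⟩
          2 * transversals ∎
          where
          pointwise : ∀ r → suc m * (χ a r * 𝟏 (¬? (Central? r))) ≤ 2 * (χ a r * ∑ (λ w → χ a w * β (z r) (e ⊕ w)))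
          pointwise r with a ∙ r ≟ 0# | Central? r
          ... | no _ | _ = ≤-trans (≤-reflexive (*-zeroʳ (suc m))) z≤n
          ... | yes _ | yes _ = ≤-trans (≤-reflexive (*-zeroʳ (suc m))) z≤n
          ... | yes Vr | no ¬c = ≤-trans (≤-reflexive (*-identityʳ (suc m))) (≤-trans (half-bad Vr ¬c) (≤-reflexive (cong (2 *_) (sym (*-identityˡ (∑ (λ w → χ a w * β (z r) (e ⊕ w))))))))

      private
        -- Otherwise all `suc m` points of the level are exceptions, and
        -- `N * suc m ≥ 2 * (q * q) ≥ 6 * q` violates the bound `4 * q`.
        central-exists′ : ∃ λ r → V r × Central r
        central-exists′ with ∃? (λ r → (a ∙ r ≟ 0#) ×-dec Central? r)
        ... | yes found = found
        ... | no none = contradiction exceptions-bound (≤⇒≯ (begin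
          4 * q  ≤⟨ *-monoˡ-≤ q (s≤s (s≤s (s≤s (s≤s (z≤n {2}))))) ⟩
          6 * q  ≡⟨ *-assoc 2 3 q ⟩
          2 * (3 * q)  ≤⟨ *-monoʳ-≤ 2 (*-monoˡ-≤ q 3≤q) ⟩
          2 * (q * q)  ≤⟨ *-mono-≤ 2≤N q²≤ ⟩
          N * suc m  ≡⟨ cong (N *_) all ⟨
          N * exceptions ∎))
          where
          open ≤-Reasoning
          all : exceptions ≡ suc m
          all = trans (∑-cong pointwise) (∑χ a≢𝟘)
            where
            pointwise : ∀ r → χ a r * 𝟏 (¬? (Central? r)) ≡ χ a r
            pointwise r with a ∙ r ≟ 0# | Central? r
            ... | no _   | _  = refl
            ... | yes Vr | yes c = contradiction (r , Vr , c) none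
            ... | yes _  | no _  = refl

      abstract
        central-exists : ∃ λ r → V r × Central r
        central-exists = central-exists′

    module _ {r} (Vr : V r) (central : Central r) where

      abstract
        -- For a central point `Ψ r w` does not depend on `w`, so its additive part `Δ r w`
        -- vanishes.
        central-relation : ∀ {w} → V w → lam r · G₂ ((1# +ᴷ - t) · w) ≡ (1# +ᴷ - lam r) · G₁ (t · w)
        central-relation {w} Vw = trans (from-difference Δ≡𝟘 (vsolve (lam r ∷ []) (G₁ ((- t) · w) ∷ G₂ ((1# +ᴷ - t) · w) ∷ [])
            (s₀ ⊡ v₁ ⊞ 𝟎) ((one :- s₀) ⊡ ((:- one) ⊡ v₀) ⊞ ((one :- s₀) ⊡ v₀ ⊞ s₀ ⊡ v₁)) (refl , refl , _)))
          (cong ((1# +ᴷ - lam r) ·_) (trans (cong ((- 1#) ·_) (trans (cong G₁ (vsolve (t ∷ []) (w ∷ []) ((:- s₀) ⊡ v₀) ((:- one) ⊡ (s₀ ⊡ v₀)) (refl , _)))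
            (G₁-neg (V-· t Vw)))) (vsolve [] (G₁ (t · w) ∷ []) ((:- one) ⊡ ((:- one) ⊡ v₀)) v₀ (refl , _))))
          where
          Δ≡𝟘 : Δ r w ≡ 𝟘
          Δ≡𝟘 = from-difference (trans (sym (Ψ-⊕ Vr (∙-𝟘 a) Vw)) (trans (cong (Ψ r) (𝟘⊕ w)) (trans (sym (central w Vw)) (central 𝟘 (∙-𝟘 a)))))
            (vsolve [] (Δ r w ∷ Ψ r 𝟘 ∷ []) (v₀ ⊞ v₁) (𝟎 ⊞ (v₁ ⊞ v₀)) (refl , refl , _))

        central-value : G₁ (v′ r) ≡ ((1# +ᴷ - lam r) · G₁ r) ⊕ (lam r · G₂ r)
        central-value = trans (central 𝟘 (∙-𝟘 a)) (cong₂ (λ P Q → ((1# +ᴷ - lam r) · G₁ P) ⊕ (lam r · G₂ Q)) (collapse _) (collapse _))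
          where
          collapse : ∀ s → r ⊕ (s · 𝟘) ≡ r
          collapse s = trans (cong (r ⊕_) (·𝟘 s)) (⊕𝟘 r)

  module Glued (few : W ≤ 2 * q * (q * m)) where

    private
      -- One central point on each level is enough: the relation no longer mentions the point, only
      -- its height `s`.
      relation : ∀ t → ∃ λ s → ∀ {w} → V w → s · G₂ ((1# +ᴷ - t) · w) ≡ (1# +ᴷ - s) · G₁ (t · w)
      relation t = let (r , Vr , central) = AtLevel.central-exists t few in
        AtLevel.lam t r , AtLevel.central-relation t Vr central

      relation⁻¹ : ∀ {t} (t≢0 : t ≢ 0#) → ∃ λ s → ∀ {w} → V w → s · G₂ ((inv t≢0 +ᴷ - 1#) · w) ≡ (1# +ᴷ - s) · G₁ w
      relation⁻¹ {t} t≢0 = let (s , rel) = relation t in s , λ {w} Vw →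
        trans (cong (λ x → s · G₂ x) (from-difference (cong (_· w) (inv-left t≢0))
                (vsolve (t ∷ inv t≢0 ∷ []) (w ∷ []) ((s₁ :- one) ⊡ v₀ ⊞ one ⊡ v₀) ((one :- s₀) ⊡ (s₁ ⊡ v₀) ⊞ (s₁ :* s₀) ⊡ v₀) (refl , _))))
          (trans (rel (V-· (inv t≢0) Vw)) (cong (λ x → (1# +ᴷ - s) · G₁ x) (·-inv t≢0 w)))

      -- `relation⁻¹` at `α` makes `G₁ w` a multiple of `G₂ (c · w)` for `c = 1 / α - 1`, which is
      -- nonzero since `α ≢ 1#`. The value `s = 1` would give `G₂ (c · w) ≡ 𝟘`.
      multiple : ∀ {w} → V w → w ≢ 𝟘 → ∃ λ c → (- 1#) · G₁ w ≡ G₂ (c · w)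
      multiple {w} Vw w≢𝟘 = go (relation⁻¹ α≢0)
        where
        c : Carrier
        c = inv α≢0 +ᴷ - 1#
        c≢0 : c ≢ 0#
        c≢0 = -‿≢0 (λ e → α≢1 (trans (trans (sym (solve 1 (λ x → x :* con (ℤ.+ 1) := x) refl α)) (cong (α *ᴷ_) (sym e))) (inv-right α≢0)))
        go : (∃ λ s → ∀ {w} → V w → s · G₂ (c · w) ≡ (1# +ᴷ - s) · G₁ w) → ∃ λ c → (- 1#) · G₁ w ≡ G₂ (c · w)
        go (s , rel) with 1# ≟ s
        ... | yes refl = contradiction
          (G₂-inj _ _ (trans (sym (1· _)) (trans (rel Vw) (trans (cong (_· G₁ w) (-‿inverseʳ 1#)) (trans (0· _) (sym G₂-𝟘))))))
          (·-≢𝟘 c≢0 w≢𝟘)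
        ... | no 1≢s =
          let i = inv (-‿≢0 1≢s)
              (κ , eq) = G₂-scalar ((- i) *ᴷ s) (V-· c Vw)
          in κ *ᴷ c , trans (trans (from-difference
               (cong₂ _⊕_ (cong ((- i) ·_) (sym (rel Vw))) (cong (_· G₁ w) (inv-left (-‿≢0 1≢s))))
               (vsolve (s ∷ i ∷ []) (G₁ w ∷ G₂ (c · w) ∷ [])
                 ((:- one) ⊡ v₀ ⊞ ((:- s₁) ⊡ (s₀ ⊡ v₁) ⊞ one ⊡ v₀))
                 (((:- s₁) :* s₀) ⊡ v₁ ⊞ ((:- s₁) ⊡ ((one :- s₀) ⊡ v₀) ⊞ (s₁ :* (one :- s₀)) ⊡ v₀)) (refl , refl , _))) eq)
             (cong G₂ (·-· κ c w))

    -- For c ≠ 0, -1 the vector G₂(cw) is a multiple of G₁(w) other than -G₁(w), so -G₁(w) = G₂(-w).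
    abstract
      G₁≡G₂ : ∀ {w} → V w → G₁ w ≡ G₂ w
      G₁≡G₂ {w} Vw with w ≟ 𝟘
      ... | yes refl = trans G₁-𝟘 (sym G₂-𝟘)
      ... | no w≢𝟘 = go (multiple Vw w≢𝟘)
        where
        G₁w≢𝟘 : G₁ w ≢ 𝟘
        G₁w≢𝟘 e = w≢𝟘 (G₁-inj _ _ (trans e (sym G₁-𝟘)))
        go : (∃ λ c → (- 1#) · G₁ w ≡ G₂ (c · w)) → G₁ w ≡ G₂ w
        go (c , eq) with c +ᴷ 1# ≟ 0#
        ... | yes c+1≡0 = from-difference
          (cong ((- 1#) ·_) (trans eq (trans (cong (λ x → G₂ (x · w)) c≡-1) (G₂-neg Vw))))
          (vsolve [] (G₁ w ∷ G₂ w ∷ []) (v₀ ⊞ (:- one) ⊡ ((:- one) ⊡ v₁)) (v₁ ⊞ (:- one) ⊡ ((:- one) ⊡ v₀)) (refl , refl , _))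
          where
          c≡-1 : c ≡ - 1#
          c≡-1 = trans (solve 1 (λ c → c := (c :+ con (ℤ.+ 1)) :- con (ℤ.+ 1)) refl c) (trans (cong (_+ᴷ - 1#) c+1≡0) (solve 0 (con (ℤ.+ 0) :- con (ℤ.+ 1) := :- con (ℤ.+ 1)) refl))
        ... | no c+1≢0 = contradiction G₁w≡𝟘 G₁w≢𝟘
          where
          t≢0 : inv c+1≢0 ≢ 0#
          t≢0 = inv-≢0 c+1≢0
          invinv : inv t≢0 ≡ c +ᴷ 1#
          invinv = Vectors.*-cancelˡ S t≢0 (trans (inv-right t≢0) (sym (inv-left c+1≢0)))
          s : Carrier
          s = proj₁ (relation⁻¹ t≢0)
          rel : s · G₂ (c · w) ≡ (1# +ᴷ - s) · G₁ w
          rel = trans (cong (λ x → s · G₂ (x · w)) (trans (solve 1 (λ c → c := (c :+ con (ℤ.+ 1)) :- con (ℤ.+ 1)) refl c) (cong (_+ᴷ - 1#) (sym invinv))))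
            (proj₂ (relation⁻¹ t≢0) Vw)
          G₁w≡𝟘 : G₁ w ≡ 𝟘
          G₁w≡𝟘 = from-difference (trans (sym rel) (cong (s ·_) (sym eq)))
            (vsolve (s ∷ []) (G₁ w ∷ []) (v₀ ⊞ s₀ ⊡ ((:- one) ⊡ v₀)) (𝟎 ⊞ (one :- s₀) ⊡ v₀) (refl , _))

    -- With `G₁` in place of `G₂` the relation reads `s · (G₁ w ⊝ G₁ (t · w)) ≡ (1 - s) · G₁ (t ·
    -- w)`, and the terms `s · G₁ (t · w)` cancel.
    G-homothety : ∀ t {s} → (∀ {w} → V w → s · G₂ ((1# +ᴷ - t) · w) ≡ (1# +ᴷ - s) · G₁ (t · w)) →
      ∀ {w} → V w → G₁ (t · w) ≡ s · G₁ w
    G-homothety t {s} rel {w} Vw = from-difference (trans (sym (rel Vw)) (cong (s ·_) (trans (sym (G₁≡G₂ (V-· _ Vw)))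
        (trans (cong G₁ (vsolve (t ∷ []) (w ∷ []) ((one :- s₀) ⊡ v₀) (v₀ ⊟ s₀ ⊡ v₀) (refl , _))) (G₁-⊝ Vw (V-· t Vw))))))
      (vsolve (s ∷ []) (G₁ w ∷ G₁ (t · w) ∷ []) (v₁ ⊞ s₀ ⊡ (v₀ ⊟ v₁)) (s₀ ⊡ v₀ ⊞ (one :- s₀) ⊡ v₁) (refl , refl , _))

    -- The height of a chosen central point on the level of `t`. `σ-unique` frees it from the
    -- choice, and the field laws follow by evaluating at the single vector `w₀`.
    σ : Carrier → Carrier
    σ t = proj₁ (relation t)

    σ-spec : ∀ t {w} → V w → G₁ (t · w) ≡ σ t · G₁ w
    σ-spec t = G-homothety t (proj₂ (relation t))

    private
      w₀ : Point
      w₀ = proj₁ (outside-line 𝟘)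
      Vw₀ : V w₀
      Vw₀ = proj₁ (proj₂ (outside-line 𝟘))
      w₀≢𝟘 : w₀ ≢ 𝟘
      w₀≢𝟘 e = proj₂ (proj₂ (outside-line 𝟘)) (0# , trans e (sym (0· 𝟘)))
      G₁w₀≢𝟘 : G₁ w₀ ≢ 𝟘
      G₁w₀≢𝟘 e = w₀≢𝟘 (G₁-inj _ _ (trans e (sym G₁-𝟘)))

    σ-unique : ∀ t {s} → G₁ (t · w₀) ≡ s · G₁ w₀ → s ≡ σ t
    σ-unique t e = ·-injective G₁w₀≢𝟘 (trans (sym e) (σ-spec t Vw₀))

    σ-0 : σ 0# ≡ 0#
    σ-0 = sym (σ-unique 0# (trans (cong G₁ (0· w₀)) (trans G₁-𝟘 (sym (0· _)))))

    σ-1 : σ 1# ≡ 1#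
    σ-1 = sym (σ-unique 1# (trans (cong G₁ (1· w₀)) (sym (1· _))))

    σ-+ : ∀ x y → σ (x +ᴷ y) ≡ σ x +ᴷ σ y
    σ-+ x y = sym (σ-unique (x +ᴷ y) (trans (cong G₁ (·-distribʳ x y w₀)) (trans (G₁-⊕ (V-· x Vw₀) (V-· y Vw₀))
      (trans (cong₂ _⊕_ (σ-spec x Vw₀) (σ-spec y Vw₀)) (sym (·-distribʳ (σ x) (σ y) _))))))

    σ-* : ∀ x y → σ (x *ᴷ y) ≡ σ x *ᴷ σ y
    σ-* x y = sym (σ-unique (x *ᴷ y) (trans (cong G₁ (sym (·-· x y w₀))) (trans (σ-spec x (V-· y Vw₀))
      (trans (cong (σ x ·_) (σ-spec y Vw₀)) (·-· (σ x) (σ y) _)))))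

    σ-injective : ∀ x y → σ x ≡ σ y → x ≡ y
    σ-injective x y e = ·-injective w₀≢𝟘 (G₁-inj _ _ (trans (σ-spec x Vw₀) (trans (cong (_· G₁ w₀) e) (sym (σ-spec y Vw₀)))))

    σ-automorphism : IsFieldAutomorphism σ
    σ-automorphism = ((λ {x} {y} → σ-injective x y) ,
      (λ y → let (x , e) = injective⇒surjective σ σ-injective y in x , λ z≡x → trans (cong σ z≡x) e)) , σ-+ , σ-* , σ-1

    g h : Point → Point
    g p = G₁ (flat p) ⊕ (σ (a ∙ p) · e′)
    h p = g p ⊕ (f b₁ ⊝ g b₁)

    g-⊕ : ∀ x y → g (x ⊕ y) ≡ g x ⊕ g y
    g-⊕ x y = begin
      G₁ (flat (x ⊕ y)) ⊕ (σ (a ∙ (x ⊕ y)) · e′)  ≡⟨ cong₂ (λ P c → G₁ P ⊕ (c · e′)) flat-sum (trans (cong σ (∙-⊕ a x y)) (σ-+ _ _)) ⟩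
      G₁ (flat x ⊕ flat y) ⊕ ((σ (a ∙ x) +ᴷ σ (a ∙ y)) · e′)  ≡⟨ cong (_⊕ ((σ (a ∙ x) +ᴷ σ (a ∙ y)) · e′)) (G₁-⊕ (V-flat x) (V-flat y)) ⟩
      (G₁ (flat x) ⊕ G₁ (flat y)) ⊕ ((σ (a ∙ x) +ᴷ σ (a ∙ y)) · e′)  ≡⟨ vsolve (σ (a ∙ x) ∷ σ (a ∙ y) ∷ []) (G₁ (flat x) ∷ G₁ (flat y) ∷ e′ ∷ []) (v₀ ⊞ v₁ ⊞ (s₀ :+ s₁) ⊡ v₂) ((v₀ ⊞ s₀ ⊡ v₂) ⊞ (v₁ ⊞ s₁ ⊡ v₂)) (refl , refl , refl , _) ⟩
      g x ⊕ g y ∎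
      where
      open ≡-Reasoning
      flat-sum : flat (x ⊕ y) ≡ flat x ⊕ flat y
      flat-sum = trans (cong (λ c → (x ⊕ y) ⊝ (c · e)) (∙-⊕ a x y))
        (vsolve (a ∙ x ∷ a ∙ y ∷ []) (x ∷ y ∷ e ∷ []) ((v₀ ⊞ v₁) ⊟ (s₀ :+ s₁) ⊡ v₂) ((v₀ ⊟ s₀ ⊡ v₂) ⊞ (v₁ ⊟ s₁ ⊡ v₂)) (refl , refl , refl , _))

    g-· : ∀ s x → g (s · x) ≡ σ s · g x
    g-· s x = begin
      G₁ (flat (s · x)) ⊕ (σ (a ∙ (s · x)) · e′)  ≡⟨ cong₂ (λ P c → G₁ P ⊕ (c · e′)) flat-scale (trans (cong σ (∙-· a s x)) (σ-* _ _)) ⟩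
      G₁ (s · flat x) ⊕ ((σ s *ᴷ σ (a ∙ x)) · e′)  ≡⟨ cong (_⊕ ((σ s *ᴷ σ (a ∙ x)) · e′)) (σ-spec s (V-flat x)) ⟩
      (σ s · G₁ (flat x)) ⊕ ((σ s *ᴷ σ (a ∙ x)) · e′)  ≡⟨ vsolve (σ s ∷ σ (a ∙ x) ∷ []) (G₁ (flat x) ∷ e′ ∷ []) (s₀ ⊡ v₀ ⊞ (s₀ :* s₁) ⊡ v₁) (s₀ ⊡ (v₀ ⊞ s₁ ⊡ v₁)) (refl , refl , _) ⟩
      σ s · g x ∎
      where
      open ≡-Reasoning
      flat-scale : flat (s · x) ≡ s · flat x
      flat-scale = trans (cong (λ c → (s · x) ⊝ (c · e)) (∙-· a s x))
        (vsolve (s ∷ a ∙ x ∷ []) (x ∷ e ∷ []) (s₀ ⊡ v₀ ⊟ (s₀ :* s₁) ⊡ v₁) (s₀ ⊡ (v₀ ⊟ s₁ ⊡ v₁)) (refl , refl , _))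

    g-injective : ∀ x y → g x ≡ g y → x ≡ y
    g-injective x y eq = trans (flat-⊕ x) (trans (cong₂ (λ p t → p ⊕ (t · e)) flat≡ level≡) (sym (flat-⊕ y)))
      where
      level≡ : a ∙ x ≡ a ∙ y
      level≡ = σ-injective _ _ (level-unique (V-flat x) (V-flat y) eq)
      flat≡ : flat x ≡ flat y
      flat≡ = G₁-inj _ _ (⊕-cancelʳ (σ (a ∙ x) · e′) (trans eq (cong (λ t → G₁ (flat y) ⊕ (σ t · e′)) (sym level≡))))

    h-semiaffine : IsSemiAffine h
    h-semiaffine = σ , σ-automorphism , g ,
      ((λ {x} {y} → g-injective x y) , (λ y → let (x , e) = injective⇒surjective g g-injective y in x , λ z≡x → trans (cong g z≡x) e)) ,
      g-⊕ , g-· , (f b₁ ⊝ g b₁) , λ _ → refl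

    h-value : ∀ t {r} → V r → h (AtLevel.z t r) ≡ f b₁ ⊕ (G₁ r ⊕ (σ t · e′))
    h-value t {r} Vr = trans (cong (_⊕ (f b₁ ⊝ g b₁)) (trans (cong g (trans (⊕-assoc b₁ _ r) (cong (b₁ ⊕_) (⊕-comm _ r)))) (g-⊕ b₁ (r ⊕ (t · e)))))
      (trans (vsolve [] (g b₁ ∷ g (r ⊕ (t · e)) ∷ f b₁ ∷ []) (v₀ ⊞ v₁ ⊞ (v₂ ⊟ v₀)) (v₂ ⊞ v₁) (refl , refl , refl , _))
        (cong (f b₁ ⊕_) (cong₂ (λ P c → G₁ P ⊕ (σ c · e′)) flat≡ (∙-e Vr t))))
      where
      flat≡ : flat (r ⊕ (t · e)) ≡ r
      flat≡ = trans (cong (λ c → (r ⊕ (t · e)) ⊝ (c · e)) (∙-e Vr t)) (vsolve (t ∷ []) (r ∷ e ∷ []) (v₀ ⊞ s₀ ⊡ v₁ ⊟ s₀ ⊡ v₁) v₀ (refl , refl , _))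

    -- The height of a central point is `σ t` by uniqueness; its kernel part is by `central-value`
    -- an affine combination of `G₁ r` and `G₂ r`, which are equal.
    central⇒f≡h : ∀ t {r} → V r → AtLevel.Central t r → f (AtLevel.z t r) ≡ h (AtLevel.z t r)
    central⇒f≡h t {r} Vr central = trans (f-z r) (trans (cong (f b₁ ⊕_) (cong₂ (λ P c → P ⊕ (c · e′)) value level)) (sym (h-value t Vr)))
      where
      open AtLevel t
      value : G₁ (v′ r) ≡ G₁ r
      value = trans (central-value Vr central) (trans (cong (λ P → ((1# +ᴷ - lam r) · G₁ r) ⊕ (lam r · P)) (sym (G₁≡G₂ Vr)))
        (vsolve (lam r ∷ []) (G₁ r ∷ []) ((one :- s₀) ⊡ v₀ ⊞ s₀ ⊡ v₀) v₀ (refl , _)))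
      level : lam r ≡ σ t
      level = σ-unique t (G-homothety t (central-relation Vr central) Vw₀)

    defect : ℕ
    defect = ∑ (λ p → 𝟏 (¬? (f p ≟ h p)))

    inner-levels : ℕ
    inner-levels = ∑ (λ t → 𝟏 (¬? (0# ≟ t)) * 𝟏 (¬? (1# ≟ t)))

    2+inner-levels : inner-levels + 2 ≡ q
    2+inner-levels = begin
      inner-levels + 2  ≡⟨ cong (inner-levels +_) (cong₂ _+_ (∑-δ 0# (λ _ → 1)) (∑-δ 1# (λ _ → 1))) ⟨
      inner-levels + (∑ (λ t → 𝟏 (0# ≟ t) * 1) + ∑ (λ t → 𝟏 (1# ≟ t) * 1))  ≡⟨ cong (inner-levels +_) (∑-+ _ _) ⟨
      inner-levels + ∑ (λ t → 𝟏 (0# ≟ t) * 1 + 𝟏 (1# ≟ t) * 1)  ≡⟨ ∑-+ _ _ ⟨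
      ∑ (λ t → 𝟏 (¬? (0# ≟ t)) * 𝟏 (¬? (1# ≟ t)) + (𝟏 (0# ≟ t) * 1 + 𝟏 (1# ≟ t) * 1))  ≡⟨ ∑-cong pointwise ⟩
      ∑ {Carrier} (λ _ → 1)  ≡⟨ trans (∑ᴷ-const 1) (*-identityʳ q) ⟩
      q ∎
      where
      open ≡-Reasoning
      pointwise : ∀ t → 𝟏 (¬? (0# ≟ t)) * 𝟏 (¬? (1# ≟ t)) + (𝟏 (0# ≟ t) * 1 + 𝟏 (1# ≟ t) * 1) ≡ 1
      pointwise t with 0# ≟ t | 1# ≟ t
      ... | yes refl | yes 1≡0 = contradiction (sym 1≡0) 0≢1
      ... | yes _  | no _  = refl
      ... | no _  | yes _   = refl
      ... | no _  | no _  = refl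

    -- The levels of 0 and 1 contain no point where `f` and `h` differ; on each of the other `q - 2`
    -- levels such points are exceptions.
    defect-bound : N * defect ≤ 4 * q * inner-levels
    defect-bound = begin
      N * defect  ≡⟨ cong (N *_) (∑-shift (λ p → 𝟏 (¬? (f p ≟ h p))) b₁) ⟨
      N * ∑ (λ p → 𝟏 (¬? (f (b₁ ⊕ p) ≟ h (b₁ ⊕ p))))  ≡⟨ cong (N *_) (∑-levels a e ae≡1 _) ⟩
      N * ∑ (λ t → ∑ (λ r → χ a r * 𝟏 (¬? (f (b₁ ⊕ ((t · e) ⊕ r)) ≟ h (b₁ ⊕ ((t · e) ⊕ r)))))) ≡⟨ ∑-* N _ ⟨
      ∑ (λ t → N * ∑ (λ r → χ a r * 𝟏 (¬? (f (b₁ ⊕ ((t · e) ⊕ r)) ≟ h (b₁ ⊕ ((t · e) ⊕ r)))))) ≤⟨ ∑-mono each ⟩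
      ∑ (λ t → 4 * q * (𝟏 (¬? (0# ≟ t)) * 𝟏 (¬? (1# ≟ t))))  ≡⟨ ∑-* (4 * q) _ ⟩
      4 * q * inner-levels ∎
      where
      open ≤-Reasoning
      wrong : Carrier → Point → ℕ
      wrong t r = χ a r * 𝟏 (¬? (f (b₁ ⊕ ((t · e) ⊕ r)) ≟ h (b₁ ⊕ ((t · e) ⊕ r))))
      none : ∀ t → (∀ {r} → V r → f (AtLevel.z t r) ≡ h (AtLevel.z t r)) → N * ∑ (wrong t) ≡ 0
      none t right = trans (cong (N *_) (trans (∑-cong pointwise) (∑-* 0 (λ (_ : Point) → 0)))) (*-zeroʳ N)
        where
        pointwise : ∀ r → wrong t r ≡ 0
        pointwise r with a ∙ r ≟ 0#
        ... | no _   = refl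
        ... | yes Vr = trans (*-identityˡ _) (𝟏-no (¬? (f (b₁ ⊕ ((t · e) ⊕ r)) ≟ h (b₁ ⊕ ((t · e) ⊕ r)))) (λ ne → ne (subst (λ p → f p ≡ h p) (⊕-assoc b₁ (t · e) r) (right Vr))))
      at-0 : ∀ {r} → V r → f (AtLevel.z 0# r) ≡ h (AtLevel.z 0# r)
      at-0 {r} Vr = trans (cong f (cong (_⊕ r) (trans (cong (b₁ ⊕_) (0· e)) (⊕𝟘 b₁)))) (trans (f-G₁ r) (sym (trans (h-value 0# Vr)
        (cong (f b₁ ⊕_) (trans (cong (G₁ r ⊕_) (trans (cong (_· e′) σ-0) (0· e′))) (⊕𝟘 _))))))
      at-1 : ∀ {r} → V r → f (AtLevel.z 1# r) ≡ h (AtLevel.z 1# r)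
      at-1 {r} Vr = trans (cong (λ x → f ((b₁ ⊕ x) ⊕ r)) (1· e)) (trans (f-G₂ r) (trans (cong (f b₂ ⊕_) (sym (G₁≡G₂ Vr))) (sym (trans (h-value 1# Vr)
        (trans (cong (λ c → f b₁ ⊕ (G₁ r ⊕ (c · e′))) σ-1) (vsolve [] (f b₁ ∷ f b₂ ∷ G₁ r ∷ []) (v₀ ⊞ (v₂ ⊞ one ⊡ (v₁ ⊟ v₀))) (v₁ ⊞ v₂) (refl , refl , refl , _)))))))
      each : ∀ t → N * ∑ (wrong t) ≤ 4 * q * (𝟏 (¬? (0# ≟ t)) * 𝟏 (¬? (1# ≟ t)))
      each t with 0# ≟ t | 1# ≟ t
      ... | yes refl | _ = ≤-trans (≤-reflexive (none 0# at-0)) z≤n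
      ... | no _ | yes refl = ≤-trans (≤-reflexive (none 1# at-1)) z≤n
      ... | no _ | no _ = ≤-trans (*-monoʳ-≤ N (∑-mono pointwise)) (≤-trans (<⇒≤ (AtLevel.exceptions-bound t few)) (≤-reflexive (sym (*-identityʳ (4 * q)))))
        where
        pointwise : ∀ r → wrong t r ≤ χ a r * 𝟏 (¬? (AtLevel.Central? t r))
        pointwise r with a ∙ r ≟ 0#
        ... | no _   = z≤n
        ... | yes Vr = *-monoʳ-≤ 1 (𝟏-mono (¬? (f (b₁ ⊕ ((t · e) ⊕ r)) ≟ h (b₁ ⊕ ((t · e) ⊕ r)))) (¬? (AtLevel.Central? t r))
                         (λ ne central → ne (subst (λ p → f p ≡ h p) (⊕-assoc b₁ (t · e) r) (central⇒f≡h t Vr central))))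

-- Counting the points where `f` and `h` differ.

module Defect {q} {K : FiniteField q} {n : ℕ} (S : Space K n)
  {α : FiniteField.Carrier K} (α≢0 : α ≢ FiniteField.0# K) (α≢1 : α ≢ FiniteField.1# K)
  (3≤q : 3 ≤ q) {m : ℕ} (size : q * suc m ≡ q ^ n) (q²≤ : q * q ≤ suc m)
  (f : Space.Point S → Space.Point S) (inj : ∀ x y → f x ≡ f y → x ≡ y)
  {h : Space.Point S → Space.Point S} (h-semiaffine : Vectors.IsSemiAffine S h) where
  open FiniteField K using (Carrier; 0#; 1#; -_; 0≢1) renaming (_+_ to _+ᴷ_; _*_ to _*ᴷ_)
  open Vectors S hiding (+-comm; +-assoc; *-comm; *-assoc; +-identityʳ; +-identityˡ; *-identityʳ; *-identityˡ; *-cancelˡ)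
  open Variables
  open Lines S
  open SemiAffine S
  open GoodLevels S α≢0 α≢1 3≤q size q²≤ f inj

  private
    h-inj : ∀ x y → h x ≡ h y → x ≡ y
    h-inj = semiaffine-injective h-semiaffine

  Moved : Point → Set
  Moved p = f p ≢ h p

  Moved? : ∀ p → Dec (Moved p)
  Moved? p = ¬? (f p ≟ h p)

  d : ℕ
  d = ∑ (λ p → 𝟏 (Moved? p))

  Isolated : Point → Point → Set
  Isolated p v = v ≢ 𝟘 × Moved p × (∀ t → t ≢ 0# → ¬ Moved (p ⊕ (t · v)))

  Isolated? : ∀ p v → Dec (Isolated p v)
  Isolated? p v = ¬? (v ≟ 𝟘) ×-dec (Moved? p ×-dec ∀? (λ t → ¬? (t ≟ 0#) →-dec ¬? (Moved? (p ⊕ (t · v)))))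

  -- As q ≥ 3, the line has two further points `x` and `y`, where `f` and `h` agree. If it were
  -- good, `f p` would be some `h (p ⊕ (t · v))`; here `t = 0` contradicts `Moved p`, and any other
  -- `t` contradicts injectivity of `f`.
  isolated⇒bad : ∀ {p v} → Isolated p v → ¬ Good f p v
  isolated⇒bad {p} {v} (v≢𝟘 , moved , rest) good-pv = go (good-three inj good-pv (1# , refl) (α , refl) (OnLine-base p v) x≢y)
    where
    x y : Point
    x = p ⊕ (1# · v)
    y = p ⊕ (α · v)
    x≢y : x ≢ y
    x≢y eq = α≢1 (·-injective v≢𝟘 (sym (trans (sym (⊕-⊝ p _)) (trans (cong (_⊝ p) eq) (⊕-⊝ p _)))))
    unmoved : ∀ {t} → t ≢ 0# → f (p ⊕ (t · v)) ≡ h (p ⊕ (t · v))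
    unmoved t≢0 = decidable-stable (f _ ≟ h _) (rest _ t≢0)
    go : ¬ (∃ λ s → f p ≡ f x ⊕ (s · (f y ⊝ f x)))
    go (s , eq) with good-onto h-inj (semiaffine-good h-semiaffine p v) (1# , refl) (α , refl) x≢y s
    ... | t , eq′ with t ≟ 0#
    ... | yes refl = moved (trans fp≡ (cong h (sym (proj₂ (OnLine-base p v)))))
      where
      fp≡ : f p ≡ h (p ⊕ (0# · v))
      fp≡ = trans eq (trans (cong₂ (λ P Q → P ⊕ (s · (Q ⊝ P))) (unmoved (0≢1 ∘ sym)) (unmoved α≢0)) (sym eq′))
    ... | no t≢0 = ·-≢𝟘 t≢0 v≢𝟘 (trans (sym (⊕-⊝ p _)) (trans (cong (_⊝ p) (sym p≡)) (vsolve [] (p ∷ []) (v₀ ⊟ v₀) 𝟎 (refl , _))))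
      where
      p≡ : p ≡ p ⊕ (t · v)
      p≡ = inj _ _ (trans eq (trans (cong₂ (λ P Q → P ⊕ (s · (Q ⊝ P))) (unmoved (0≢1 ∘ sym)) (unmoved α≢0)) (trans (sym eq′) (sym (unmoved t≢0)))))

  isolated-lines : ℕ
  isolated-lines = ∑ (λ v → ∑ (λ p → 𝟏 (Isolated? p v)))

  -- An isolated line contains only one moved point, so shifting that point along the line by the
  -- `q` scalars never produces the same base point twice.
  isolated-lines-bound : q * isolated-lines ≤ W
  isolated-lines-bound = ≤-trans (≤-reflexive (sym (∑-* q _))) (∑-mono each)
    where
    open ≤-Reasoning
    each : ∀ v → q * ∑ (λ p → 𝟏 (Isolated? p v)) ≤ ∑ (λ b → β b v)
    each v = begin
      q * ∑ (λ p → 𝟏 (Isolated? p v))  ≡⟨ ∑ᴷ-const _ ⟨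
      ∑ {Carrier} (λ s → ∑ (λ p → 𝟏 (Isolated? p v)))  ≡⟨ ∑-× _ ⟨
      ∑ (uncurry (λ (s : Carrier) p → 𝟏 (Isolated? p v)))  ≤⟨ ∑-≤-injective (uncurry (λ s p → p ⊕ (s · v))) bound injective ⟩
      ∑ (λ b → β b v) ∎
      where
      bound : ∀ x → 𝟏 (Isolated? (proj₂ x) v) ≤ β (proj₂ x ⊕ (proj₁ x · v)) v
      bound (s , p) = ≤-trans (𝟏-mono (Isolated? p v) (¬? (Good? f p v)) isolated⇒bad) (≤-reflexive (β-rebase (s , refl)))
      injective : ∀ x x′ → 𝟏 (Isolated? (proj₂ x) v) ≢ 0 → 𝟏 (Isolated? (proj₂ x′) v) ≢ 0 →
        proj₂ x ⊕ (proj₁ x · v) ≡ proj₂ x′ ⊕ (proj₁ x′ · v) → x ≡ x′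
      injective (s , p) (s′ , p′) ≢0 ≢0′ eq =
        same (𝟏-≢0 (Isolated? p v) ≢0) (𝟏-≢0 (Isolated? p′ v) ≢0′)
        where
        p′≡ : p′ ≡ p ⊕ ((s +ᴷ - s′) · v)
        p′≡ = from-difference (sym eq) (vsolve (s ∷ s′ ∷ []) (p ∷ p′ ∷ v ∷ []) (v₁ ⊞ (v₀ ⊞ s₀ ⊡ v₂)) (v₀ ⊞ (s₀ :- s₁) ⊡ v₂ ⊞ (v₁ ⊞ s₁ ⊡ v₂)) (refl , refl , refl , _))
        same : Isolated p v → Isolated p′ v → (s , p) ≡ (s′ , p′)
        same (v≢𝟘 , _ , rest) (_ , moved′ , _) with s ≟ s′
        ... | yes refl = cong (s ,_) (⊕-cancelʳ (s · v) eq)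
        ... | no s≢s′ = contradiction (subst Moved p′≡ moved′) (rest _ (-‿≢0 s≢s′))

  others : Point → ℕ
  others p = ∑ (λ p′ → 𝟏 (Moved? p′) * 𝟏 (¬? (p ≟ p′)))

  1+others : ∀ {p} → Moved p → suc (others p) ≡ d
  1+others {p} moved = begin
    1 + others p  ≡⟨ cong (_+ others p) (trans (∑-δ p (λ p′ → 𝟏 (Moved? p′))) (𝟏-yes (Moved? p) moved)) ⟨
    ∑ (λ p′ → 𝟏 (p ≟ p′) * 𝟏 (Moved? p′)) + others p  ≡⟨ ∑-+ _ _ ⟨
    ∑ (λ p′ → 𝟏 (p ≟ p′) * 𝟏 (Moved? p′) + 𝟏 (Moved? p′) * 𝟏 (¬? (p ≟ p′)))   ≡⟨ ∑-cong (λ p′ → trans (factor (𝟏 (p ≟ p′)) (𝟏 (Moved? p′)) _) (trans (cong (𝟏 (Moved? p′) *_) (𝟏-¬ (p ≟ p′))) (*-identityʳ _))) ⟩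
    d ∎
    where
    open ≡-Reasoning
    factor : ∀ x y z → x * y + y * z ≡ y * (x + z)
    factor x y z = trans (cong (_+ y * z) (*-comm x y)) (sym (*-distribˡ-+ y x z))

  A : ℕ
  A = N + q * m

  1+A≡ : suc A ≡ card Point
  1+A≡ = trans (cong (_+ q * m) 1+N≡q) (trans (sym (*-suc q m)) (trans size (sym card-Point)))

  -- Of the `A = q^n - 1` nonzero directions at `p`, every other moved point spoils only the `N`
  -- nonzero multiples of its difference from `p`.
  isolated-at : ∀ {p} → Moved p → A ≤ ∑ (λ v → 𝟏 (Isolated? p v)) + others p * N
  isolated-at {p} moved = begin
    A  ≡⟨ suc-injective (trans 1+A≡ (sym (∑-≢ 𝟘))) ⟩
    ∑ (λ v → 𝟏 (¬? (𝟘 ≟ v)))  ≤⟨ ∑-mono split ⟩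
    ∑ (λ v → 𝟏 (Isolated? p v) + 𝟏 (blocked? v))  ≡⟨ ∑-+ _ _ ⟩
    ∑ (λ v → 𝟏 (Isolated? p v)) + ∑ (λ v → 𝟏 (blocked? v))  ≤⟨ +-monoʳ-≤ _ few-blocked ⟩
    ∑ (λ v → 𝟏 (Isolated? p v)) + others p * N ∎
    where
    open ≤-Reasoning
    Blocked : Point → Set
    Blocked v = v ≢ 𝟘 × ∃ λ t → t ≢ 0# × Moved (p ⊕ (t · v))
    blocked? : ∀ v → Dec (Blocked v)
    blocked? v = ¬? (v ≟ 𝟘) ×-dec ∃? (λ t → ¬? (t ≟ 0#) ×-dec Moved? (p ⊕ (t · v)))
    split : ∀ v → 𝟏 (¬? (𝟘 ≟ v)) ≤ 𝟏 (Isolated? p v) + 𝟏 (blocked? v)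
    split v = go (𝟘 ≟ v) (blocked? v)
      where
      go : (d₁ : Dec (𝟘 ≡ v)) (d₂ : Dec (Blocked v)) → 𝟏 (¬? d₁) ≤ 𝟏 (Isolated? p v) + 𝟏 d₂
      go (yes _) _ = z≤n
      go (no _) (yes _) = m≤n+m 1 _
      go (no 𝟘≢v) (no ¬b) = ≤-trans (≤-reflexive (sym (𝟏-yes (Isolated? p v) (𝟘≢v ∘ sym , moved , λ t t≢0 mv → ¬b (𝟘≢v ∘ sym , t , t≢0 , mv))))) (m≤m+n _ 0)
    few-blocked : ∑ (λ v → 𝟏 (blocked? v)) ≤ others p * N
    few-blocked = begin
      ∑ (λ v → 𝟏 (blocked? v))  ≤⟨ ∑-≤-surjective (uncurry (λ p′ y → y · (p′ ⊝ p))) covered ⟩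
      ∑ (uncurry (λ p′ y → 𝟏 (Moved? p′) * 𝟏 (¬? (p ≟ p′)) * nonzero y))  ≡⟨ ∑-× (λ p′ y → 𝟏 (Moved? p′) * 𝟏 (¬? (p ≟ p′)) * nonzero y) ⟩
      ∑ (λ p′ → ∑ (λ y → 𝟏 (Moved? p′) * 𝟏 (¬? (p ≟ p′)) * nonzero y))  ≡⟨ ∑-cong (λ p′ → trans (∑-* (𝟏 (Moved? p′) * 𝟏 (¬? (p ≟ p′))) nonzero) (*-comm (𝟏 (Moved? p′) * 𝟏 (¬? (p ≟ p′))) N)) ⟩
      ∑ (λ p′ → N * (𝟏 (Moved? p′) * 𝟏 (¬? (p ≟ p′))))  ≡⟨ trans (∑-* N _) (*-comm N _) ⟩
      others p * N ∎
      where
      covered : ∀ v → 𝟏 (blocked? v) ≢ 0 → ∃ λ x → uncurry (λ p′ y → y · (p′ ⊝ p)) x ≡ v ×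
        𝟏 (blocked? v) ≤ uncurry (λ p′ y → 𝟏 (Moved? p′) * 𝟏 (¬? (p ≟ p′)) * nonzero y) x
      covered v ≢0 = go (𝟏-≢0 (blocked? v) ≢0)
        where
        go : Blocked v → ∃ λ x → uncurry (λ p′ y → y · (p′ ⊝ p)) x ≡ v ×
          𝟏 (blocked? v) ≤ uncurry (λ p′ y → 𝟏 (Moved? p′) * 𝟏 (¬? (p ≟ p′)) * nonzero y) x
        go (v≢𝟘 , t , t≢0 , mv) = (p ⊕ (t · v) , inv t≢0) , trans (cong (inv t≢0 ·_) (⊕-⊝ p _)) (inv-· t≢0 v) ,
          ≤-trans (𝟏-≤1 (blocked? v)) (≤-reflexive (sym (cong₂ _*_ (cong₂ _*_ (𝟏-yes (Moved? _) mv)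
            (𝟏-yes (¬? (p ≟ (p ⊕ (t · v)))) (λ eq → ·-≢𝟘 t≢0 v≢𝟘 (trans (sym (⊕-⊝ p _)) (trans (cong (_⊝ p) (sym eq)) (vsolve [] (p ∷ []) (v₀ ⊟ v₀) 𝟎 (refl , _)))))))
            (𝟏-yes (¬? (0# ≟ inv t≢0)) (inv-≢0 t≢0 ∘ sym)))))

  defect-count : ∀ {d₁} → d ≡ suc d₁ → q * (d * A) ≤ W + q * (d * (d₁ * N))
  defect-count {d₁} d≡ = begin
    q * (d * A)  ≡⟨ cong (q *_) (trans (*-comm d A) (sym (∑-* A _))) ⟩
    q * ∑ (λ p → A * 𝟏 (Moved? p))  ≤⟨ *-monoʳ-≤ q (∑-mono pointwise) ⟩
    q * ∑ (λ p → ∑ (λ v → 𝟏 (Isolated? p v)) + d₁ * N * 𝟏 (Moved? p))  ≡⟨ cong (q *_) (trans (∑-+ _ _) (cong₂ _+_ (∑-swap _) (∑-* (d₁ * N) _))) ⟩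
    q * (isolated-lines + d₁ * N * d)  ≡⟨ *-distribˡ-+ q isolated-lines _ ⟩
    q * isolated-lines + q * (d₁ * N * d)  ≤⟨ +-mono-≤ isolated-lines-bound (≤-reflexive (cong (q *_) (*-comm (d₁ * N) d))) ⟩
    W + q * (d * (d₁ * N)) ∎
    where
    open ≤-Reasoning
    pointwise : ∀ p → A * 𝟏 (Moved? p) ≤ ∑ (λ v → 𝟏 (Isolated? p v)) + d₁ * N * 𝟏 (Moved? p)
    pointwise p = go (Moved? p)
      where
      go : (dec : Dec (Moved p)) → A * 𝟏 dec ≤ ∑ (λ v → 𝟏 (Isolated? p v)) + d₁ * N * 𝟏 dec
      go (no _) = ≤-trans (≤-reflexive (*-zeroʳ A)) z≤n
      go (yes mv) = begin
        A * 1  ≡⟨ *-identityʳ A ⟩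
        A  ≤⟨ isolated-at mv ⟩
        ∑ (λ v → 𝟏 (Isolated? p v)) + others p * N  ≡⟨ cong (λ x → ∑ (λ v → 𝟏 (Isolated? p v)) + x * N) (suc-injective (trans (1+others mv) d≡)) ⟩
        ∑ (λ v → 𝟏 (Isolated? p v)) + d₁ * N  ≡⟨ cong (∑ (λ v → 𝟏 (Isolated? p v)) +_) (*-identityʳ (d₁ * N)) ⟨
        ∑ (λ v → 𝟏 (Isolated? p v)) + d₁ * N * 1 ∎

  defect-≥ : ∀ {k} (x : Fin k → Point) → (∀ i j → x i ≡ x j → i ≡ j) → (∀ i → Moved (x i)) → k ≤ d
  defect-≥ {k} x x-inj moved = ≤-trans (≤-reflexive (sym (trans (∑-const {Fin k} 1) (trans (*-identityʳ _) (card-Fin k)))))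
    (∑-≤-injective x (λ i → ≤-reflexive (sym (𝟏-yes (Moved? (x i)) (moved i)))) (λ i j _ _ → x-inj i j))

  SwapsTwo : Set
  SwapsTwo = ∃ λ p → ∃ λ r → p ≢ r × f p ≡ h r × f r ≡ h p × (∀ x → x ≢ p → x ≢ r → f x ≡ h x)

  private
    -- The point `r` is where `h` takes the value `f p`; were it not moved, `f r` would equal `f p`.
    -- In particular there is never just one moved point.
    moved-preimage : ∀ {p} → Moved p → ∃ λ r → f p ≡ h r × p ≢ r × Moved r
    moved-preimage {p} moved = let (r , hr≡) = semiaffine-surjective h-semiaffine (f p) in
      r , sym hr≡ , (λ p≡r → moved (trans (sym hr≡) (cong h (sym p≡r)))) ,
      λ fr≡hr → moved (trans (sym hr≡) (cong h (inj _ _ (trans fr≡hr hr≡))))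

    pair : Point → Point → Fin 2 → Point
    pair p r 0F = p
    pair p r 1F = r

    triple : Point → Point → Point → Fin 3 → Point
    triple p r x 0F = p
    triple p r x 1F = r
    triple p r x 2F = x

  two-moved : ∀ {p} → Moved p → 2 ≤ d
  two-moved {p} moved with moved-preimage moved
  ... | r , _ , p≢r , moved-r = defect-≥ (pair p r)
    (λ { 0F 0F _ → refl ; 0F 1F e → contradiction e p≢r ; 1F 0F e → contradiction (sym e) p≢r ; 1F 1F _ → refl })
    (λ { 0F → moved ; 1F → moved-r })

  swaps-two : ∀ {p} → Moved p → d ≤ 2 → SwapsTwo
  swaps-two {p} moved d≤2 with moved-preimage moved
  ... | r , fp≡hr , p≢r , moved-r with moved-preimage moved-r
  ... | x , fr≡hx , r≢x , moved-x = p , r , p≢r , fp≡hr , trans fr≡hx (cong h (only moved-x (r≢x ∘ sym))) ,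
        λ y y≢p y≢r → decidable-stable (f y ≟ h y) (λ mv → y≢p (only mv y≢r))
    where
    only : ∀ {y} → Moved y → y ≢ r → y ≡ p
    only {y} mv y≢r = decidable-stable (y ≟ p) λ y≢p → contradiction (defect-≥ (triple p r y)
      (λ { 0F 0F _ → refl ; 1F 1F _ → refl ; 2F 2F _ → refl
         ; 0F 1F e → contradiction e p≢r ; 1F 0F e → contradiction (sym e) p≢r
         ; 0F 2F e → contradiction (sym e) y≢p ; 2F 0F e → contradiction e y≢p
         ; 1F 2F e → contradiction (sym e) y≢r ; 2F 1F e → contradiction e y≢r })
      (λ { 0F → moved ; 1F → moved-r ; 2F → mv })) (<⇒≱ (s≤s d≤2))

  module _ {E : ℕ} (E+2≡q : E + 2 ≡ q) (Nd≤ : N * d ≤ 4 * q * E) where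

    open +-*-Solver using () renaming (solve to solve′; _:+_ to _:+′_; _:*_ to _:*′_; _:=_ to _:=′_; con to con′)
    open ≤-Reasoning

    two-defects : d ≡ 2 → 2 * q * (q * m) ≤ W
    two-defects d≡2 = +-cancelʳ-≤ (q * (2 * (1 * N))) _ _ (begin
      2 * q * (q * m) + q * (2 * (1 * N))  ≡⟨ solve′ 3 (λ q m n → con′ 2 :*′ q :*′ (q :*′ m) :+′ q :*′ (con′ 2 :*′ (con′ 1 :*′ n)) :=′ q :*′ (con′ 2 :*′ (n :+′ q :*′ m))) refl q m N ⟩
      q * (2 * A)  ≡⟨ cong (λ x → q * (x * A)) d≡2 ⟨
      q * (d * A)  ≤⟨ defect-count d≡2 ⟩
      W + q * (d * (1 * N))  ≡⟨ cong (λ x → W + q * (x * (1 * N))) d≡2 ⟩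
      W + q * (2 * (1 * N)) ∎)

    -- For `d > 2` the count of isolated lines gives `q * m ≤ d * N`, and gluing gave
    -- `N * d ≤ 4 * q * E` with `E = q - 2`. Hence `m + 1 ≤ 4 * E + 1`, which is less than
    -- `(E + 2)^2 = q * q`.
    few⇒d≤2 : W ≤ 2 * q * (q * m) → d ≤ 2
    few⇒d≤2 few with d ≤? 2
    ... | yes d≤2 = d≤2
    ... | no d≰2 = contradiction (≤-trans q²≤ (s≤s m≤4E)) (<⇒≱ (begin-strict
      suc (4 * E)  <⟨ s≤s (m<m+n (4 * E) {3} (s≤s z≤n)) ⟩
      suc (4 * E + 3)  ≤⟨ m≤m+n _ (E * E) ⟩
      suc (4 * E + 3) + E * E  ≡⟨ solve′ 1 (λ e → con′ 1 :+′ (con′ 4 :*′ e :+′ con′ 3) :+′ e :*′ e :=′ (e :+′ con′ 2) :*′ (e :+′ con′ 2)) refl E ⟩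
      (E + 2) * (E + 2)  ≡⟨ cong₂ _*_ E+2≡q E+2≡q ⟩
      q * q ∎))
      where
      j : ℕ
      j = d ∸ 3
      d≡ : d ≡ suc (suc (suc j))
      d≡ = sym (m+[n∸m]≡n (≰⇒> d≰2))
      -- Comparing W ≤ 2q·qm with defect-count at d = 3 + j and dividing by q(1 + j).
      qm≤dN : q * m ≤ d * N
      qm≤dN = *-cancelˡ-≤ (suc j) (*-cancelˡ-≤ q (+-cancelʳ-≤ (q * (d * N) + 2 * q * (q * m)) _ _ (begin
        q * (suc j * (q * m)) + (q * (d * N) + 2 * q * (q * m))  ≡⟨ cong (λ x → q * (suc j * (q * m)) + (q * (x * N) + 2 * q * (q * m))) d≡ ⟩
        q * (suc j * (q * m)) + (q * (suc (suc (suc j)) * N) + 2 * q * (q * m))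
          ≡⟨ solve′ 4 (λ q j m n → q :*′ ((con′ 1 :+′ j) :*′ (q :*′ m)) :+′ (q :*′ ((con′ 3 :+′ j) :*′ n) :+′ con′ 2 :*′ q :*′ (q :*′ m)) :=′ q :*′ ((con′ 3 :+′ j) :*′ (n :+′ q :*′ m))) refl q j m N ⟩
        q * (suc (suc (suc j)) * A)  ≡⟨ cong (λ x → q * (x * A)) d≡ ⟨
        q * (d * A)  ≤⟨ defect-count d≡ ⟩
        W + q * (d * (suc (suc j) * N))  ≤⟨ +-monoˡ-≤ _ few ⟩
        2 * q * (q * m) + q * (d * (suc (suc j) * N))  ≡⟨ solve′ 5 (λ q j m n d → con′ 2 :*′ q :*′ (q :*′ m) :+′ q :*′ (d :*′ ((con′ 2 :+′ j) :*′ n)) :=′ q :*′ ((con′ 1 :+′ j) :*′ (d :*′ n)) :+′ (q :*′ (d :*′ n) :+′ con′ 2 :*′ q :*′ (q :*′ m))) refl q j m N d ⟩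
        q * (suc j * (d * N)) + (q * (d * N) + 2 * q * (q * m)) ∎)))
      m≤4E : m ≤ 4 * E
      m≤4E = *-cancelˡ-≤ q (begin
        q * m  ≤⟨ qm≤dN ⟩
        d * N  ≡⟨ *-comm d N ⟩
        N * d  ≤⟨ Nd≤ ⟩
        4 * q * E  ≡⟨ solve′ 2 (λ q e → con′ 4 :*′ q :*′ e :=′ q :*′ (con′ 4 :*′ e)) refl q E ⟩
        q * (4 * E) ∎)

    -- The value `d = 0` would make `f` semi-affine and `d = 1` is excluded by `two-moved`. Only
    -- `d = 2` is left, where the isolated lines alone reach the bound.
    few⇒swap : W ≤ 2 * q * (q * m) → ¬ IsSemiAffine f → 2 * q * (q * m) ≤ W × SwapsTwo
    few⇒swap few ¬sa with ∃? Moved?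
    ... | no none = contradiction (semiaffine-cong h-semiaffine (λ x → decidable-stable (f x ≟ h x) (λ mv → none (x , mv)))) ¬sa
    ... | yes (p , moved) = two-defects (≤-antisym (few⇒d≤2 few) (two-moved moved)) , swaps-two moved (few⇒d≤2 few)

-- From weights to numbers of lines, and the equality case.

module Coaffinity {q} {K : FiniteField q} {n : ℕ} (S : Space K n)
  {α : FiniteField.Carrier K} (α≢0 : α ≢ FiniteField.0# K) (α≢1 : α ≢ FiniteField.1# K)
  (3≤q : 3 ≤ q) {m : ℕ} (size : q * suc m ≡ q ^ n) (q²≤ : q * q ≤ suc m)
  (f : Space.Point S → Space.Point S) (inj : ∀ x y → f x ≡ f y → x ≡ y) where
  open FiniteField K using (Carrier; 0#; 1#; -_; 0≢1) renaming (_+_ to _+ᴷ_; _*_ to _*ᴷ_)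
  open Vectors S hiding (+-comm; +-assoc; *-comm; *-assoc; +-identityʳ; +-identityˡ; *-identityʳ; *-identityˡ; *-cancelˡ)
  open Variables
  open Lines S
  open SemiAffine S
  open DoubleCosets S
  open GoodLevels S α≢0 α≢1 3≤q size q²≤ f inj public

  private
    OnLine? : ∀ b v x → Dec (OnLine b v x)
    OnLine? b v x = ∃? (λ t → x ≟ b ⊕ (t · v))

    _~_ : Point × Point → Point × Point → Set
    (b , v) ~ (b′ , v′) = SameLine b v b′ v′

    _~?_ : ∀ x y → Dec (x ~ y)
    (b , v) ~? (b′ , v′) = ∀? λ x → map′ (λ (to , from) → mk⇔ to from) (λ e → Equivalence.to e , Equivalence.from e)
      ((OnLine? b v x →-dec OnLine? b′ v′ x) ×-dec (OnLine? b′ v′ x →-dec OnLine? b v x))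

    Bad : Point × Point → Set
    Bad (b , v) = ¬ Good f b v

    Bad? : ∀ x → Dec (Bad x)
    Bad? (b , v) = ¬? (Good? f b v)

    Bad-resp : ∀ {x y} → x ~ y → Bad x → Bad y
    Bad-resp {b , v} {b′ , v′} same bad g = let (c , d , on) = Good-on g in
      bad (good c d λ t → on (Equivalence.to (same _) (t , refl)))

    open Representatives _~?_ (λ x → mk⇔ id id) (λ s x → mk⇔ (Equivalence.from (s x)) (Equivalence.to (s x)))
      (λ s s′ x → mk⇔ (Equivalence.to (s′ x) ∘ Equivalence.to (s x)) (Equivalence.from (s x) ∘ Equivalence.from (s′ x)))
      Bad? Bad-resp

    -- The line is presented by `q` base points and `N` direction vectors. A pair with zero
    -- direction cannot present it, since it describes a single point.
    class-size : ∀ x → Bad x → ∑ (λ y → 𝟏 (y ~? x)) ≡ q * N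
    class-size (b , v) bad = trans (≤-antisym
        (∑-≤-surjective φ {χ = λ x → nonzero (proj₂ x)} (λ y ≢0 → covered y (𝟏-≢0 (y ~? (b , v)) ≢0)))
        (∑-≤-injective φ same (λ x x′ _ _ → φ-injective x x′)))
      (trans (∑-× (λ _ x → nonzero x)) (∑ᴷ-const N))
      where
      v≢𝟘 : v ≢ 𝟘
      v≢𝟘 = ¬Good⇒≢𝟘 bad
      φ : Carrier × Carrier → Point × Point
      φ (s , x) = b ⊕ (s · v) , x · v
      φ-injective : ∀ x x′ → φ x ≡ φ x′ → x ≡ x′
      φ-injective (s , x) (s′ , x′) e = cong₂ _,_
        (·-injective v≢𝟘 (trans (sym (⊕-⊝ b _)) (trans (cong (_⊝ b) (cong proj₁ e)) (⊕-⊝ b _))))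
        (·-injective v≢𝟘 (cong proj₂ e))
      same : ∀ x → nonzero (proj₂ x) ≤ 𝟏 (φ x ~? (b , v))
      same (s , x) = 𝟏-mono (¬? (0# ≟ x)) (φ (s , x) ~? (b , v)) λ 0≢x y → mk⇔
        (λ { (t , refl) → s +ᴷ (t *ᴷ x) , vsolve (s ∷ t ∷ x ∷ []) (b ∷ v ∷ []) (v₀ ⊞ s₀ ⊡ v₁ ⊞ s₁ ⊡ (s₂ ⊡ v₁)) (v₀ ⊞ (s₀ :+ s₁ :* s₂) ⊡ v₁) (refl , refl , _) })
        (λ { (t , refl) → (t +ᴷ - s) *ᴷ inv (0≢x ∘ sym) , from-difference (cong (_· ((t +ᴷ - s) · v)) (sym (inv-right (0≢x ∘ sym))))
          (vsolve (s ∷ t ∷ x ∷ inv (0≢x ∘ sym) ∷ []) (b ∷ v ∷ [])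
            (v₀ ⊞ s₁ ⊡ v₁ ⊞ (s₂ :* s₃) ⊡ ((s₁ :- s₀) ⊡ v₁))
            (v₀ ⊞ s₀ ⊡ v₁ ⊞ ((s₁ :- s₀) :* s₃) ⊡ (s₂ ⊡ v₁) ⊞ one ⊡ ((s₁ :- s₀) ⊡ v₁)) (refl , refl , _)) })
      covered : ∀ y → y ~ (b , v) → ∃ λ x → φ x ≡ y × 𝟏 (y ~? (b , v)) ≤ nonzero (proj₂ x)
      covered (b′ , v′) s~ with Equivalence.to (s~ b′) (OnLine-base b′ v′) | Equivalence.to (s~ (b′ ⊕ v′)) (OnLine-tip b′ v′)
      ... | s , b′≡ | s′ , tip≡ = (s , s′ +ᴷ - s) , cong₂ _,_ (sym b′≡) (sym v′≡) ,
            ≤-trans (𝟏-≤1 ((b′ , v′) ~? (b , v))) (≤-reflexive (sym (𝟏-yes (¬? (0# ≟ s′ +ᴷ - s)) nontrivial)))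
        where
        v′≡ : v′ ≡ (s′ +ᴷ - s) · v
        v′≡ = from-difference (cong₂ _⊝_ tip≡ b′≡)
          (vsolve (s ∷ s′ ∷ []) (b ∷ v ∷ b′ ∷ v′ ∷ []) (v₃ ⊞ (v₀ ⊞ s₁ ⊡ v₁ ⊟ (v₀ ⊞ s₀ ⊡ v₁))) ((s₁ :- s₀) ⊡ v₁ ⊞ (v₂ ⊞ v₃ ⊟ v₂)) (refl , refl , refl , refl , _))
        point : ∀ {x} → v′ ≡ 𝟘 → OnLine b′ v′ x → x ≡ b′
        point v′≡𝟘 (t , e) = trans e (trans (cong (b′ ⊕_) (trans (cong (t ·_) v′≡𝟘) (·𝟘 t))) (⊕𝟘 b′))
        nontrivial : 0# ≢ s′ +ᴷ - s
        nontrivial e = v≢𝟘 (trans (sym (⊕-⊝ b v)) (trans (cong (_⊝ b) tip≡base) (vsolve [] (b ∷ []) (v₀ ⊟ v₀) 𝟎 (refl , _))))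
          where
          v′≡𝟘 : v′ ≡ 𝟘
          v′≡𝟘 = trans v′≡ (trans (cong (_· v) (sym e)) (0· v))
          tip≡base : b ⊕ v ≡ b
          tip≡base = trans (point v′≡𝟘 (Equivalence.from (s~ (b ⊕ v)) (OnLine-tip b v))) (sym (point v′≡𝟘 (Equivalence.from (s~ b) (OnLine-base b v))))

  coaffinity : ∃ λ k → HasCoaffinity f k × W ≡ k * (q * N)
  coaffinity = let (k , T) = transversal in k , has T , trans (sym total) (∑-classes T class-size)
    where
    total : ∑ (λ x → 𝟏 (Bad? x)) ≡ W
    total = trans (∑-× (λ b v → β b v)) (∑-swap β)
    has : ∀ {k} → Transversal k elements → HasCoaffinity f k
    has T = proj₁ ∘ rep , proj₂ ∘ rep , (λ i → ¬Good⇒≢𝟘 (rep-P i)) ,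
      (λ i → Equivalence.from (BadLine⇔¬Good inj (¬Good⇒≢𝟘 (rep-P i))) (rep-P i)) ,
      distinct , λ b v v≢𝟘 bad → covers (b , v) (complete (b , v)) (Equivalence.to (BadLine⇔¬Good inj v≢𝟘) bad)
      where open Transversal T

  SemiAffineSwap : Set
  SemiAffineSwap = Σ (Point → Point) λ h → IsSemiAffine h × ∃ λ p → ∃ λ r →
    p ≢ r × f p ≡ h r × f r ≡ h p × (∀ x → x ≢ p → x ≢ r → f x ≡ h x)

  few⇒swap : W ≤ 2 * q * (q * m) → ¬ IsSemiAffine f → 2 * q * (q * m) ≤ W × SemiAffineSwap
  few⇒swap few ¬sa = go (few⇒two-good-levels few)
    where
    go : (∃ λ a → a ≢ 𝟘 × TwoGoodLevels a) → 2 * q * (q * m) ≤ W × SemiAffineSwap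
    go (a , a≢𝟘 , c , c′ , c≢c′ , level , level′) =
      let (bound , swap) = Defect.few⇒swap S α≢0 α≢1 3≤q size q²≤ f inj G.h-semiaffine G.2+inner-levels G.defect-bound few ¬sa
      in bound , G.h , G.h-semiaffine , swap
      where
      u : Point
      u = proj₁ (∙-nondegenerate a a≢𝟘)
      au≡1 : a ∙ u ≡ 1#
      au≡1 = proj₂ (∙-nondegenerate a a≢𝟘)
      δ≢0 : c′ +ᴷ - c ≢ 0#
      δ≢0 = -‿≢0 (c≢c′ ∘ sym)
      -- The functional is rescaled so that the two good levels differ by 1, as gluing requires; `b`
      -- and `b ⊕ e` lie on the levels `c` and `c′` of `a`.
      a′ e b : Point
      a′ = inv δ≢0 · a
      e = (c′ +ᴷ - c) · u
      b = c · u
      a′∙ : ∀ x → a′ ∙ x ≡ inv δ≢0 *ᴷ (a ∙ x)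
      a′∙ x = trans (∙-comm a′ x) (trans (∙-· x (inv δ≢0) a) (cong (inv δ≢0 *ᴷ_) (∙-comm x a)))
      a∙u : ∀ t → a ∙ (t · u) ≡ t
      a∙u t = trans (∙-· a t u) (trans (cong (t *ᴷ_) au≡1) (solve 1 (λ t → t :* con (ℤ.+ 1) := t) refl t))
      kernel : ∀ {x} → a′ ∙ x ≡ 0# → a ∙ x ≡ 0#
      kernel {x} e = Vectors.*-cancelˡ S (inv-≢0 δ≢0) (trans (sym (a′∙ x)) (trans e (sym (zeroʳ _))))
      a′e≡1 : a′ ∙ e ≡ 1#
      a′e≡1 = trans (a′∙ e) (trans (cong (inv δ≢0 *ᴷ_) (a∙u _)) (inv-left δ≢0))
      good₁ : ∀ r v → a′ ∙ r ≡ 0# → a′ ∙ v ≡ 0# → Good f (b ⊕ r) v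
      good₁ r v r0 v0 = level (b ⊕ r) v (trans (∙-⊕ a b r) (trans (cong₂ _+ᴷ_ (a∙u c) (kernel r0)) (solve 1 (λ c → c :+ con (ℤ.+ 0) := c) refl c))) (kernel v0)
      good₂ : ∀ r v → a′ ∙ r ≡ 0# → a′ ∙ v ≡ 0# → Good f ((b ⊕ e) ⊕ r) v
      good₂ r v r0 v0 = level′ ((b ⊕ e) ⊕ r) v (trans (∙-⊕ a (b ⊕ e) r) (trans (cong₂ _+ᴷ_ (trans (∙-⊕ a b e) (cong₂ _+ᴷ_ (a∙u c) (a∙u _))) (kernel r0))
        (solve 2 (λ c c′ → (c :+ (c′ :- c)) :+ con (ℤ.+ 0) := c′) refl c c′))) (kernel v0)
      module G = Gluing.Glued S α≢0 α≢1 3≤q size q²≤ f inj a′e≡1 good₁ good₂ few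

  -- Away from the preimages `p` and `r` of the transposed points `f` agrees with the semi-affine
  -- map `g ∘ h`, so a bad line contains exactly one of them. Directions in `⟨r ⊝ p⟩` give no bad
  -- lines, and each other direction has at most `q` base points for `p` and `q` for `r`.
  double-coset⇒few : ∀ {τ} → IsTransposition τ → InDoubleCoset τ f → W ≤ 2 * q * (q * m)
  double-coset⇒few {τ} (x , y , x≢y , τx , τy , τ-rest) (g , h , sa-g , sa-h , f≡) = begin
    ∑ (λ v → ∑ (λ b → β b v))  ≤⟨ ∑-mono each ⟩
    ∑ (λ v → (2 * q) * κ v)  ≡⟨ ∑-* (2 * q) κ ⟩
    2 * q * ∑ κ  ≤⟨ *-monoʳ-≤ (2 * q) κ-bound ⟩
    2 * q * (q * m) ∎
    where
    open ≤-Reasoning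
    p r u : Point
    p = proj₁ (semiaffine-surjective sa-h x)
    r = proj₁ (semiaffine-surjective sa-h y)
    u = r ⊝ p
    hp≡x : h p ≡ x
    hp≡x = proj₂ (semiaffine-surjective sa-h x)
    hr≡y : h r ≡ y
    hr≡y = proj₂ (semiaffine-surjective sa-h y)
    h-inj : ∀ z z′ → h z ≡ h z′ → z ≡ z′
    h-inj = semiaffine-injective sa-h
    u≢𝟘 : u ≢ 𝟘
    u≢𝟘 e = x≢y (trans (sym hp≡x) (trans (cong h (sym (⊝≡𝟘 e))) hr≡y))
    κ : Point → ℕ
    κ v = 𝟏 (¬? (v ∈⟨ u ⟩?))
    κ-bound : ∑ κ ≤ q * m
    κ-bound = +-cancelˡ-≤ q (∑ κ) (q * m) (begin
      q + ∑ κ  ≤⟨ +-monoˡ-≤ (∑ κ) q≤inside ⟩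
      ∑ (λ v → 𝟏 (v ∈⟨ u ⟩?)) + ∑ κ  ≡⟨ ∑-+ _ κ ⟨
      ∑ (λ v → 𝟏 (v ∈⟨ u ⟩?) + κ v)  ≡⟨ ∑-cong (λ v → 𝟏-¬ (v ∈⟨ u ⟩?)) ⟩
      ∑ {Point} (λ _ → 1)  ≡⟨ trans (∑ᴾ-const 1) (*-identityʳ _) ⟩
      q ^ n  ≡⟨ trans (sym size) (*-suc q m) ⟩
      q + q * m ∎)
      where
      q≤inside : q ≤ ∑ (λ v → 𝟏 (v ∈⟨ u ⟩?))
      q≤inside = ≤-trans (≤-reflexive (trans (sym (*-identityʳ q)) (sym (∑ᴷ-const 1)))) (∑-≤-injective (_· u)
        (λ t → ≤-reflexive (sym (𝟏-yes ((t · u) ∈⟨ u ⟩?) (t , refl)))) (λ _ _ _ _ → ·-injective u≢𝟘))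
    good-if : ∀ {b v} → (OnLine b v p → OnLine b v r) → (OnLine b v r → OnLine b v p) → Good f b v
    good-if {b} {v} p⇒r r⇒p = let (c , d , on) = Good-on (semiaffine-good (semiaffine-∘ sa-g sa-h) b v) in
      good c d λ t → let (z , on-z , eq) = replaced t in subst (OnLine c d) (sym eq) (on on-z)
      where
      replaced : ∀ t → ∃ λ z → OnLine b v z × f (b ⊕ (t · v)) ≡ g (h z)
      replaced t with (b ⊕ (t · v)) ≟ p | (b ⊕ (t · v)) ≟ r
      ... | yes z≡p | _ = r , p⇒r (t , sym z≡p) , trans (f≡ _) (cong g (trans (cong (τ ∘ h) z≡p) (trans (cong τ hp≡x) (trans τx (sym hr≡y)))))
      ... | no _ | yes z≡r = p , r⇒p (t , sym z≡r) , trans (f≡ _) (cong g (trans (cong (τ ∘ h) z≡r) (trans (cong τ hr≡y) (trans τy (sym hp≡x)))))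
      ... | no z≢p | no z≢r = b ⊕ (t · v) , (t , refl) , trans (f≡ _) (cong g (τ-rest _
              (λ e → z≢p (h-inj _ _ (trans e (sym hp≡x)))) (λ e → z≢r (h-inj _ _ (trans e (sym hr≡y))))))
    transfer : ∀ {b v z z′ s} → s ≢ 0# → v ≡ s · (z′ ⊝ z) → OnLine b v z → OnLine b v z′
    transfer {b} {v} {z} {z′} {s} s≢0 v≡ (t , z≡) = t +ᴷ inv s≢0 , trans (sym (⊕⊝ z z′))
      (trans (cong₂ _⊕_ z≡ (trans (sym (inv-· s≢0 _)) (cong (inv s≢0 ·_) (sym v≡))))
        (trans (⊕-assoc _ _ _) (cong (b ⊕_) (sym (·-distribʳ t (inv s≢0) v)))))
    each : ∀ v → ∑ (λ b → β b v) ≤ 2 * q * κ v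
    each v with v ∈⟨ u ⟩?
    ... | yes (s , v≡su) = ≤-trans (≤-reflexive (trans (∑-cong (λ b → 𝟏-no (¬? (Good? f b v)) (λ bad → bad (good-if
              (transfer (s≢0 bad) v≡su) (transfer {s = - s} (-s≢0 bad) v≡)))))
            (∑-* 0 (λ (_ : Point) → 0)))) z≤n
      where
      s≢0 : ∀ {b} → ¬ Good f b v → s ≢ 0#
      s≢0 bad s≡0 = ¬Good⇒≢𝟘 bad (trans v≡su (trans (cong (_· u) s≡0) (0· u)))
      v≡ : v ≡ (- s) · (p ⊝ r)
      v≡ = trans v≡su (vsolve (s ∷ []) (p ∷ r ∷ []) (s₀ ⊡ (v₁ ⊟ v₀)) ((:- s₀) ⊡ (v₀ ⊟ v₁)) (refl , refl , _))
      -s≢0 : ∀ {b} → ¬ Good f b v → - s ≢ 0#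
      -s≢0 bad e = ¬Good⇒≢𝟘 bad (trans v≡ (trans (cong (_· (p ⊝ r)) e) (0· _)))
    ... | no _ = begin
      ∑ (λ b → β b v)  ≤⟨ ∑-mono through ⟩
      ∑ (λ b → 𝟏 (OnLine? b v p) + 𝟏 (OnLine? b v r))  ≡⟨ ∑-+ _ _ ⟩
      ∑ (λ b → 𝟏 (OnLine? b v p)) + ∑ (λ b → 𝟏 (OnLine? b v r))  ≤⟨ +-mono-≤ (pencil p) (pencil r) ⟩
      q + q  ≡⟨ trans (cong (q +_) (sym (+-identityʳ q))) (sym (*-identityʳ (2 * q))) ⟩
      2 * q * 1 ∎
      where
      pencil : ∀ z → ∑ (λ b → 𝟏 (OnLine? b v z)) ≤ q
      pencil z = ≤-trans (∑-≤-surjective (λ t → z ⊕ (t · v)) {χ = λ _ → 1} (λ b ≢0 →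
          let (t , e) = OnLine-sym (𝟏-≢0 (OnLine? b v z) ≢0) in t , sym e , 𝟏-≤1 (OnLine? b v z)))
        (≤-reflexive (trans (∑ᴷ-const 1) (*-identityʳ q)))
      through : ∀ b → β b v ≤ 𝟏 (OnLine? b v p) + 𝟏 (OnLine? b v r)
      through b with OnLine? b v p | OnLine? b v r
      ... | yes _ | _ = ≤-trans (𝟏-≤1 (¬? (Good? f b v))) (m≤m+n 1 _)
      ... | no _ | yes _ = 𝟏-≤1 (¬? (Good? f b v))
      ... | no ¬p | no ¬r = ≤-reflexive (𝟏-no (¬? (Good? f b v)) (λ bad → bad (good-if (λ on → contradiction on ¬p) (λ on → contradiction on ¬r))))

  -- Here `γ` is the Gaussian binomial coefficient. By `m ≡ (q ∸ 1) * γ` the weight of `2 * q * γ`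
  -- lines is exactly the threshold `2 * q * (q * m)`.
  coaffinity-theorem : ∀ {γ} → m ≡ (q ∸ 1) * γ → ¬ IsSemiAffine f →
    ∃ λ k → HasCoaffinity f k × 2 * q * γ ≤ k
      × (∀ τ → IsTransposition τ → (k ≡ 2 * q * γ ⇔ InDoubleCoset τ f))
  coaffinity-theorem {γ} m≡ ¬sa = go coaffinity
    where
    open ≤-Reasoning
    instance
      qN-nonZero : NonZero (q * N)
      qN-nonZero = >-nonZero (*-mono-≤ (≤-trans (s≤s z≤n) 3≤q) (≤-trans (s≤s z≤n) 2≤N))
    threshold : 2 * q * γ * (q * N) ≡ 2 * q * (q * m)
    threshold = trans (solve′ 3 (λ q g n → con′ 2 :*′ q :*′ g :*′ (q :*′ n) :=′ con′ 2 :*′ q :*′ (q :*′ (n :*′ g))) refl q γ N) (cong (λ m → 2 * q * (q * m)) (sym (trans m≡ (cong (λ q → (q ∸ 1) * γ) (sym 1+N≡q)))))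
      where open +-*-Solver using () renaming (solve to solve′; _:*_ to _:*′_; _:=_ to _:=′_; con to con′)
    go : (∃ λ k → HasCoaffinity f k × W ≡ k * (q * N)) → ∃ λ k → HasCoaffinity f k × 2 * q * γ ≤ k
      × (∀ τ → IsTransposition τ → (k ≡ 2 * q * γ ⇔ InDoubleCoset τ f))
    go (k , has , W≡) = k , has , lower , λ τ transposition → mk⇔
      (λ k≡ → in-coset transposition (proj₂ (few⇒swap (≤-reflexive (trans W≡ (trans (cong (_* (q * N)) k≡) threshold))) ¬sa)))
      (λ coset → ≤-antisym (*-cancelʳ-≤ k (2 * q * γ) (q * N) (begin
          k * (q * N)  ≡⟨ W≡ ⟨
          W  ≤⟨ double-coset⇒few transposition coset ⟩
          2 * q * (q * m)  ≡⟨ threshold ⟨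
          2 * q * γ * (q * N) ∎)) lower)
      where
      in-coset : ∀ {τ} → IsTransposition τ → SemiAffineSwap → InDoubleCoset τ f
      in-coset {τ} transposition (h , sa , p , r , p≢r , fp , fr , rest) = swap⇒double-coset sa p≢r fp fr rest τ transposition
      lower : 2 * q * γ ≤ k
      lower with 2 * q * γ ≤? k
      ... | yes ≤k = ≤k
      ... | no ≰k = contradiction (begin-strict
        W  ≡⟨ W≡ ⟩
        k * (q * N)  <⟨ *-monoˡ-< (q * N) (≰⇒> ≰k) ⟩
        2 * q * γ * (q * N)  ≡⟨ threshold ⟩
        2 * q * (q * m)  ∎) (λ W< → <⇒≱ W< (proj₁ (few⇒swap (<⇒≤ W<) ¬sa)))

-- The geometric series without subtraction; it exhibits `q^k` in the form `suc m`.
power≡gauss : ∀ q₁ k → suc q₁ ^ k ≡ suc (q₁ * gauss1 k (suc q₁))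
power≡gauss q₁ zero  = cong suc (sym (*-zeroʳ q₁))
power≡gauss q₁ (suc k) = begin
  suc q₁ ^ k + q₁ * suc q₁ ^ k  ≡⟨ cong (_+ q₁ * suc q₁ ^ k) (power≡gauss q₁ k) ⟩
  suc (q₁ * gauss1 k (suc q₁) + q₁ * suc q₁ ^ k)  ≡⟨ cong suc (trans (+-comm (q₁ * gauss1 k (suc q₁)) _) (sym (*-distribˡ-+ q₁ (suc q₁ ^ k) _))) ⟩
  suc (q₁ * gauss1 (suc k) (suc q₁)) ∎
  where open ≡-Reasoning

theorem8p4 : (q : ℕ) (K : FiniteField q) → 3 ≤ q → (n : ℕ) → 3 ≤ n →
    let open Geometry K n in
    (f : Point ↔ Point) → ¬ IsSemiAffine (Inverse.to f) →
    ∃ λ k → HasCoaffinity (Inverse.to f) k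
    × 2 * q * gauss1 (n ∸ 1) q ≤ k
    × (∀ τ → IsTransposition τ →
    (k ≡ 2 * q * gauss1 (n ∸ 1) q ⇔ InDoubleCoset τ (Inverse.to f)))
-- Matching on `suc q₁` and `suc n₁` lets `q ∸ 1` and `n ∸ 1` compute, so that `m ≡ (q ∸ 1) * γ`
-- holds by `refl`.
theorem8p4 (suc q₁) K 3≤q (suc n₁) (s≤s 2≤n₁) f ¬sa =
  let (α , α≢0 , α≢1) = FieldFacts.∃≢0,1 K 3≤q in
  Coaffinity.coaffinity-theorem (Coordinates.space K (suc n₁)) α≢0 α≢1 3≤q
    {q₁ * gauss1 n₁ (suc q₁)} (cong (suc q₁ *_) (sym (power≡gauss q₁ n₁)))
    (≤-trans (≤-trans (≤-reflexive (cong (suc q₁ *_) (sym (*-identityʳ (suc q₁))))) (^-monoʳ-≤ (suc q₁) 2≤n₁)) (≤-reflexive (power≡gauss q₁ n₁)))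
    (Inverse.to f) (λ _ _ → Injection.injective (↔⇒↣ f))
    refl ¬sa
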